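{- Let $G$ be a planar PCC graph. Then $G$ has at most $208$ vertices.
   Context: All graphs are finite, simple (no loops or multiple edges), connected, and 2-cell embedded in the sphere; the set of faces includes the outer face. For a face $\sigma$, its size $|\sigma|$ is the number of edges in its boundary walk, counted with multiplicity. For a vertex $v$, $\deg(v)$ is its degree and $F(v)$ denotes the multiset of faces incident to $v$ (one entry for each corner at $v$, so $\#F(v)=\deg(v)$). The combinatorial curvature of $v$ is $K(v)=1-\frac{\deg(v)}{2}+\sum_{\sigma\in F(v)}\frac{1}{|\sigma|}$. The face vector $f(v)$ is the multiset of the sizes of the faces in $F(v)$. A prism of order $N$ is a planar graph with exactly $2N$ vertices, two faces of size $N$ and $N$ faces of size $4$, such that $f(v)=\{4,4,N\}$ for every vertex $v$. An antiprism of order $N$ is a planar graph with exactly $2N$ vertices, two faces of size $N$ and $2N$ faces of size $3$, such that $f(v)=\{3,3,3,N\}$ for every vertex $v$. A (planar) PCC graph is such a graph $G$ with (i) $K(v)>0$ for every vertex $v$, (ii) $\deg(v)\ge 3$ for every vertex $v$, and (iii) $G$ is not a prism or an antiprism. -}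

module Defs where

open import Data.Nat using (ℕ; zero; suc; _+_; _*_)
open import Data.Fin using (Fin; _≟_)
open import Data.Fin.Permutation using (Permutation′; _⟨$⟩ʳ_)
open import Data.List using (List; []; _∷_; filter; length; map; foldr; replicate)
open import Data.List.Relation.Binary.Permutation.Propositional using (_↭_)
open import Data.Product using (Σ; ∃; _×_; _,_)
open import Data.Sum using (_⊎_)
open import Data.Integer using (+_)
open import Data.Rational using (ℚ; 0ℚ; 1ℚ; _-_; _<_) renaming (_+_ to _+ℚ_; _/_ to _/ℚ_)
open import Function using (_∘_)
open import Relation.Binary.PropositionalEquality using (_≡_; _≢_)
open import Relation.Nullary using (¬_)

allFin : (n : ℕ) → List (Fin n)
allFin n = Data.List.allFin n

iter : {A : Set} → (A → A) → ℕ → A → A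
iter f zero x = x
iter f (suc k) x = f (iter f k x)

SameOrbit : {A : Set} → (A → A) → A → A → Set
SameOrbit f x y = ∃ λ k → iter f k x ≡ y

-- reachability under the group generated by σ and α (all generators
-- are permutations of a finite set, so forward steps suffice)
data Reach {n : ℕ} (σ α : Fin n → Fin n) : Fin n → Fin n → Set where
  here : ∀ {d} → Reach σ α d d
  stepσ : ∀ {d e} → Reach σ α d e → Reach σ α d (σ e)
  stepα : ∀ {d e} → Reach σ α d e → Reach σ α d (α e)

Surjective : {A B : Set} → (A → B) → Set
Surjective {A} {B} f = ∀ (b : B) → ∃ λ (a : A) → f a ≡ b

-- A connected graph 2-cell embedded in an orientable surface, given as a
-- combinatorial map (rotation system) on the dart set Fin darts.
--  * α : fixed-point-free involution pairing the two darts of each edge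
--  * σ : rotation at vertices; vertices = σ-orbits
--  * faces = orbits of φ = σ ∘ α (face boundary walks); the face of dart d
--    is the face at the corner of d's tail vertex that d represents.
-- Vertices and faces are labelled by Fin V and Fin F via the maps
-- vert / face, whose fibres are exactly the orbits.
record Map : Set where
  field
    darts : ℕ
    σ α : Permutation′ darts
    V F : ℕ
    vert : Fin darts → Fin V
    face : Fin darts → Fin F
  σf : Fin darts → Fin darts
  σf = σ ⟨$⟩ʳ_
  αf : Fin darts → Fin darts
  αf = α ⟨$⟩ʳ_
  φ : Fin darts → Fin darts
  φ = σf ∘ αf
  field
    α-invol : ∀ d → αf (αf d) ≡ d
    α-fpf : ∀ d → αf d ≢ d
    vert-surj : Surjective vert
    vert-orbit : ∀ d e → (vert d ≡ vert e → SameOrbit σf d e) × (SameOrbit σf d e → vert d ≡ vert e)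
    face-surj : Surjective face
    face-orbit : ∀ d e → (face d ≡ face e → SameOrbit φ d e) × (SameOrbit φ d e → face d ≡ face e)
    connected : ∀ d e → Reach σf αf d e

  dartsAt : Fin V → List (Fin darts)
  dartsAt v = filter (λ d → vert d ≟ v) (allFin darts)

  deg : Fin V → ℕ
  deg v = length (dartsAt v)

  -- |σ| : length of the boundary walk of face f (= number of darts in the φ-orbit)
  size : Fin F → ℕ
  size f = length (filter (λ d → face d ≟ f) (allFin darts))

  -- face vector f(v): sizes of the faces at the corners of v (multiset as list)
  faceVec : Fin V → List ℕ
  faceVec v = map (size ∘ face) (dartsAt v)

  faceSizes : List ℕ
  faceSizes = map size (allFin F)

open Map public

-- 1 / k in ℚ (k = 0 never occurs for actual face sizes)
inv : ℕ → ℚ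
inv zero = 0ℚ
inv (suc k) = (+ 1) /ℚ (suc k)

sumℚ : List ℚ → ℚ
sumℚ = foldr _+ℚ_ 0ℚ

curvature : (M : Map) → Fin (V M) → ℚ
curvature M v = (1ℚ - ((+ deg M v) /ℚ 2)) +ℚ sumℚ (map inv (faceVec M v))

Simple : Map → Set
Simple M =
  (∀ d → vert M (αf M d) ≢ vert M d) ×
  (∀ d e → vert M d ≡ vert M e → vert M (αf M d) ≡ vert M (αf M e) → d ≡ e)

-- embedded in the sphere: Euler's formula V - E + F = 2 with E = darts/2,
-- i.e. 2V + 2F = darts + 4 (for a connected orientable map this means genus 0)
Spherical : Map → Set
Spherical M = 2 * V M + 2 * F M ≡ darts M + 4

PlanarGraph : Map → Set
PlanarGraph M = Simple M × Spherical M

IsPrism : Map → Set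
IsPrism M = ∃ λ N → (V M ≡ 2 * N) ×
  (faceSizes M ↭ (N ∷ N ∷ replicate N 4)) ×
  (∀ v → faceVec M v ↭ (4 ∷ 4 ∷ N ∷ []))

IsAntiprism : Map → Set
IsAntiprism M = ∃ λ N → (V M ≡ 2 * N) ×
  (faceSizes M ↭ (N ∷ N ∷ replicate (2 * N) 3)) ×
  (∀ v → faceVec M v ↭ (3 ∷ 3 ∷ 3 ∷ N ∷ []))

PCC : Map → Set
PCC M = PlanarGraph M ×
  (∀ v → 0ℚ < curvature M v) ×
  (∀ v → 3 Data.Nat.≤ deg M v) ×
  ¬ IsPrism M × ¬ IsAntiprism M

{-# OPTIONS --safe #-}
module Submission where

open import Defs hiding (darts; σ; α; V; F; vert; face; σf; αf; φ; α-invol; α-fpf; vert-surj; vert-orbit; face-surj; face-orbit; connected; dartsAt; deg; size; faceVec; faceSizes)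
open import Algebra.Bundles using (CommutativeMonoid)
import Algebra.Properties.CommutativeMonoid.Sum as Sum
open import Algebra.Structures using (IsCommutativeMonoid)
open import Data.Bool.Base using (Bool; T; _∧_; _∨_; false; if_then_else_; not; true)
open import Data.Bool.ListAction using (all; any)
open import Data.Bool.Properties using (T-≡; ∧-zeroʳ)
open import Data.Empty using (⊥; ⊥-elim)
open import Data.Fin.Base using (Fin; punchIn; suc; toℕ; zero)
open import Data.Fin.Permutation using (Permutation′; _∘ₚ_; _⟨$⟩ʳ_; inverseˡ)
import Data.Fin.Properties as Finₚ
open import Data.Integer.Base as ℤ using (+_; -[1+_]; 0ℤ; ℤ)
import Data.Integer.Properties as ℤₚ
import Data.List.Base as List
open import Data.List.Base using (List; []; _++_; _∷_; _∷ʳ_; applyUpTo; concatMap; drop; filter; filterᵇ; foldr; length; map; replicate; reverse; tabulate; upTo; zipWith)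
open import Data.List.Membership.Propositional using (_∈_; lose)
open import Data.List.Membership.Propositional.Properties using (∈-allFin; ∈-applyUpTo⁺; ∈-applyUpTo⁻; ∈-concatMap⁺; ∈-filter⁺; ∈-filter⁻; ∈-map⁺)
open import Data.List.Membership.Propositional.Properties.WithK using (unique∧set⇒bag)
import Data.List.Properties as Listₚ
open import Data.List.Relation.Binary.BagAndSetEquality using (∼bag⇒↭)
open import Data.List.Relation.Binary.Permutation.Propositional as Perm using (_↭_; prep; swap; ↭-refl; ↭-sym; ↭-trans; ↭⇒↭ₛ)
open import Data.List.Relation.Binary.Permutation.Propositional.Properties using (All-resp-↭; map⁺; ↭-length; ∷↭∷ʳ)
open import Data.List.Relation.Binary.Permutation.Setoid.Properties using (foldr-commMonoid)
open import Data.List.Relation.Unary.All as All using (All; []; _∷_)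
import Data.List.Relation.Unary.All.Properties as Allₚ
open import Data.List.Relation.Unary.AllPairs using (_∷_)
open import Data.List.Relation.Unary.Any using (Any; here; there)
import Data.List.Relation.Unary.Any.Properties as Anyₚ
open import Data.List.Relation.Unary.Unique.Propositional using (Unique)
import Data.List.Relation.Unary.Unique.Propositional.Properties as Uniqueₚ
open import Data.Nat using (_≤_)
open import Data.Nat.Base as ℕ using (NonZero; _*_; _<_; _<ᵇ_; _∸_; _≡ᵇ_; _≤_; _≤ᵇ_; suc; s≤s; zero; z≤n; ℕ) renaming (_+_ to _+ⁿ_)
open import Data.Nat.DivMod using ([m+n]%n≡m%n; _%_; _/_; m%n<n; m<n⇒m%n≡m; m≡m%n+[m/n]*n)
import Data.Nat.Properties as ℕₚ
open import Data.Product using (_,_; _×_; proj₁; proj₂; ∃)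
open import Data.Rational.Base as ℚ using (0ℚ; 1ℚ; fromℚᵘ; toℚᵘ; ℚ) renaming (_<_ to _<ℚ_)
import Data.Rational.Properties as ℚₚ
open import Data.Rational.Unnormalised.Base as ℚᵘ using (*<*; *≡*; *≤*; mkℚᵘ; ℚᵘ)
import Data.Rational.Unnormalised.Properties as ℚᵘₚ
open import Data.Sum using ([_,_]′; _⊎_; inj₁; inj₂)
open import Function using (_∘_; case_of_; id)
open import Function.Bundles using (Equivalence; mk⇔)
open import Relation.Binary.PropositionalEquality
open import Relation.Nullary using (Dec; does; no; yes; ¬?; ¬_)
open import Relation.Nullary.Decidable using (_×-dec_; dec-false; dec-true)
open import Relation.Unary using (Decidable)

-- By Gauss-Bonnet the curvatures of all vertices add up to 2, so an average curvature of at least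
-- 1/104 means at most 208 vertices. Long faces stand in the way: a vertex of type (4,4,s) or
-- (3,3,3,s) has curvature only 1/s. Call a face large if its size is at least 42, and measure
-- curvature in units of 1/720720. Three cases remain.
--
-- Two large faces. Dropping the term 1/s of every large face takes exactly 1 per face from the
-- total 2, and it leaves every vertex nonnegative, because (3,7,s) is positively curved only for s
-- < 42. Hence there are exactly two large faces and every vertex has one of the flat types (4,4,s),
-- (3,3,3,s), (3,6,s). The last one fails by parity round a triangle. By connectedness one of the
-- other two occurs everywhere, and the strip between the two large faces makes the graph a prism or
-- an antiprism.
--
-- One face of size at least 86, all others below 42. Let each corner of that face contribute -8400
-- instead of 720720/s. As 86 · 8400 > 720720, the total becomes negative. On the other hand the
-- vertices can divide what they have among their triangles and squares so that no face ends up
-- negative, except along a ladder, a strip of squares or triangles with large faces on both sides.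
-- A ladder continues all along the face, both of its sides lie on this one face, and so it exhausts
-- the graph; then all vertices are flat, which contradicts Gauss-Bonnet.
--
-- All faces of size at most 85. Each vertex divides its excess over 1/104 among its corners, and
-- neighbouring vertices pass charge across edges. The amounts solve a linear program and are listed
-- in tables. Every face ends up nonnegative, so the average is at least 1/104.
--
-- The claims about faces are finite checks. Sizes are rounded to 21 labels, which leaves finitely
-- many vertex types, and the boundary of a face is a closed walk in a finite weighted graph of
-- vertex states. By the cycle lemma a closed walk of negative weight can be started so that all its
-- partial sums are negative. A dynamic program that keeps the least negative sum at each node
-- therefore finds every bad face.

-- Orbits of an injective map on a finite set.

unique⇒↭ : ∀ {A : Set} {xs ys : List A} → Unique xs → Unique ys →
           (∀ {x} → x ∈ xs → x ∈ ys) → (∀ {x} → x ∈ ys → x ∈ xs) → xs ↭ ys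
unique⇒↭ u v f g = ∼bag⇒↭ (unique∧set⇒bag u v (mk⇔ f g))

iter-+ : ∀ {A : Set} (f : A → A) m n x → iter f (m +ⁿ n) x ≡ iter f m (iter f n x)
iter-+ f zero    n x = refl
iter-+ f (suc m) n x = cong f (iter-+ f m n x)

iter-comm : ∀ {A : Set} (f : A → A) n x → iter f n (f x) ≡ f (iter f n x)
iter-comm f zero    x = refl
iter-comm f (suc n) x = cong f (iter-comm f n x)

iter-injective : ∀ {A : Set} {f : A → A} → (∀ {x y} → f x ≡ f y → x ≡ y) →
                 ∀ n {x y} → iter f n x ≡ iter f n y → x ≡ y
iter-injective inj zero    e = e
iter-injective inj (suc n) e = iter-injective inj n (inj e)

least : ∀ {P : ℕ → Set} → Decidable P → ∀ n → P n → ∃ λ p → P p × (∀ {q} → q < p → ¬ P q)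
least {P} P? n Pn = go n zero (ℕₚ.+-identityʳ n) λ ()
  where
  go : ∀ k i → k +ⁿ i ≡ n → (∀ {q} → q < i → ¬ P q) → ∃ λ p → P p × (∀ {q} → q < p → ¬ P q)
  go k i e below with P? i
  ... | yes Pi = i , Pi , below
  go zero    i e below | no ¬Pi = ⊥-elim (¬Pi (subst P (sym e) Pn))
  go (suc k) i e below | no ¬Pi = go k (suc i) (trans (ℕₚ.+-suc k i) e) λ {q} q≤i → case≤ q≤i
    where
    case≤ : ∀ {q} → q < suc i → ¬ P q
    case≤ (s≤s q≤i) with ℕₚ.m≤n⇒m<n∨m≡n q≤i
    ... | inj₁ q<i  = below q<i
    ... | inj₂ refl = ¬Pi

-- The iterates of `d` below its minimal period list the fibre of `d` without repetition, so the
-- period is the size of the fibre. Going round a vertex or a face is then a walk of known length.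
module Orbit {n m : ℕ} (f : Fin n → Fin n) (inj : ∀ {x y} → f x ≡ f y → x ≡ y)
  (lab : Fin n → Fin m)
  (orbit : ∀ d e → (lab d ≡ lab e → SameOrbit f d e) × (SameOrbit f d e → lab d ≡ lab e)) where

  fibre : Fin m → List (Fin n)
  fibre v = filter (λ d → lab d Finₚ.≟ v) (allFin n)

  lab-iter : ∀ k d → lab (iter f k d) ≡ lab d
  lab-iter k d = sym (proj₂ (orbit d (iter f k d)) (k , refl))

  module _ (d : Fin n) where

    private
      P : ℕ → Set
      P p = iter f (suc p) d ≡ d

      somePeriod : ∃ P
      somePeriod with Finₚ.pigeonhole (ℕₚ.n<1+n n) (λ (i : Fin (suc n)) → iter f (toℕ i) d)
      -- Two of `n + 1` iterates coincide, and injectivity cancels the first `i` steps. The witness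
      -- is one less than the difference because `P p` speaks of `suc p` steps.
      ... | i , j , i<j , e = toℕ j ∸ suc (toℕ i) , sym (iter-injective inj (toℕ i) (begin
        iter f (toℕ i) d                                     ≡⟨ e ⟩
        iter f (toℕ j) d                                     ≡⟨ cong (λ k → iter f k d) (sym (trans (ℕₚ.+-suc (toℕ i) (toℕ j ∸ suc (toℕ i))) (ℕₚ.m+[n∸m]≡n i<j))) ⟩
        iter f (toℕ i +ⁿ suc (toℕ j ∸ suc (toℕ i))) d         ≡⟨ iter-+ f (toℕ i) _ d ⟩
        iter f (toℕ i) (iter f (suc (toℕ j ∸ suc (toℕ i))) d) ∎))
        where open ≡-Reasoning

      minimal = least {P} (λ p → iter f (suc p) d Finₚ.≟ d) (proj₁ somePeriod) (proj₂ somePeriod)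

      p : ℕ
      p = suc (proj₁ minimal)

      period : iter f p d ≡ d
      period = proj₁ (proj₂ minimal)

      period-* : ∀ k → iter f (k * p) d ≡ d
      period-* zero = refl
      period-* (suc k) = trans (iter-+ f p (k * p) d) (trans (cong (iter f p) (period-* k)) period)

      orbitList : List (Fin n)
      orbitList = applyUpTo (λ i → iter f i d) p

      orbit-unique : Unique orbitList
      orbit-unique = Uniqueₚ.applyUpTo⁺₁ _ p λ {i} {j} i<j j<p e →
        proj₂ (proj₂ minimal) {j ∸ suc i} (ℕₚ.≤-trans (subst (suc (j ∸ suc i) ≤_) (ℕₚ.m+[n∸m]≡n i<j) (s≤s (ℕₚ.m≤n+m _ i))) (ℕₚ.≤-pred j<p))
          (sym (iter-injective inj i (trans e (trans
            (cong (λ k → iter f k d) (sym (trans (ℕₚ.+-suc i _) (ℕₚ.m+[n∸m]≡n i<j)))) (iter-+ f i _ d)))))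

      fibre-unique : Unique (fibre (lab d))
      fibre-unique = Uniqueₚ.filter⁺ _ (Uniqueₚ.allFin⁺ n)

      to : ∀ {x} → x ∈ orbitList → x ∈ fibre (lab d)
      to x∈ with ∈-applyUpTo⁻ (λ i → iter f i d) x∈
      ... | i , _ , refl = ∈-filter⁺ _ (∈-allFin _) (lab-iter i d)

      from : ∀ {x} → x ∈ fibre (lab d) → x ∈ orbitList
      from {x} x∈ with proj₁ (orbit d x) (sym (proj₂ (∈-filter⁻ (λ e → lab e Finₚ.≟ lab d) {xs = allFin n} x∈)))
      ... | k , refl = subst (_∈ orbitList) (sym reduce) (∈-applyUpTo⁺ (λ i → iter f i d) (m%n<n k p))
        where
        reduce : iter f k d ≡ iter f (k % p) d
        reduce = trans (cong (λ k → iter f k d) (m≡m%n+[m/n]*n k p))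
                 (trans (iter-+ f (k % p) (k / p * p) d) (cong (iter f (k % p)) (period-* (k / p))))

      orbit↭ : orbitList ↭ fibre (lab d)
      orbit↭ = unique⇒↭ orbit-unique fibre-unique to from

      p≡ : p ≡ length (fibre (lab d))
      p≡ = trans (sym (Listₚ.length-applyUpTo (λ i → iter f i d) p)) (↭-length orbit↭)

    fibre-period : iter f (length (fibre (lab d))) d ≡ d
    fibre-period = subst (λ k → iter f k d ≡ d) p≡ period

    fibre-↭ : applyUpTo (λ i → iter f i d) (length (fibre (lab d))) ↭ fibre (lab d)
    fibre-↭ = subst (λ k → applyUpTo (λ i → iter f i d) k ↭ fibre (lab d)) p≡ orbit↭

    fibre-nonempty : 0 < length (fibre (lab d))
    fibre-nonempty = subst (0 <_) p≡ (s≤s z≤n)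

    fibre-distinct : ∀ i → 0 < i → i < length (fibre (lab d)) → iter f i d ≢ d
    fibre-distinct (suc i) _ i<c = proj₂ (proj₂ minimal) (ℕₚ.≤-pred (subst (suc (suc i) ≤_) (sym p≡) i<c))

-- Finite sums and double counting.

module Sums {A : Set} {_⊕_ : A → A → A} {0# : A} (isCM : IsCommutativeMonoid _≡_ _⊕_ 0#) where

  private
    M : CommutativeMonoid _ _
    M = record { isCommutativeMonoid = isCM }
  open IsCommutativeMonoid isCM using (identityˡ; identityʳ; assoc; comm)
  open Sum M public using (sum; sum-cong-≗; ∑-distrib-+; ∑-comm; sum-permute; sum-remove; sum-replicate-zero)

  ∑ₗ : ∀ {B : Set} → (B → A) → List B → A
  ∑ₗ g = foldr (λ x s → g x ⊕ s) 0#

  ∑ₗ-map : ∀ {B : Set} (g : B → A) xs → ∑ₗ g xs ≡ foldr _⊕_ 0# (map g xs)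
  ∑ₗ-map g []       = refl
  ∑ₗ-map g (x ∷ xs) = cong (g x ⊕_) (∑ₗ-map g xs)

  foldr-↭ : ∀ {xs ys} → xs ↭ ys → foldr _⊕_ 0# xs ≡ foldr _⊕_ 0# ys
  foldr-↭ p = foldr-commMonoid (setoid A) isCM (↭⇒↭ₛ p)

  ∑ₗ-↭ : ∀ {B : Set} (g : B → A) {xs ys} → xs ↭ ys → ∑ₗ g xs ≡ ∑ₗ g ys
  ∑ₗ-↭ g {xs} {ys} p = trans (∑ₗ-map g xs) (trans (foldr-↭ (map⁺ g p)) (sym (∑ₗ-map g ys)))

  -- sums over initial segments of ℕ
  ∑< : ℕ → (ℕ → A) → A
  ∑< k h = ∑ₗ h (List.upTo k)

  ∑ₗ-applyUpTo : ∀ {B : Set} (g : B → A) (h : ℕ → B) k → ∑ₗ g (applyUpTo h k) ≡ ∑ₗ (g ∘ h) (List.upTo k)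
  ∑ₗ-applyUpTo {B} g h k = go h id k
    where
    go : ∀ (h : ℕ → B) (i : ℕ → ℕ) k → ∑ₗ g (applyUpTo (h ∘ i) k) ≡ ∑ₗ (g ∘ h) (applyUpTo i k)
    go h i zero    = refl
    go h i (suc k) = cong (g (h (i 0)) ⊕_) (go h (i ∘ suc) k)

  ∑-allFin : ∀ {n} (g : Fin n → A) → ∑ₗ g (allFin n) ≡ sum g
  ∑-allFin {n} g = go n id
    where
    go : ∀ k (h : Fin k → Fin n) → ∑ₗ g (tabulate h) ≡ sum (g ∘ h)
    go zero    h = refl
    go (suc k) h = cong (g (h zero) ⊕_) (go k (h ∘ suc))

  ∑ₗ-filter : ∀ {B : Set} {P : B → Set} (P? : Decidable P) (g : B → A) xs →
              ∑ₗ g (filter P? xs) ≡ ∑ₗ (λ x → if does (P? x) then g x else 0#) xs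
  ∑ₗ-filter P? g [] = refl
  ∑ₗ-filter P? g (x ∷ xs) with does (P? x)
  ... | true  = cong (g x ⊕_) (∑ₗ-filter P? g xs)
  ... | false = trans (∑ₗ-filter P? g xs) (sym (identityˡ _))

  ∑-delta : ∀ {m} (x : Fin m) (a : A) → sum (λ v → if does (x Finₚ.≟ v) then a else 0#) ≡ a
  ∑-delta {suc m} x a = begin
    sum t                                  ≡⟨ sum-remove {i = x} t ⟩
    t x ⊕ sum (λ v → t (punchIn x v))       ≡⟨ cong₂ _⊕_ (cong (λ b → if b then a else 0#) (dec-true (x Finₚ.≟ x) refl))
                                                 (sum-cong-≗ λ v → cong (λ b → if b then a else 0#)
                                                   (dec-false (x Finₚ.≟ punchIn x v) (Finₚ.punchInᵢ≢i x v ∘ sym))) ⟩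
    a ⊕ sum (λ (v : Fin m) → 0#)           ≡⟨ cong (a ⊕_) (sum-replicate-zero m) ⟩
    a ⊕ 0#                                 ≡⟨ identityʳ a ⟩
    a                                      ∎
    where
    open ≡-Reasoning
    t : Fin (suc m) → A
    t v = if does (x Finₚ.≟ v) then a else 0#

  -- Each `d` lies in exactly one fibre: expand both sides with indicators and exchange the sums.
  -- This moves sums over darts to vertices and to faces.
  ∑-fibres : ∀ {n m} (lab : Fin n → Fin m) (g : Fin n → A) →
             sum (λ v → ∑ₗ g (filter (λ d → lab d Finₚ.≟ v) (allFin n))) ≡ sum g
  ∑-fibres {n} {m} lab g = begin
    sum (λ v → ∑ₗ g (filter (λ d → lab d Finₚ.≟ v) (allFin n)))
      ≡⟨ sum-cong-≗ {m} (λ v → trans (∑ₗ-filter (λ d → lab d Finₚ.≟ v) g (allFin n)) (∑-allFin (λ d → if does (lab d Finₚ.≟ v) then g d else 0#))) ⟩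
    sum (λ v → sum (λ d → if does (lab d Finₚ.≟ v) then g d else 0#))
      ≡⟨ ∑-comm {m} {n} (λ v d → if does (lab d Finₚ.≟ v) then g d else 0#) ⟩
    sum (λ d → sum (λ v → if does (lab d Finₚ.≟ v) then g d else 0#))
      ≡⟨ sum-cong-≗ {n} (λ d → ∑-delta (lab d) (g d)) ⟩
    sum g ∎
    where open ≡-Reasoning

module ℤ∑ = Sums ℤₚ.+-0-isCommutativeMonoid

∑-const : ∀ n z → ℤ∑.sum {n} (λ _ → z) ≡ + n ℤ.* z
∑-const zero    z = sym (ℤₚ.*-zeroˡ z)
∑-const (suc n) z = trans (cong (ℤ._+_ z) (∑-const n z)) (sym (ℤₚ.suc-* (+ n) z))

∑-* : ∀ {n} k (g : Fin n → ℤ) → ℤ∑.sum (λ v → k ℤ.* g v) ≡ k ℤ.* ℤ∑.sum g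
∑-* {zero}  k g = sym (ℤₚ.*-zeroʳ k)
∑-* {suc n} k g = trans (cong (ℤ._+_ (k ℤ.* g zero)) (∑-* k (g ∘ suc))) (sym (ℤₚ.*-distribˡ-+ k (g zero) (ℤ∑.sum (g ∘ suc))))

-- Curvature in integer units and Gauss-Bonnet.

-- Fractions with the fixed denominator suc N.
module Fixed (N : ℕ) where

  frac : ℤ → ℚ
  frac z = fromℚᵘ (mkℚᵘ z N)

  frac≃ : ∀ z → toℚᵘ (frac z) ℚᵘ.≃ mkℚᵘ z N
  frac≃ z = ℚₚ.toℚᵘ-fromℚᵘ (mkℚᵘ z N)

  frac-+ : ∀ a b → frac a ℚ.+ frac b ≡ frac (a ℤ.+ b)
  frac-+ a b = ℚₚ.toℚᵘ-injective (begin
    toℚᵘ (frac a ℚ.+ frac b)             ≈⟨ ℚₚ.toℚᵘ-homo-+ (frac a) (frac b) ⟩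
    toℚᵘ (frac a) ℚᵘ.+ toℚᵘ (frac b)     ≈⟨ ℚᵘₚ.+-cong (frac≃ a) (frac≃ b) ⟩
    mkℚᵘ a N ℚᵘ.+ mkℚᵘ b N               ≈⟨ *≡* (trans (cong (ℤ._* + suc N) (sym (ℤₚ.*-distribʳ-+ (+ suc N) a b))) (ℤₚ.*-assoc (a ℤ.+ b) (+ suc N) (+ suc N))) ⟩
    mkℚᵘ (a ℤ.+ b) N                     ≈⟨ frac≃ (a ℤ.+ b) ⟨
    toℚᵘ (frac (a ℤ.+ b))                ∎)
    where open ℚᵘₚ.≃-Reasoning

  frac-neg : ∀ a → ℚ.- frac a ≡ frac (ℤ.- a)
  frac-neg a = ℚₚ.toℚᵘ-injective (begin
    toℚᵘ (ℚ.- frac a)      ≈⟨ ℚₚ.toℚᵘ-homo‿- (frac a) ⟩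
    ℚᵘ.- toℚᵘ (frac a)     ≈⟨ ℚᵘₚ.-‿cong (frac≃ a) ⟩
    mkℚᵘ (ℤ.- a) N         ≈⟨ frac≃ (ℤ.- a) ⟨
    toℚᵘ (frac (ℤ.- a))    ∎)
    where open ℚᵘₚ.≃-Reasoning

  frac-pos : ∀ {z} → 0ℚ ℚ.< frac z → 0ℤ ℤ.< z
  frac-pos {z} p with ℚᵘₚ.<-respʳ-≃ (frac≃ z) (ℚₚ.toℚᵘ-mono-< p)
  ... | *<* q = subst₂ ℤ._<_ refl (ℤₚ.*-identityʳ z) (subst (ℤ._< z ℤ.* + 1) (ℤₚ.*-zeroˡ (+ suc N)) q)

  frac-≡ : ∀ a b c → .{{_ : NonZero c}} → a ℤ.* + suc N ≡ b ℤ.* + c → a ℚ./ c ≡ frac b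
  frac-≡ a b (suc c) e = ℚₚ.toℚᵘ-injective (ℚᵘₚ.≃-trans (ℚₚ.toℚᵘ-fromℚᵘ (mkℚᵘ a c)) (ℚᵘₚ.≃-trans (*≡* e) (ℚᵘₚ.≃-sym (frac≃ b))))

  inv≤frac : ∀ s u → suc N ℕ.≤ u ℕ.* s → inv s ℚ.≤ frac (+ u)
  inv≤frac zero    u N≤ with () ← subst (suc N ℕ.≤_) (ℕₚ.*-zeroʳ u) N≤
  inv≤frac (suc s) u N≤ = ℚₚ.toℚᵘ-cancel-≤ (ℚᵘₚ.≤-respˡ-≃ (ℚᵘₚ.≃-sym (ℚₚ.toℚᵘ-fromℚᵘ (mkℚᵘ (+ 1) s)))
    (ℚᵘₚ.≤-respʳ-≃ (ℚᵘₚ.≃-sym (frac≃ (+ u))) (*≤* (subst₂ ℤ._≤_ (sym (ℤₚ.*-identityˡ (+ suc N))) (ℤₚ.pos-* u (suc s)) (ℤ.+≤+ N≤)))))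

  sum-inv≤ : ∀ (u : ℕ → ℕ) xs → All (λ s → suc N ℕ.≤ u s ℕ.* s) xs →
             sumℚ (map inv xs) ℚ.≤ frac (ℤ∑.∑ₗ (λ s → + u s) xs)
  sum-inv≤ u []       []       = ℚₚ.≤-reflexive (ℚₚ.toℚᵘ-injective (ℚᵘₚ.≃-trans (*≡* refl) (ℚᵘₚ.≃-sym (frac≃ 0ℤ))))
  sum-inv≤ u (s ∷ xs) (p ∷ ps) = ℚₚ.≤-trans (ℚₚ.+-mono-≤ (inv≤frac s (u s) p) (sum-inv≤ u xs ps))
    (ℚₚ.≤-reflexive (frac-+ (+ u s) (ℤ∑.∑ₗ (λ s → + u s) xs)))

-- With N = 2h, the vertex charge h(2 - deg v) + Σ u(|face|), which is N·K(v) when u s = N/s.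
charge : ℕ → (ℕ → ℤ) → List ℕ → ℤ
charge h u xs = + (2 ℕ.* h) ℤ.+ ℤ∑.∑ₗ (λ s → u s ℤ.- + h) xs

module Maps (M : Map) where

  open Map M public

  size′ : Fin F → ℕ
  size′ = size

  deg′ : Fin V → ℕ
  deg′ = deg

  σf-injective : ∀ {x y} → σf x ≡ σf y → x ≡ y
  σf-injective e = trans (sym (inverseˡ σ)) (trans (cong (σ ⟨$⟩ˡ_) e) (inverseˡ σ))
    where open import Data.Fin.Permutation using (_⟨$⟩ˡ_)

  φ-injective : ∀ {x y} → φ x ≡ φ y → x ≡ y
  φ-injective {x} {y} e = trans (sym (α-invol x)) (trans (cong αf (σf-injective e)) (α-invol y))

  module VO = Orbit σf σf-injective vert vert-orbit
  module FO = Orbit φ φ-injective face face-orbit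

  φα : ∀ d → φ (αf d) ≡ σf d
  φα d = cong σf (α-invol d)

  sz : Fin darts → ℕ
  sz d = size′ (face d)

  dg : Fin darts → ℕ
  dg d = deg′ (vert d)

  face-φ : ∀ d → face (φ d) ≡ face d
  face-φ = FO.lab-iter 1

  vert-σ : ∀ d → vert (σf d) ≡ vert d
  vert-σ = VO.lab-iter 1

  -- Consecutive entries of a rotation, at `d` and at `σf d`, are thus the faces on the two sides of
  -- the edge of `d`.
  face-α : ∀ d → face (αf d) ≡ face (σf d)
  face-α d = trans (sym (face-φ (αf d))) (cong face (φα d))

  vert-φ : ∀ d → vert (φ d) ≡ vert (αf d)
  vert-φ d = vert-σ (αf d)

  -- Unlike `faceVec`, this keeps the rotation order, on which all local arguments rest.
  corner : Fin darts → List ℕ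
  corner d = applyUpTo (λ i → sz (iter σf i d)) (dg d)

  corner↭ : ∀ d → corner d ↭ faceVec (vert d)
  corner↭ d = subst (_↭ faceVec (vert d)) (Listₚ.map-applyUpTo (λ i → iter σf i d) sz (dg d)) (map⁺ sz (VO.fibre-↭ d))

  module _ (h : ℕ) where

    open ℤ∑

    ∑ₗ-const : ∀ {B : Set} z (xs : List B) → ∑ₗ (λ _ → z) xs ≡ + length xs ℤ.* z
    ∑ₗ-const z []       = sym (ℤₚ.*-zeroˡ z)
    ∑ₗ-const z (x ∷ xs) = trans (cong (ℤ._+_ z) (∑ₗ-const z xs)) (sym (ℤₚ.suc-* (+ length xs) z))

    ∑ₗ-cong-∈ : ∀ {B : Set} {P : B → Set} {f g : B → ℤ} → (∀ x → P x → f x ≡ g x) → ∀ {xs} → All P xs → ∑ₗ f xs ≡ ∑ₗ g xs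
    ∑ₗ-cong-∈ e []       = refl
    ∑ₗ-cong-∈ e (p ∷ ps) = cong₂ ℤ._+_ (e _ p) (∑ₗ-cong-∈ e ps)

    ∑-darts : ∀ (g : ℕ → ℤ) → sum (λ d → g (sz d)) ≡ sum (λ f → + size′ f ℤ.* g (size′ f))
    ∑-darts g = trans (sym (∑-fibres face (λ d → g (sz d)))) (sum-cong-≗ {F} λ f →
      trans (∑ₗ-cong-∈ {P = λ d → face d ≡ f} (λ d e → cong (g ∘ size′) e) (Allₚ.all-filter (λ d → face d Finₚ.≟ f) (allFin darts))) (∑ₗ-const (g (size′ f)) (filter (λ d → face d Finₚ.≟ f) (allFin darts))))

    vcharge : (ℕ → ℤ) → Fin V → ℤ
    vcharge u v = charge h u (faceVec v)

    -- Gauss-Bonnet for arbitrary weights: regroup the corners by faces and eliminate the number of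
    -- darts by Euler's formula. For `u s = 2h / s` every face gives `2h`, and the total `4h` is
    -- curvature 2.
    ∑-vcharge : ∀ (u : ℕ → ℤ) → Spherical M →
      sum (vcharge u) ℤ.+ (+ F ℤ.* + (2 ℕ.* h)) ≡ + (4 ℕ.* h) ℤ.+ sum (λ f → + size′ f ℤ.* u (size′ f))
    ∑-vcharge u sph = begin
      sum (vcharge u) ℤ.+ F2h
        ≡⟨ cong (ℤ._+ F2h) (trans (sum-cong-≗ {V} λ v → cong (ℤ._+_ 2h) (∑ₗ-map′ (dartsAt v))) (∑-distrib-+ {V} (λ _ → 2h) (λ v → ∑ₗ g (dartsAt v)))) ⟩
      sum {V} (λ _ → 2h) ℤ.+ sum (λ v → ∑ₗ g (dartsAt v)) ℤ.+ F2h
        ≡⟨ cong₂ (λ a b → a ℤ.+ b ℤ.+ F2h) (∑-const V 2h) (trans (∑-fibres vert g) (trans (∑-distrib-+ {darts} (λ d → u (sz d)) (λ _ → ℤ.- + h)) (cong₂ ℤ._+_ (∑-darts u) (∑-const darts (ℤ.- + h))))) ⟩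
      + V ℤ.* 2h ℤ.+ (S ℤ.+ + darts ℤ.* (ℤ.- + h)) ℤ.+ F2h
        ≡⟨ arith ⟩
      + (4 ℕ.* h) ℤ.+ S ∎
      where
      open ≡-Reasoning
      g : Fin darts → ℤ
      g d = u (sz d) ℤ.- + h
      2h F2h S : ℤ
      2h = + (2 ℕ.* h)
      F2h = + F ℤ.* 2h
      S = sum (λ f → + size′ f ℤ.* u (size′ f))
      ∑ₗ-map′ : ∀ ds → ∑ₗ (λ s → u s ℤ.- + h) (map sz ds) ≡ ∑ₗ g ds
      ∑ₗ-map′ []       = refl
      ∑ₗ-map′ (d ∷ ds) = cong (ℤ._+_ (g d)) (∑ₗ-map′ ds)
      open import Data.Integer.Solver using (module +-*-Solver)
      open +-*-Solver
      euler : + 2 ℤ.* + V ℤ.+ + 2 ℤ.* + F ≡ + darts ℤ.+ + 4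
      euler = trans (cong₂ ℤ._+_ (sym (ℤₚ.pos-* 2 V)) (sym (ℤₚ.pos-* 2 F))) (cong +_ sph)
      arith : + V ℤ.* 2h ℤ.+ (S ℤ.+ + darts ℤ.* (ℤ.- + h)) ℤ.+ F2h ≡ + (4 ℕ.* h) ℤ.+ S
      arith = begin
        + V ℤ.* 2h ℤ.+ (S ℤ.+ + darts ℤ.* (ℤ.- + h)) ℤ.+ F2h
          ≡⟨ cong (λ t → + V ℤ.* t ℤ.+ (S ℤ.+ + darts ℤ.* (ℤ.- + h)) ℤ.+ + F ℤ.* t) (ℤₚ.pos-* 2 h) ⟩
        + V ℤ.* (+ 2 ℤ.* + h) ℤ.+ (S ℤ.+ + darts ℤ.* (ℤ.- + h)) ℤ.+ + F ℤ.* (+ 2 ℤ.* + h)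
          ≡⟨ solve 5 (λ v f d k s → v :* (con (+ 2) :* k) :+ (s :+ d :* (:- k)) :+ f :* (con (+ 2) :* k) := (con (+ 2) :* v :+ con (+ 2) :* f) :* k :+ d :* (:- k) :+ s) refl (+ V) (+ F) (+ darts) (+ h) S ⟩
        (+ 2 ℤ.* + V ℤ.+ + 2 ℤ.* + F) ℤ.* + h ℤ.+ + darts ℤ.* (ℤ.- + h) ℤ.+ S
          ≡⟨ cong (λ t → t ℤ.* + h ℤ.+ + darts ℤ.* (ℤ.- + h) ℤ.+ S) euler ⟩
        (+ darts ℤ.+ + 4) ℤ.* + h ℤ.+ + darts ℤ.* (ℤ.- + h) ℤ.+ S
          ≡⟨ solve 3 (λ d k s → (d :+ con (+ 4)) :* k :+ d :* (:- k) :+ s := con (+ 4) :* k :+ s) refl (+ darts) (+ h) S ⟩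
        + 4 ℤ.* + h ℤ.+ S
          ≡⟨ cong (ℤ._+ S) (sym (ℤₚ.pos-* 4 h)) ⟩
        + (4 ℕ.* h) ℤ.+ S ∎

    vcharge-corner : ∀ u d → vcharge u (vert d) ≡ charge h u (corner d)
    vcharge-corner u d = cong (ℤ._+_ (+ (2 ℕ.* h))) (∑ₗ-↭ (λ s → u s ℤ.- + h) (↭-sym (corner↭ d)))

  -- A positive curvature stays positive after rounding every 1/s up to u s / 2h.
  charge-pos : ∀ n (u : ℕ → ℕ) v → (let h = suc n) → 0ℚ ℚ.< curvature M v →
    All (λ s → 2 ℕ.* h ℕ.≤ u s ℕ.* s) (faceVec v) → 0ℤ ℤ.< charge h (λ s → + u s) (faceVec v)
  charge-pos n u v K>0 us = subst (0ℤ ℤ.<_) rearrange (frac-pos (ℚₚ.<-≤-trans K>0 (begin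
      1ℚ ℚ.- (+ D) ℚ./ 2 ℚ.+ sumℚ (map inv fv)
        ≤⟨ ℚₚ.+-monoʳ-≤ (1ℚ ℚ.- (+ D) ℚ./ 2) (sum-inv≤ u fv us) ⟩
      1ℚ ℚ.- (+ D) ℚ./ 2 ℚ.+ frac (∑ₗ (λ s → + u s) fv)
        ≡⟨ cong (ℚ._+ frac (∑ₗ (λ s → + u s) fv)) (cong₂ (λ a b → a ℚ.- b) 1≡ D≡) ⟩
      frac (+ N) ℚ.- frac (+ D ℤ.* + h) ℚ.+ frac (∑ₗ (λ s → + u s) fv)
        ≡⟨ cong (λ t → frac (+ N) ℚ.+ t ℚ.+ frac (∑ₗ (λ s → + u s) fv)) (frac-neg (+ D ℤ.* + h)) ⟩
      frac (+ N) ℚ.+ frac (ℤ.- (+ D ℤ.* + h)) ℚ.+ frac (∑ₗ (λ s → + u s) fv)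
        ≡⟨ trans (cong (ℚ._+ frac (∑ₗ (λ s → + u s) fv)) (frac-+ (+ N) (ℤ.- (+ D ℤ.* + h)))) (frac-+ (+ N ℤ.+ ℤ.- (+ D ℤ.* + h)) (∑ₗ (λ s → + u s) fv)) ⟩
      frac (+ N ℤ.+ ℤ.- (+ D ℤ.* + h) ℤ.+ ∑ₗ (λ s → + u s) fv) ∎)))
    where
    open ℤ∑
    open ℚₚ.≤-Reasoning
    h N D : ℕ
    h = suc n
    N = 2 ℕ.* h
    D = deg′ v
    fv = faceVec v
    -- The argument is the predecessor of `N` in computed form, so the common denominator is
    -- `2 * h`.
    open Fixed (n ℕ.+ suc (n ℕ.+ 0))
    1≡ : 1ℚ ≡ frac (+ N)
    1≡ = frac-≡ (+ 1) (+ N) 1 (trans (ℤₚ.*-identityˡ (+ N)) (sym (ℤₚ.*-identityʳ (+ N))))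
    D≡ : (+ D) ℚ./ 2 ≡ frac (+ D ℤ.* + h)
    D≡ = frac-≡ (+ D) (+ D ℤ.* + h) 2 (trans (cong (+ D ℤ.*_) (trans (cong +_ (ℕₚ.*-comm 2 h)) (ℤₚ.pos-* h 2))) (sym (ℤₚ.*-assoc (+ D) (+ h) (+ 2))))
    rearrange : + N ℤ.+ ℤ.- (+ D ℤ.* + h) ℤ.+ ∑ₗ (λ s → + u s) fv ≡ charge h (λ s → + u s) fv
    rearrange = trans (ℤₚ.+-assoc (+ N) (ℤ.- (+ D ℤ.* + h)) (∑ₗ (λ s → + u s) fv)) (cong (ℤ._+_ (+ N)) (trans (cong (λ t → ℤ.- (+ t ℤ.* + h) ℤ.+ ∑ₗ (λ s → + u s) fv) (sym (Listₚ.length-map sz (dartsAt v)))) (go fv)))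
      where
      open import Data.Integer.Solver using (module +-*-Solver)
      open +-*-Solver
      go : ∀ xs → ℤ.- (+ length xs ℤ.* + h) ℤ.+ ∑ₗ (λ s → + u s) xs ≡ ∑ₗ (λ s → + u s ℤ.- + h) xs
      go []       = cong (λ t → ℤ.- t ℤ.+ 0ℤ) (ℤₚ.*-zeroˡ (+ h))
      go (x ∷ xs) = trans (cong (λ t → ℤ.- t ℤ.+ (+ u x ℤ.+ ∑ₗ (λ s → + u s) xs)) (ℤₚ.suc-* (+ length xs) (+ h)))
        (trans (solve 4 (λ k l a s → :- (k :+ l) :+ (a :+ s) := (a :- k) :+ (:- l :+ s)) refl (+ h) (+ length xs ℤ.* + h) (+ u x) (∑ₗ (λ s → + u s) xs))
               (cong (ℤ._+_ (+ u x ℤ.- + h)) (go xs)))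

-- Partial sums of periodic sequences and the cycle lemma.

open ℤ∑

prefix : (ℕ → ℤ) → ℕ → ℤ
prefix w zero    = 0ℤ
prefix w (suc j) = prefix w j ℤ.+ w j

prefix-+ : ∀ w i j → prefix w (i ℕ.+ j) ≡ prefix w i ℤ.+ prefix (λ l → w (i ℕ.+ l)) j
prefix-+ w i zero    = trans (cong (prefix w) (ℕₚ.+-identityʳ i)) (sym (ℤₚ.+-identityʳ _))
prefix-+ w i (suc j) = trans (cong (prefix w) (ℕₚ.+-suc i j))
  (trans (cong (ℤ._+ w (i ℕ.+ j)) (prefix-+ w i j)) (ℤₚ.+-assoc (prefix w i) _ _))

prefix-cong : ∀ {w w′} → (∀ i → w i ≡ w′ i) → ∀ j → prefix w j ≡ prefix w′ j
prefix-cong e zero    = refl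
prefix-cong e (suc j) = cong₂ ℤ._+_ (prefix-cong e j) (e j)

prefix-∑ : ∀ w k → ∑ₗ w (upTo k) ≡ prefix w k
prefix-∑ w zero    = refl
prefix-∑ w (suc k) = trans (cong (ℤ._+_ (w 0)) (trans (∑ₗ-applyUpTo w suc k) (prefix-∑ (w ∘ suc) k)))
  (trans (cong (ℤ._+ prefix (w ∘ suc) k) (sym (ℤₚ.+-identityˡ (w 0)))) (sym (prefix-+ w 1 k)))

-- Taking the last maximum makes all later values strictly smaller, and this strictness becomes the
-- negativity in the cycle lemma.
lastMax : ∀ (p : ℕ → ℤ) m → ∃ λ s → s ℕ.≤ m × (∀ i → i ℕ.≤ m → p i ℤ.≤ p s) × (∀ i → s ℕ.< i → i ℕ.≤ m → p i ℤ.< p s)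
lastMax p zero = 0 , z≤n , (λ { zero _ → ℤₚ.≤-refl }) , λ { zero () _ ; (suc i) _ () }
lastMax p (suc m) with lastMax p m
... | s , s≤m , below , after with p s ℤₚ.≤? p (suc m)
... | yes q = suc m , ℕₚ.≤-refl , upd , λ i m<i i≤m → ⊥-elim (ℕₚ.<⇒≱ m<i i≤m)
  where
  upd : ∀ i → i ℕ.≤ suc m → p i ℤ.≤ p (suc m)
  upd i i≤ with ℕₚ.m≤n⇒m<n∨m≡n i≤
  ... | inj₁ (s≤s i≤m) = ℤₚ.≤-trans (below i i≤m) q
  ... | inj₂ refl      = ℤₚ.≤-refl
... | no q = s , ℕₚ.m≤n⇒m≤1+n s≤m , upd , upd′
  where
  upd : ∀ i → i ℕ.≤ suc m → p i ℤ.≤ p s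
  upd i i≤ with ℕₚ.m≤n⇒m<n∨m≡n i≤
  ... | inj₁ (s≤s i≤m) = below i i≤m
  ... | inj₂ refl      = ℤₚ.<⇒≤ (ℤₚ.≰⇒> q)
  upd′ : ∀ i → s ℕ.< i → i ℕ.≤ suc m → p i ℤ.< p s
  upd′ i s<i i≤ with ℕₚ.m≤n⇒m<n∨m≡n i≤
  ... | inj₁ (s≤s i≤m) = after i s<i i≤m
  ... | inj₂ refl      = ℤₚ.≰⇒> q

-- The cycle lemma: rotate so as to start right after the last maximum of the partial sums.
cycle-lemma : ∀ (w : ℕ → ℤ) n → (∀ i → w (i ℕ.+ n) ≡ w i) → prefix w n ℤ.< 0ℤ →
              ∃ λ s → ∀ j → 0 ℕ.< j → j ℕ.≤ n → prefix (λ i → w (s ℕ.+ i)) j ℤ.< 0ℤ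
cycle-lemma w zero    per neg = ⊥-elim (ℤₚ.<-irrefl refl neg)
cycle-lemma w (suc n) per neg with lastMax (prefix w) n
... | s , s≤n , below , after = s , λ j 0<j j≤n → descend j (lower j 0<j j≤n)
  where
  p = prefix w
  shift : ∀ i → p (suc n ℕ.+ i) ≡ p (suc n) ℤ.+ p i
  shift i = trans (prefix-+ w (suc n) i) (cong (ℤ._+_ (p (suc n))) (prefix-cong (λ l → trans (cong w (ℕₚ.+-comm (suc n) l)) (per l)) i))
  lower : ∀ j → 0 ℕ.< j → j ℕ.≤ suc n → p (s ℕ.+ j) ℤ.< p s
  -- Up to the end of the period the sums lie strictly below the last maximum. Beyond it, the
  -- negative total of one period is added to a sum that is at most the maximum.
  lower j 0<j j≤n with (s ℕ.+ j) ℕₚ.≤? n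
  ... | yes q = after (s ℕ.+ j) (subst (ℕ._< s ℕ.+ j) (ℕₚ.+-identityʳ s) (ℕₚ.+-monoʳ-< s 0<j)) q
  ... | no q = subst (ℤ._< p s) (sym (trans (cong p e) (shift r)))
      (ℤₚ.<-≤-trans (ℤₚ.+-monoˡ-< (p r) neg) (subst (ℤ._≤ p s) (sym (ℤₚ.+-identityˡ (p r))) (below r r≤n)))
    where
    r : ℕ
    r = s ℕ.+ j ℕ.∸ suc n
    e : s ℕ.+ j ≡ suc n ℕ.+ r
    e = sym (ℕₚ.m+[n∸m]≡n (ℕₚ.≰⇒> q))
    r≤n : r ℕ.≤ n
    r≤n = ℕₚ.≤-trans (ℕₚ.∸-monoˡ-≤ (suc n) (ℕₚ.+-monoʳ-≤ s j≤n)) (ℕₚ.≤-trans (ℕₚ.≤-reflexive (ℕₚ.m+n∸n≡m s (suc n))) s≤n)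
  descend : ∀ j → p (s ℕ.+ j) ℤ.< p s → prefix (λ i → w (s ℕ.+ i)) j ℤ.< 0ℤ
  descend j q = subst₂ ℤ._<_ (cancel (prefix (λ i → w (s ℕ.+ i)) j)) (ℤₚ.+-inverseˡ (p s))
      (ℤₚ.+-monoʳ-< (ℤ.- p s) (subst (ℤ._< p s) (prefix-+ w s j) q))
    where
    cancel : ∀ x → ℤ.- p s ℤ.+ (p s ℤ.+ x) ≡ x
    cancel x = trans (sym (ℤₚ.+-assoc (ℤ.- p s) (p s) x)) (trans (cong (ℤ._+ x) (ℤₚ.+-inverseˡ (p s))) (ℤₚ.+-identityˡ x))

-- Discharging on a map.

module Discharging (M : Map) where
  open Maps M

  orbit-sum : (Fin darts → ℤ) → Fin darts → ℤ
  orbit-sum g d = ∑ₗ (λ i → g (iter σf i d)) (upTo (dg d))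

  walk : (Fin darts → ℤ) → Fin darts → ℕ → ℤ
  walk g d = prefix (λ i → g (iter φ i d))

  -- The contrapositive of the cycle lemma. A check of faces may therefore drop a walk as soon as
  -- one of its partial sums is nonnegative.
  walk-nonneg : ∀ (g : Fin darts → ℤ) →
    (∀ d → ¬ (∀ j → 0 ℕ.< j → j ℕ.≤ sz d → walk g d j ℤ.< 0ℤ)) → ∀ d → 0ℤ ℤ.≤ walk g d (sz d)
  walk-nonneg g H d = ℤₚ.≮⇒≥ λ neg → contra (cycle-lemma (λ i → g (iter φ i d)) (sz d) periodic neg)
    where
    periodic : ∀ i → g (iter φ (i ℕ.+ sz d) d) ≡ g (iter φ i d)
    periodic i = cong g (trans (iter-+ φ i (sz d) d) (cong (iter φ i) (FO.fibre-period d)))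
    contra : (∃ λ s → ∀ j → 0 ℕ.< j → j ℕ.≤ sz d → prefix (λ i → g (iter φ (s ℕ.+ i) d)) j ℤ.< 0ℤ) → ⊥
    contra (s , neg) = H (iter φ s d) λ j 0<j j≤ →
      subst (ℤ._< 0ℤ) (prefix-cong (λ i → cong g (trans (cong (λ k → iter φ k d) (ℕₚ.+-comm s i)) (iter-+ φ i s d))) j)
        (neg j 0<j (subst (j ℕ.≤_) (cong size (FO.lab-iter s d)) j≤))

  sum-mono : ∀ {n} {f g : Fin n → ℤ} → (∀ i → f i ℤ.≤ g i) → sum f ℤ.≤ sum g
  sum-mono {zero}  h = ℤₚ.≤-refl
  sum-mono {suc n} h = ℤₚ.+-mono-≤ (h zero) (sum-mono (h ∘ suc))

  sum-nonneg : ∀ {n} {f : Fin n → ℤ} → (∀ i → 0ℤ ℤ.≤ f i) → 0ℤ ℤ.≤ sum f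
  sum-nonneg {n} {f} h = subst (ℤ._≤ sum f) (sum-replicate-zero n) (sum-mono h)

  ∑-vertices : ∀ (g : Fin darts → ℤ) (E : Fin V → ℤ) → (∀ d → orbit-sum g d ℤ.≤ E (vert d)) → sum g ℤ.≤ sum E
  ∑-vertices g E h = subst (ℤ._≤ sum E) (∑-fibres vert g) (sum-mono λ v → bound v (vert-surj v))
    where
    bound : ∀ v → (∃ λ d → vert d ≡ v) → ∑ₗ g (dartsAt v) ℤ.≤ E v
    bound .(vert d) (d , refl) = subst (ℤ._≤ E (vert d)) (trans (sym (∑ₗ-applyUpTo g (λ i → iter σf i d) (dg d))) (∑ₗ-↭ g (VO.fibre-↭ d))) (h d)

  ∑-faces : ∀ (g : Fin darts → ℤ) → (∀ d → 0ℤ ℤ.≤ walk g d (sz d)) → 0ℤ ℤ.≤ sum g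
  ∑-faces g h = subst (0ℤ ℤ.≤_) (∑-fibres face g) (sum-nonneg λ f → bound f (face-surj f))
    where
    bound : ∀ f → (∃ λ d → face d ≡ f) → 0ℤ ℤ.≤ ∑ₗ g (FO.fibre f)
    bound .(face d) (d , refl) = subst (0ℤ ℤ.≤_)
      (trans (sym (prefix-∑ (λ i → g (iter φ i d)) (sz d))) (trans (sym (∑ₗ-applyUpTo g (λ i → iter φ i d) (sz d))) (∑ₗ-↭ g (FO.fibre-↭ d)))) (h d)

  -- Every corner receives `share` from its vertex, and `give` is passed on across every dart.
  discharge : ∀ (share give : Fin darts → ℤ) (E : Fin V → ℤ) →
    (∀ d → orbit-sum share d ℤ.≤ E (vert d)) →
    (let net = λ d → share d ℤ.+ (give d ℤ.- give (αf d))) →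
    (∀ d → ¬ (∀ j → 0 ℕ.< j → j ℕ.≤ sz d → walk net d j ℤ.< 0ℤ)) →
    0ℤ ℤ.≤ sum E
  discharge share give E hv hf = ℤₚ.≤-trans (subst (0ℤ ℤ.≤_) total (∑-faces net (walk-nonneg net hf))) (∑-vertices share E hv)
    where
    net : Fin darts → ℤ
    net d = share d ℤ.+ (give d ℤ.- give (αf d))
    neg-sum : ∀ {n} (f : Fin n → ℤ) → sum (λ i → ℤ.- f i) ≡ ℤ.- sum f
    neg-sum {zero}  f = refl
    neg-sum {suc n} f = trans (cong (ℤ._+_ (ℤ.- f zero)) (neg-sum (f ∘ suc))) (sym (ℤₚ.neg-distrib-+ (f zero) (sum (f ∘ suc))))
    -- `α` permutes the darts, so everything passed across edges cancels.
    total : sum net ≡ sum share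
    total = begin
      sum net                                                         ≡⟨ ∑-distrib-+ share (λ d → give d ℤ.- give (αf d)) ⟩
      sum share ℤ.+ sum (λ d → give d ℤ.- give (αf d))                ≡⟨ cong (ℤ._+_ (sum share)) (∑-distrib-+ give (λ d → ℤ.- give (αf d))) ⟩
      sum share ℤ.+ (sum give ℤ.+ sum (λ d → ℤ.- give (αf d)))        ≡⟨ cong (λ t → sum share ℤ.+ (sum give ℤ.+ t)) (trans (neg-sum (λ d → give (αf d))) (cong ℤ.-_ (sym (sum-permute give α)))) ⟩
      sum share ℤ.+ (sum give ℤ.- sum give)                           ≡⟨ cong (ℤ._+_ (sum share)) (ℤₚ.+-inverseʳ (sum give)) ⟩
      sum share ℤ.+ 0ℤ                                                ≡⟨ ℤₚ.+-identityʳ (sum share) ⟩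
      sum share                                                       ∎
      where open ≡-Reasoning

-- Boolean tests and words up to rotation.

∧-true : ∀ {a b} → (a ∧ b) ≡ true → a ≡ true × b ≡ true
∧-true {true} {true} refl = refl , refl

true≢false : ∀ {b} → b ≡ true → b ≡ false → ⊥
true≢false refl ()

all-∈ : ∀ {A : Set} (p : A → Bool) {xs} → all p xs ≡ true → ∀ {x} → x ∈ xs → p x ≡ true
all-∈ p {x ∷ xs} e (here refl) = proj₁ (∧-true e)
all-∈ p {x ∷ xs} e (there x∈)  = all-∈ p (proj₂ (∧-true {p x} e)) x∈

any-∈ : ∀ {A : Set} (p : A → Bool) {xs x} → x ∈ xs → p x ≡ true → any p xs ≡ true
any-∈ p {y ∷ ys} (here refl) e rewrite e = refl
any-∈ p {y ∷ ys} (there x∈)  e with p y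
... | true  = refl
... | false = any-∈ p x∈ e

filterᵇ-∈ : ∀ {A : Set} (p : A → Bool) {xs x} → x ∈ xs → p x ≡ true → x ∈ filterᵇ p xs
filterᵇ-∈ p {y ∷ ys} (here refl) e rewrite e = here refl
filterᵇ-∈ p {y ∷ ys} (there x∈)  e with p y
... | true  = there (filterᵇ-∈ p x∈ e)
... | false = filterᵇ-∈ p x∈ e

≡ᵇ-sound : ∀ m n → (m ≡ᵇ n) ≡ true → m ≡ n
≡ᵇ-sound m n e = ℕₚ.≡ᵇ⇒≡ m n (Equivalence.from T-≡ e)

≡ᵇ-refl : ∀ m → (m ≡ᵇ m) ≡ true
≡ᵇ-refl m = Equivalence.to T-≡ (ℕₚ.≡⇒≡ᵇ m m refl)

eqBool : Bool → Bool → Bool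
eqBool true  b = b
eqBool false b = not b

eqBool-refl : ∀ b → eqBool b b ≡ true
eqBool-refl true  = refl
eqBool-refl false = refl

eqList : List ℕ → List ℕ → Bool
eqList []       []       = true
eqList (x ∷ xs) (y ∷ ys) = (x ≡ᵇ y) ∧ eqList xs ys
eqList _        _        = false

hd : List ℕ → ℕ
hd []      = 0
hd (x ∷ _) = x

rot : List ℕ → List ℕ
rot []       = []
rot (x ∷ xs) = xs ∷ʳ x

rotʳ-reversed : List ℕ → List ℕ
rotʳ-reversed []       = []
rotʳ-reversed (x ∷ xs) = x ∷ reverse xs

rotʳ : List ℕ → List ℕ
rotʳ xs = rotʳ-reversed (reverse xs)

rotʳ-rot : ∀ xs → rotʳ (rot xs) ≡ xs
rotʳ-rot []       = refl
rotʳ-rot (x ∷ xs) = trans (cong rotʳ-reversed (Listₚ.reverse-++ xs (x ∷ []))) (cong (x ∷_) (Listₚ.reverse-involutive xs))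

-- A vertex seen from one of its corners: the sizes of its faces in rotation order, an entry being
-- increased by 64 when the neighbour along the corresponding dart is one that the vertex recognises.
State : Set
State = List ℕ

lab : State → List ℕ
lab = map (_% 64)

mark : ℕ → Bool
mark e = 64 ≤ᵇ e

-- Search for closed walks with negative partial sums.

-- Steps of negative partial sums through a weighted graph, given by its rows of (target, weight).
Frontier : Set
Frontier = List (ℕ × ℤ)

negative : ℤ → Bool
negative (+ _)    = false
negative -[1+ _ ] = true

negative-true : ∀ {z} → z ℤ.< 0ℤ → negative z ≡ true
negative-true { -[1+ _ ]} _ = refl
negative-true {+ n} (ℤ.+<+ ())

-- The library's _⊓_ recurses on unary representations.
minimum : ℤ → ℤ → ℤ
minimum x y = if x ℤ.≤ᵇ y then x else y

minimum-≤ˡ : ∀ x y → minimum x y ℤ.≤ x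
minimum-≤ˡ x y with x ℤ.≤ᵇ y in e
... | true  = ℤₚ.≤-refl
... | false = ℤₚ.<⇒≤ (ℤₚ.≰⇒> λ q → true≢false (Equivalence.to T-≡ (ℤₚ.≤⇒≤ᵇ q)) e)

minimum-≤ʳ : ∀ x y → minimum x y ℤ.≤ y
minimum-≤ʳ x y with x ℤ.≤ᵇ y in e
... | true  = ℤₚ.≤ᵇ⇒≤ (Equivalence.from T-≡ e)
... | false = ℤₚ.≤-refl

-- A nonnegative sum ends the walk: only walks whose partial sums are all negative are of interest.
push : ℕ → ℤ → Frontier → Frontier
push j (+ _)    F = F
push j -[1+ n ] F = (j , -[1+ n ]) ∷ F

relax : ℤ → List (ℕ × ℤ) → Frontier
relax v []            = []
relax v ((j , w) ∷ r) = push j (v ℤ.+ w) (relax v r)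

-- At a common node only the lighter walk survives; whatever the heavier one can do later, the
-- lighter one can do too.
merge : Frontier → Frontier → Frontier
merge []            G             = G
merge ((j , x) ∷ F) []            = (j , x) ∷ F
merge ((j , x) ∷ F) ((k , y) ∷ G) =
  if j ≡ᵇ k then (j , minimum x y) ∷ merge F G else
  if j <ᵇ k then (j , x) ∷ merge F ((k , y) ∷ G) else (k , y) ∷ merge ((j , x) ∷ F) G

first : List (List (ℕ × ℤ)) → List (ℕ × ℤ)
first []      = []
first (r ∷ _) = r

row : List (List (ℕ × ℤ)) → ℕ → List (ℕ × ℤ)
row R i = first (drop i R)

-- The rows are consumed along with a frontier, which is sorted: `sweep R b S` expects S = drop b R.
mutual
  sweep : List (List (ℕ × ℤ)) → ℕ → List (List (ℕ × ℤ)) → Frontier → Frontier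
  sweep R b S []            = []
  sweep R b S ((i , v) ∷ F) = visit R i v (if b ≤ᵇ i then drop (i ∸ b) S else drop i R) F

  visit : List (List (ℕ × ℤ)) → ℕ → ℤ → List (List (ℕ × ℤ)) → Frontier → Frontier
  visit R i v S F = merge (relax v (first S)) (sweep R i S F)

expand : List (List (ℕ × ℤ)) → Frontier → Frontier
expand R = sweep R 0 R

run : List (List (ℕ × ℤ)) → ℕ → Frontier → Frontier
run R zero    F = F
run R (suc n) F = run R n (expand R F)

returns : List (List (ℕ × ℤ)) → ℕ → ℕ × ℤ → Bool
returns R s (i , v) = any (λ e → (proj₁ e ≡ᵇ s) ∧ negative (v ℤ.+ proj₂ e)) (row R i)

-- Only the answer `false` is ever used, as a proof that no bad closed walk of length `n` starts at
-- `s`. Hence the cautious default at length zero, which is the length of no face.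
closes : List (List (ℕ × ℤ)) → ℕ → ℕ → Bool
closes R zero    s = true
closes R (suc n) s = any (returns R s) (run R n ((s , 0ℤ) ∷ []))

-- The invariant of the search: for a walk of weight `p` that ends at node `i`, the frontier holds
-- an entry at `i` that is no heavier.
Bounded : Frontier → ℕ → ℤ → Set
Bounded F i p = Any (λ e → proj₁ e ≡ i × proj₂ e ℤ.≤ p) F

bounded-≤ : ∀ {F i p q} → p ℤ.≤ q → Bounded F i p → Bounded F i q
bounded-≤ p≤q (here (e , y≤p)) = here (e , ℤₚ.≤-trans y≤p p≤q)
bounded-≤ p≤q (there b)        = there (bounded-≤ p≤q b)

push-old : ∀ j x {F i p} → Bounded F i p → Bounded (push j x F) i p
push-old j (+ _)    b = b
push-old j -[1+ n ] b = there b

push-new : ∀ j {x F p} → x ℤ.≤ p → p ℤ.< 0ℤ → Bounded (push j x F) j p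
push-new j {+ _}      x≤p p<0 with () ← negative-true (ℤₚ.≤-<-trans x≤p p<0)
push-new j { -[1+ n ]} x≤p p<0 = here (refl , x≤p)

relax-bounded : ∀ v r {j w p} → (j , w) ∈ r → v ℤ.+ w ℤ.≤ p → p ℤ.< 0ℤ → Bounded (relax v r) j p
relax-bounded v ((j , w) ∷ r) (here refl) q p<0 = push-new j q p<0
relax-bounded v ((j , w) ∷ r) (there m)   q p<0 = push-old j (v ℤ.+ w) (relax-bounded v r m q p<0)

merge-boundedˡ : ∀ F G {i p} → Bounded F i p → Bounded (merge F G) i p
merge-boundedˡ (_ ∷ F) []            b = b
merge-boundedˡ ((j , x) ∷ F) ((k , y) ∷ G) b with j ≡ᵇ k | j <ᵇ k | b
... | true  | _     | here (e , q) = here (e , ℤₚ.≤-trans (minimum-≤ˡ x y) q)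
... | true  | _     | there b′     = there (merge-boundedˡ F G b′)
... | false | true  | here q       = here q
... | false | true  | there b′     = there (merge-boundedˡ F ((k , y) ∷ G) b′)
... | false | false | b′           = there (merge-boundedˡ ((j , x) ∷ F) G b′)

merge-boundedʳ : ∀ F G {i p} → Bounded G i p → Bounded (merge F G) i p
merge-boundedʳ []            G             b = b
merge-boundedʳ ((j , x) ∷ F) ((k , y) ∷ G) b with j ≡ᵇ k in eq | j <ᵇ k | b
... | true  | _     | here (e , q) = here (trans (≡ᵇ-sound j k eq) e , ℤₚ.≤-trans (minimum-≤ʳ x y) q)
... | true  | _     | there b′     = there (merge-boundedʳ F G b′)
... | false | true  | b′           = there (merge-boundedʳ F ((k , y) ∷ G) b′)
... | false | false | here q       = here q
... | false | false | there b′     = there (merge-boundedʳ ((j , x) ∷ F) G b′)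

-- Rows already passed are not scanned again while the index moves forward; otherwise they are read
-- from `R` afresh. The lookup is right for every frontier.
advance : ∀ (R : List (List (ℕ × ℤ))) b i {S} → S ≡ drop b R → (if b ≤ᵇ i then drop (i ∸ b) S else drop i R) ≡ drop i R
advance R b i refl with b ≤ᵇ i in eq
... | false = refl
... | true  = trans (Listₚ.drop-drop b (i ∸ b) R) (cong (λ n → drop n R) (ℕₚ.m+[n∸m]≡n (ℕₚ.≤ᵇ⇒≤ b i (Equivalence.from T-≡ eq))))

mutual
  sweep-bounded : ∀ R b S F {i j w p q} → S ≡ drop b R → Bounded F i p → (j , w) ∈ row R i → p ℤ.+ w ℤ.≤ q → q ℤ.< 0ℤ →
                  Bounded (sweep R b S F) j q
  sweep-bounded R b S ((i , v) ∷ F) e = visit-bounded R i v _ F (advance R b i e)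

  visit-bounded : ∀ R k v S F {i j w p q} → S ≡ drop k R → Bounded ((k , v) ∷ F) i p → (j , w) ∈ row R i → p ℤ.+ w ℤ.≤ q → q ℤ.< 0ℤ →
                  Bounded (visit R k v S F) j q
  visit-bounded R k v S F {w = w} refl (here (refl , v≤p)) m pw≤q q<0 =
    merge-boundedˡ _ (sweep R k S F) (relax-bounded v (row R k) m (ℤₚ.≤-trans (ℤₚ.+-monoˡ-≤ w v≤p) pw≤q) q<0)
  visit-bounded R k v S F refl (there b) m pw≤q q<0 =
    merge-boundedʳ (relax v (row R k)) _ (sweep-bounded R k S F refl b m pw≤q q<0)

expand-bounded : ∀ R F {i j w p q} → Bounded F i p → (j , w) ∈ row R i → p ℤ.+ w ℤ.≤ q → q ℤ.< 0ℤ → Bounded (expand R F) j q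
expand-bounded R F = sweep-bounded R 0 R F refl

-- The edge of the graph may be lighter than the real step `w i`, because merged vertices are
-- represented by their least share.
record Walk (R : List (List (ℕ × ℤ))) (node : ℕ → ℕ) (w : ℕ → ℤ) : Set where
  field
    step : ∀ i → ∃ λ c → (node (suc i) , c) ∈ row R (node i) × c ℤ.≤ w i

module _ {R : List (List (ℕ × ℤ))} where

  expand-run : ∀ n F → run R (suc n) F ≡ expand R (run R n F)
  expand-run zero    F = refl
  expand-run (suc n) F = expand-run n (expand R F)

  run-bounded : ∀ {node w} → Walk R node w → ∀ n → (∀ j → 0 ℕ.< j → j ℕ.≤ n → prefix w j ℤ.< 0ℤ) →
                Bounded (run R n ((node 0 , 0ℤ) ∷ [])) (node n) (prefix w n)
  run-bounded W zero    neg = here (refl , ℤₚ.≤-refl)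
  run-bounded {node} {w} W (suc n) neg with Walk.step W n
  ... | c , m , c≤w = subst (λ F → Bounded F (node (suc n)) (prefix w (suc n))) (sym (expand-run n ((node 0 , 0ℤ) ∷ [])))
    (expand-bounded R _ (run-bounded W n (λ j 0<j j≤n → neg j 0<j (ℕₚ.m≤n⇒m≤1+n j≤n))) m (ℤₚ.+-monoʳ-≤ (prefix w n) c≤w) (neg (suc n) (s≤s z≤n) ℕₚ.≤-refl))

  returns-sound : ∀ {i s v w p} → (s , w) ∈ row R i → v ℤ.≤ p → p ℤ.+ w ℤ.< 0ℤ → returns R s (i , v) ≡ true
  returns-sound {i} {s} {v} {w} m v≤p neg = find m
    where
    find : ∀ {r} → (s , w) ∈ r → any (λ e → (proj₁ e ≡ᵇ s) ∧ negative (v ℤ.+ proj₂ e)) r ≡ true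
    find (here refl) rewrite ≡ᵇ-refl s | negative-true (ℤₚ.≤-<-trans (ℤₚ.+-monoˡ-≤ w v≤p) neg) = refl
    find {(k , y) ∷ r} (there m) with (k ≡ᵇ s) ∧ negative (v ℤ.+ y)
    ... | true  = refl
    ... | false = find m

  -- By `run-bounded` some frontier entry is no heavier than the walk before its last step, so the
  -- closing edge would be found from that entry.
  closes-sound : ∀ {node w} → Walk R node w → ∀ n → node n ≡ node 0 → closes R n (node 0) ≡ false →
                 ¬ (∀ j → 0 ℕ.< j → j ℕ.≤ n → prefix w j ℤ.< 0ℤ)
  closes-sound {node} {w} W (suc n) e c neg with Walk.step W n
  ... | d , m , d≤w = true≢false (find (run-bounded W n (λ j 0<j j≤n → neg j 0<j (ℕₚ.m≤n⇒m≤1+n j≤n)))) c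
    where
    find : ∀ {F} → Bounded F (node n) (prefix w n) → any (returns R (node 0)) F ≡ true
    find {_ ∷ F} (here (refl , v≤p)) = cong (_∨ any (returns R (node 0)) F)
      (returns-sound {node n} (subst (λ s → (s , d) ∈ row R (node n)) e m) v≤p (ℤₚ.≤-<-trans (ℤₚ.+-monoʳ-≤ (prefix w n) d≤w) (neg (suc n) (s≤s z≤n) ℕₚ.≤-refl)))
    find {x ∷ F} (there b) with returns R (node 0) x
    ... | true  = refl
    ... | false = find b

  -- An empty frontier after one step means that no edge leaving the start is negative. This settles
  -- labels whose faces have unbounded length.
  dies-sound : ∀ {node w} → Walk R node w → expand R ((node 0 , 0ℤ) ∷ []) ≡ [] → ¬ (prefix w 1 ℤ.< 0ℤ)
  dies-sound {node} {w} W e neg with run-bounded W 1 (λ { (suc zero) _ _ → neg ; (suc (suc j)) _ (s≤s ()) })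
  ... | b with () ← subst (λ F → Bounded F (node 1) (prefix w 1)) e b

-- Discharging schemes as finite checks, and their soundness.

-- `gen i o` retains only the labels across the incoming and the outgoing edge of the face walk;
-- `spec` retains the whole state.
data Node : Set where
  gen  : (i o : ℕ) → Node
  spec : State → Node

-- A discharging scheme.  Vertices for which `known` fails take part only through their shares, so
-- along a face they may be merged whenever the two neighbouring faces agree.
module Scheme (labels : List ℕ) (corners : List (List ℕ))
  (known : List ℕ → Bool)
  (seen : List (List ℕ × List ℕ))
  (share : State → ℤ) (give : State → State → ℤ) (allowed : State → State → Bool)
  where

  sees : List ℕ → List ℕ → Bool
  sees A B = known A ∧ known B ∧ any (λ p → eqList (proj₁ p) A ∧ eqList (proj₂ p) B) seen

  seeing : List ℕ → Bool
  seeing A = any (λ p → eqList (proj₁ p) A) seen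

  -- Labels alone do not decide a mark, since it depends on the neighbour. Both possibilities are
  -- offered here, and `joins` removes the wrong ones along faces.
  marked : ℕ → List ℕ → List State
  marked zero    A = [] ∷ []
  marked (suc n) A = concatMap (λ X → (hd A ∷ X) ∷ (if seeing A then ((hd A ℕ.+ 64) ∷ X) ∷ [] else [])) (marked n (rot A))

  statesOf : List ℕ → List State
  statesOf A = marked (length A) A

  states : List State
  states = concatMap statesOf corners

  give′ : State → State → ℤ
  give′ X Y = if known (lab X) ∧ known (lab Y) then give X Y else 0ℤ

  rotations : ℕ → State → List State
  rotations zero    X = []
  rotations (suc n) X = X ∷ rotations n (rot X)

  -- A record, so that comparing its instances compares the parameters and does not run the check.
  record VertexOK (E : List ℕ → ℤ) : Set where
    constructor vertexOK
    field check : all (λ X → ℤ∑.∑ₗ share (rotations (length X) X) ℤ.≤ᵇ E (lab X)) states ≡ true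

  nodeIf : Bool → State → Node
  nodeIf true  X = spec X
  nodeIf false X = gen (hd (lab (rotʳ X))) (hd (lab (rot X)))

  node : State → Node
  node X = nodeIf (known (lab X)) X

  in′ out′ : Node → ℕ
  in′ (gen i o) = i
  in′ (spec X)  = hd (lab (rotʳ X))
  out′ (gen i o) = o
  out′ (spec X)  = hd (lab (rot X))

  -- Marks are claims about the neighbour, to be confirmed in both directions: `rotʳ Y` and `rot X`
  -- are the same two vertices seen from the other side of their common edge.
  joins : Node → Node → Bool
  joins (gen i o) (gen i′ o′) = true
  joins (gen i o) (spec Y)    = not (mark (hd (rotʳ Y)))
  joins (spec X)  (gen i o)   = not (mark (hd X))
  joins (spec X)  (spec Y)    = eqBool (mark (hd X)) (sees (lab X) (lab Y))
    ∧ (eqBool (mark (hd (rotʳ Y))) (sees (lab (rotʳ Y)) (lab (rot X))) ∧ allowed X Y)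

  compatible : Node → Node → Bool
  compatible u v = (out′ u ≡ᵇ in′ v) ∧ joins u v

  -- The subtracted term is what crosses the same edge in the opposite direction.
  transfer : Node → Node → ℤ
  transfer (spec X) (spec Y) = give′ X Y ℤ.- give′ (rotʳ Y) (rot X)
  transfer _        _        = 0ℤ

  insertGen : ℕ → ℕ → ℤ → List (Node × ℤ) → List (Node × ℤ)
  insertGen i o c [] = (gen i o , c) ∷ []
  insertGen i o c ((spec X , y) ∷ L) = (spec X , y) ∷ insertGen i o c L
  insertGen i o c ((gen i′ o′ , y) ∷ L) =
    if (i ≡ᵇ i′) ∧ (o ≡ᵇ o′) then (gen i o , minimum c y) ∷ L else (gen i′ o′ , y) ∷ insertGen i o c L

  insertNode : State → Node → List (Node × ℤ) → List (Node × ℤ)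
  insertNode X (spec Y)  L = (spec Y , share X) ∷ L
  insertNode X (gen i o) L = insertGen i o (share X) L

  collect : List State → List (Node × ℤ)
  collect []       = []
  collect (X ∷ Xs) = insertNode X (node X) (collect Xs)

  targets : List (Node × ℤ) → List (ℕ × Node)
  targets = map (λ e → in′ (proj₁ e) , proj₁ e)

  rowOf : Node → ℕ → ℤ → ℕ → List (ℕ × Node) → List (ℕ × ℤ)
  rowOf u o c j []            = []
  rowOf u o c j ((i , v) ∷ L) = if (o ≡ᵇ i) ∧ joins u v then (j , c ℤ.+ transfer u v) ∷ rowOf u o c (suc j) L else rowOf u o c (suc j) L

  rowsOf : List (ℕ × Node) → List (Node × ℤ) → List (List (ℕ × ℤ))
  rowsOf T []            = []
  rowsOf T ((u , c) ∷ L) = rowOf u (out′ u) c 0 T ∷ rowsOf T L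

  rows : List (Node × ℤ) → List (List (ℕ × ℤ))
  rows G = rowsOf (targets G) G

  null : Frontier → Bool
  null []      = true
  null (_ ∷ _) = false

  -- Passing intermediate results as function arguments makes the type checker share them.
  faceOK-rows : List ℕ → ℕ → List (List (ℕ × ℤ)) → Bool
  faceOK-rows ns m R = all (λ n → all (λ s → not (closes R n s)) (upTo m)) ns

  faceOK-graph : List ℕ → List (Node × ℤ) → Bool
  faceOK-graph ns G = faceOK-rows ns (length G) (rows G)

  idleOK-rows : ℕ → List (List (ℕ × ℤ)) → Bool
  idleOK-rows m R = all (λ s → null (expand R ((s , 0ℤ) ∷ []))) (upTo m)

  idleOK-graph : List (Node × ℤ) → Bool
  idleOK-graph G = idleOK-rows (length G) (rows G)

  statesAt : List State → ℕ → List State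
  statesAt S k = filterᵇ (λ X → hd (lab X) ≡ᵇ k) S

  faceOK : List State → ℕ × List ℕ → Bool
  faceOK S (k , ns) = faceOK-graph ns (collect (statesAt S k))

  record FacesOK (ps : List (ℕ × List ℕ)) : Set where
    constructor facesOK
    field check : all (faceOK states) ps ≡ true

  idleOK : List State → ℕ → Bool
  idleOK S k = idleOK-graph (collect (statesAt S k))

  Covered : List (Node × ℤ) → Node → ℤ → Set
  Covered G u s = ∃ λ c → (u , c) ∈ G × c ℤ.≤ s

  insertGen-new : ∀ i o c L → Covered (insertGen i o c L) (gen i o) c
  insertGen-new i o c [] = c , here refl , ℤₚ.≤-refl
  insertGen-new i o c ((spec X , y) ∷ L) with insertGen-new i o c L
  ... | c′ , m , q = c′ , there m , q
  insertGen-new i o c ((gen i′ o′ , y) ∷ L) with (i ≡ᵇ i′) ∧ (o ≡ᵇ o′)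
  ... | true  = _ , here refl , minimum-≤ˡ c y
  ... | false with insertGen-new i o c L
  ...   | c′ , m , q = c′ , there m , q

  insertGen-old : ∀ i o c L {u s} → Covered L u s → Covered (insertGen i o c L) u s
  insertGen-old i o c ((spec X , y) ∷ L) (c′ , here e , q) = c′ , here e , q
  insertGen-old i o c ((spec X , y) ∷ L) (c′ , there m , q) with insertGen-old i o c L (c′ , m , q)
  ... | c″ , m″ , q″ = c″ , there m″ , q″
  insertGen-old i o c ((gen i′ o′ , y) ∷ L) cov with (i ≡ᵇ i′) ∧ (o ≡ᵇ o′) in eq
  insertGen-old i o c ((gen i′ o′ , y) ∷ L) (c′ , here refl , q) | true
    rewrite ≡ᵇ-sound i i′ (proj₁ (∧-true eq)) | ≡ᵇ-sound o o′ (proj₂ (∧-true {i ≡ᵇ i′} eq)) = _ , here refl , ℤₚ.≤-trans (minimum-≤ʳ c y) q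
  insertGen-old i o c ((gen i′ o′ , y) ∷ L) (c′ , there m , q) | true  = c′ , there m , q
  insertGen-old i o c ((gen i′ o′ , y) ∷ L) (c′ , here e , q)  | false = c′ , here e , q
  insertGen-old i o c ((gen i′ o′ , y) ∷ L) (c′ , there m , q) | false with insertGen-old i o c L (c′ , m , q)
  ... | c″ , m″ , q″ = c″ , there m″ , q″

  insertNode-new : ∀ X u L → Covered (insertNode X u L) u (share X)
  insertNode-new X (spec Y)  L = _ , here refl , ℤₚ.≤-refl
  insertNode-new X (gen i o) L = insertGen-new i o (share X) L

  insertNode-old : ∀ X u L {v s} → Covered L v s → Covered (insertNode X u L) v s
  insertNode-old X (spec Y)  L (c , m , q) = c , there m , q
  insertNode-old X (gen i o) L cov         = insertGen-old i o (share X) L cov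

  collect-covers : ∀ Xs {X} → X ∈ Xs → Covered (collect Xs) (node X) (share X)
  collect-covers (Y ∷ Xs) (here refl) = insertNode-new Y (node Y) (collect Xs)
  collect-covers (Y ∷ Xs) (there m)   = insertNode-old Y (node Y) (collect Xs) (collect-covers Xs m)

  index : ∀ {G : List (Node × ℤ)} {e} → e ∈ G → ℕ
  index (here _)  = 0
  index (there m) = suc (index m)

  index< : ∀ {G : List (Node × ℤ)} {e} (m : e ∈ G) → index m ∈ upTo (length G)
  index< {G} m = Anyₚ.applyUpTo⁺ (λ i → i) refl (bound m)
    where
    bound : ∀ {G e} (m : e ∈ G) → index m ℕ.< length G
    bound (here _)  = s≤s z≤n
    bound (there m) = s≤s (bound m)

  row-rows : ∀ T {L u c} (m : (u , c) ∈ L) → row (rowsOf T L) (index m) ≡ rowOf u (out′ u) c 0 T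
  row-rows T (here refl) = refl
  row-rows T (there m)   = row-rows T m

  rowOf-∈ : ∀ u c j {L v d} (m : (v , d) ∈ L) → compatible u v ≡ true →
            (j ℕ.+ index m , c ℤ.+ transfer u v) ∈ rowOf u (out′ u) c j (targets L)
  rowOf-∈ u c j {(v , _) ∷ L} (here refl) e rewrite e = here (cong (_, (c ℤ.+ transfer u v)) (ℕₚ.+-identityʳ j))
  rowOf-∈ u c j {(v′ , _) ∷ L} {v} (there m) e with compatible u v′
  ... | true  = there (subst (λ i → (i , c ℤ.+ transfer u v) ∈ rowOf u (out′ u) c (suc j) (targets L)) (sym (ℕₚ.+-suc j (index m))) (rowOf-∈ u c (suc j) m e))
  ... | false = subst (λ i → (i , c ℤ.+ transfer u v) ∈ rowOf u (out′ u) c (suc j) (targets L)) (sym (ℕₚ.+-suc j (index m))) (rowOf-∈ u c (suc j) m e)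

  -- `X d` is the state that the map realises at `d`. Soundness comes from the fact that iterating
  -- `φ` traces a walk through these states in the checked graph.
  module Apply (M : Map) (cap : ℕ → ℕ) (cap<64 : ∀ s → cap s ℕ.< 64)
    (known-rot : ∀ A → known (rot A) ≡ known A)
    (complete : ∀ d → map cap (Maps.corner M d) ∈ corners) where

    open Maps M
    open Discharging M

    around : (Fin darts → ℕ) → Fin darts → List ℕ
    around g d = applyUpTo (λ i → g (iter σf i d)) (dg d)

    dg-suc : ∀ d → ∃ λ m → dg d ≡ suc m
    dg-suc d = go (dg d) (VO.fibre-nonempty d)
      where
      go : ∀ n → 0 ℕ.< n → ∃ λ m → n ≡ suc m
      go (suc m) _ = m , refl

    applyUpTo-σ : ∀ (g : Fin darts → ℕ) d n → applyUpTo (λ i → g (iter σf i (σf d))) n ≡ applyUpTo (λ i → g (iter σf (suc i) d)) n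
    applyUpTo-σ g d n = applyUpTo-cong (λ i → cong g (iter-comm σf i d)) n
      where
      applyUpTo-cong : ∀ {f f′ : ℕ → ℕ} → (∀ i → f i ≡ f′ i) → ∀ n → applyUpTo f n ≡ applyUpTo f′ n
      applyUpTo-cong e zero    = refl
      applyUpTo-cong e (suc n) = cong₂ _∷_ (e 0) (applyUpTo-cong (e ∘ suc) n)

    around-σ : ∀ g d → around g (σf d) ≡ rot (around g d)
    around-σ g d = trans (cong (λ v → applyUpTo (λ i → g (iter σf i (σf d))) (deg v)) (vert-σ d)) (go (dg d) (dg-suc d) (VO.fibre-period d))
      where
      go : ∀ n → (∃ λ m → n ≡ suc m) → iter σf n d ≡ d →
           applyUpTo (λ i → g (iter σf i (σf d))) n ≡ rot (applyUpTo (λ i → g (iter σf i d)) n)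
      go .(suc m) (m , refl) per = begin
        applyUpTo (λ i → g (iter σf i (σf d))) (suc m)                          ≡⟨ applyUpTo-σ g d (suc m) ⟩
        applyUpTo (λ i → g (iter σf (suc i) d)) (suc m)                         ≡⟨ sym (Listₚ.applyUpTo-∷ʳ (λ i → g (iter σf (suc i) d)) m) ⟩
        applyUpTo (λ i → g (iter σf (suc i) d)) m ∷ʳ g (iter σf (suc m) d)      ≡⟨ cong (λ e → applyUpTo (λ i → g (iter σf (suc i) d)) m ∷ʳ g e) per ⟩
        applyUpTo (λ i → g (iter σf (suc i) d)) m ∷ʳ g d                        ∎
        where open ≡-Reasoning

    around-hd : ∀ g d → hd (around g d) ≡ g d
    around-hd g d = go (dg d) (VO.fibre-nonempty d)
      where
      go : ∀ n → 0 ℕ.< n → hd (applyUpTo (λ i → g (iter σf i d)) n) ≡ g d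
      go (suc m) _ = refl

    A : Fin darts → List ℕ
    A = around (cap ∘ sz)

    A≡ : ∀ d → A d ≡ map cap (corner d)
    A≡ d = sym (Listₚ.map-applyUpTo (λ i → sz (iter σf i d)) cap (dg d))

    el : Fin darts → ℕ
    el e = if sees (A e) (A (φ e)) then cap (sz e) ℕ.+ 64 else cap (sz e)

    X : Fin darts → State
    X = around el

    lab-el : ∀ e → el e % 64 ≡ cap (sz e)
    lab-el e with sees (A e) (A (φ e))
    ... | true  = trans ([m+n]%n≡m%n (cap (sz e)) 64) (m<n⇒m%n≡m (cap<64 (sz e)))
    ... | false = m<n⇒m%n≡m (cap<64 (sz e))

    mark-el : ∀ e → mark (el e) ≡ sees (A e) (A (φ e))
    mark-el e with sees (A e) (A (φ e))
    ... | true  = Equivalence.to T-≡ (ℕₚ.≤⇒≤ᵇ (ℕₚ.m≤n+m 64 (cap (sz e))))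
    ... | false = ≢true (λ q → ℕₚ.<⇒≱ (cap<64 (sz e)) (ℕₚ.≤ᵇ⇒≤ 64 (cap (sz e)) (Equivalence.from T-≡ q)))
      where
      ≢true : ∀ {b} → (b ≡ true → ⊥) → b ≡ false
      ≢true {true}  f = ⊥-elim (f refl)
      ≢true {false} f = refl

    lab-X : ∀ d → lab (X d) ≡ A d
    lab-X d = trans (Listₚ.map-applyUpTo (λ i → el (iter σf i d)) (_% 64) (dg d)) (go (λ i → iter σf i d) (dg d))
      where
      go : ∀ (h : ℕ → Fin darts) n → applyUpTo (λ i → el (h i) % 64) n ≡ applyUpTo (λ i → cap (sz (h i))) n
      go h zero    = refl
      go h (suc n) = cong₂ _∷_ (lab-el (h 0)) (go (h ∘ suc) n)

    X-σ : ∀ d → X (σf d) ≡ rot (X d)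
    X-σ = around-σ el

    rotʳ-X : ∀ d → rotʳ (X (φ d)) ≡ X (αf d)
    rotʳ-X d = trans (cong rotʳ (X-σ (αf d))) (rotʳ-rot (X (αf d)))

    X-φα : ∀ d → X (φ (αf d)) ≡ rot (X d)
    X-φα d = trans (cong X (φα d)) (X-σ d)

    hd-X : ∀ d → hd (X d) ≡ el d
    hd-X = around-hd el

    hd-lab-X : ∀ d → hd (lab (X d)) ≡ cap (sz d)
    hd-lab-X d = trans (cong hd (lab-X d)) (around-hd (cap ∘ sz) d)

    known-X : ∀ d → known (lab (X (σf d))) ≡ known (lab (X d))
    known-X d = trans (cong known (trans (lab-X (σf d)) (around-σ (cap ∘ sz) d))) (trans (known-rot (A d)) (cong known (sym (lab-X d))))

    out-X : ∀ d → hd (lab (rot (X d))) ≡ cap (sz (αf d))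
    out-X d = trans (cong (hd ∘ lab) (sym (X-σ d))) (trans (hd-lab-X (σf d)) (cong (cap ∘ size) (sym (face-α d))))

    in-X : ∀ d → hd (lab (rotʳ (X (φ d)))) ≡ cap (sz (αf d))
    in-X d = trans (cong (hd ∘ lab) (rotʳ-X d)) (hd-lab-X (αf d))

    out≡in : ∀ d → (hd (lab (rot (X d))) ≡ᵇ hd (lab (rotʳ (X (φ d))))) ≡ true
    out≡in d = subst₂ (λ a b → (a ≡ᵇ b) ≡ true) (sym (out-X d)) (sym (in-X d)) (≡ᵇ-refl (cap (sz (αf d))))

    mark-X : ∀ d → mark (hd (X d)) ≡ sees (lab (X d)) (lab (X (φ d)))
    mark-X d = trans (cong mark (hd-X d)) (trans (mark-el d) (cong₂ sees (sym (lab-X d)) (sym (lab-X (φ d)))))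

    mark-Xʳ : ∀ d → mark (hd (rotʳ (X (φ d)))) ≡ sees (lab (rotʳ (X (φ d)))) (lab (rot (X d)))
    mark-Xʳ d = trans (cong (mark ∘ hd) (rotʳ-X d)) (trans (mark-X (αf d)) (cong₂ (λ a b → sees (lab a) (lab b)) (sym (rotʳ-X d)) (X-φα d)))

    give″ : Fin darts → ℤ
    give″ d = give′ (X d) (X (φ d))

    net : Fin darts → ℤ
    net d = share (X d) ℤ.+ (give″ d ℤ.- give″ (αf d))

    discharge-net : ∀ E → (∀ d → orbit-sum (share ∘ X) d ℤ.≤ E (vert d)) →
                    (∀ d → ¬ (∀ j → 0 ℕ.< j → j ℕ.≤ sz d → walk net d j ℤ.< 0ℤ)) → 0ℤ ℤ.≤ ℤ∑.sum E
    discharge-net = discharge (share ∘ X) give″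

    give″-α : ∀ d → give″ (αf d) ≡ give′ (rotʳ (X (φ d))) (rot (X d))
    give″-α d = cong₂ give′ (sym (rotʳ-X d)) (X-φα d)

    sees-unknownˡ : ∀ {A} B → known A ≡ false → sees A B ≡ false
    sees-unknownˡ B e rewrite e = refl

    sees-unknownʳ : ∀ A {B} → known B ≡ false → sees A B ≡ false
    sees-unknownʳ A e rewrite e with known A
    ... | true  = refl
    ... | false = refl

    known-φ : ∀ d → known (lab (rotʳ (X (φ d)))) ≡ known (lab (X (φ d)))
    known-φ d = trans (cong (known ∘ lab) (rotʳ-X d)) (sym (known-X (αf d)))

    known-rotX : ∀ d → known (lab (rot (X d))) ≡ known (lab (X d))
    known-rotX d = trans (cong (known ∘ lab) (sym (X-σ d))) (known-X d)

    ∧-intro : ∀ {a b} → a ≡ true → b ≡ true → (a ∧ b) ≡ true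
    ∧-intro refl refl = refl

    eqBool-≡ : ∀ {a b} → a ≡ b → eqBool a b ≡ true
    eqBool-≡ {a} refl = eqBool-refl a

    not-≡ : ∀ {a} → a ≡ false → not a ≡ true
    not-≡ refl = refl

    -- An unknown vertex neither sees nor is seen, so a known neighbour carries no mark towards it,
    -- which is what `joins` demands of a merged node.
    compatible-X : (∀ d → allowed (X d) (X (φ d)) ≡ true) → ∀ d → compatible (node (X d)) (node (X (φ d))) ≡ true
    compatible-X ok d = cases (known (lab (X d))) (known (lab (X (φ d)))) refl refl
      where
      cases : ∀ b c → known (lab (X d)) ≡ b → known (lab (X (φ d))) ≡ c → compatible (nodeIf b (X d)) (nodeIf c (X (φ d))) ≡ true
      cases true  true  p q = ∧-intro (out≡in d) (∧-intro (eqBool-≡ (mark-X d)) (∧-intro (eqBool-≡ (mark-Xʳ d)) (ok d)))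
      cases true  false p q = ∧-intro (out≡in d) (not-≡ (trans (mark-X d) (sees-unknownʳ (lab (X d)) q)))
      cases false true  p q = ∧-intro (out≡in d) (not-≡ (trans (mark-Xʳ d) (sees-unknownʳ (lab (rotʳ (X (φ d)))) (trans (known-rotX d) p))))
      cases false false p q = ∧-intro (out≡in d) refl

    give′-unknownˡ : ∀ Y Z → known (lab Y) ≡ false → give′ Y Z ≡ 0ℤ
    give′-unknownˡ Y Z e = cong (λ b → if b ∧ known (lab Z) then give Y Z else 0ℤ) e

    give′-unknownʳ : ∀ Y Z → known (lab Z) ≡ false → give′ Y Z ≡ 0ℤ
    give′-unknownʳ Y Z e = cong (λ b → if b then give Y Z else 0ℤ) (trans (cong (known (lab Y) ∧_) e) (∧-zeroʳ (known (lab Y))))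

    transfer-X : ∀ d → transfer (node (X d)) (node (X (φ d))) ≡ give″ d ℤ.- give″ (αf d)
    transfer-X d = trans (cases (known (lab (X d))) (known (lab (X (φ d)))) refl refl) (cong (λ t → give″ d ℤ.- t) (sym (give″-α d)))
      where
      zero-diff : ∀ {a b} → a ≡ 0ℤ → b ≡ 0ℤ → 0ℤ ≡ a ℤ.- b
      zero-diff refl refl = refl
      cases : ∀ b c → known (lab (X d)) ≡ b → known (lab (X (φ d))) ≡ c →
              transfer (nodeIf b (X d)) (nodeIf c (X (φ d))) ≡ give″ d ℤ.- give′ (rotʳ (X (φ d))) (rot (X d))
      cases true  true  p q = refl
      cases true  false p q = zero-diff (give′-unknownʳ (X d) (X (φ d)) q) (give′-unknownˡ (rotʳ (X (φ d))) (rot (X d)) (trans (known-φ d) q))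
      cases false true  p q = zero-diff (give′-unknownˡ (X d) (X (φ d)) p) (give′-unknownʳ (rotʳ (X (φ d))) (rot (X d)) (trans (known-rotX d) p))
      cases false false p q = zero-diff (give′-unknownˡ (X d) (X (φ d)) p) (give′-unknownˡ (rotʳ (X (φ d))) (rot (X d)) (trans (known-φ d) q))

    eqList-refl : ∀ xs → eqList xs xs ≡ true
    eqList-refl []       = refl
    eqList-refl (x ∷ xs) rewrite ≡ᵇ-refl x = eqList-refl xs

    sees⇒seeing : ∀ A B → sees A B ≡ true → seeing A ≡ true
    sees⇒seeing A B e = go seen (proj₂ (∧-true {known B} (proj₂ (∧-true {known A} e))))
      where
      go : ∀ ps → any (λ p → eqList (proj₁ p) A ∧ eqList (proj₂ p) B) ps ≡ true → any (λ p → eqList (proj₁ p) A) ps ≡ true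
      go (p ∷ ps) e with eqList (proj₁ p) A
      ... | true  = refl
      ... | false = go ps e

    X∈marked : ∀ n d → applyUpTo (λ i → el (iter σf i d)) n ∈ marked n (A d)
    X∈marked zero    d = here refl
    X∈marked (suc n) d = ∈-concatMap⁺ _ (lose′ (X∈marked n (σf d)))
      where
      tail≡ : applyUpTo (λ i → el (iter σf i (σf d))) n ≡ applyUpTo (λ i → el (iter σf (suc i) d)) n
      tail≡ = applyUpTo-σ el d n
      tl : State
      tl = applyUpTo (λ i → el (iter σf (suc i) d)) n
      options : ∀ b → (b ≡ true → seeing (A d) ≡ true) →
        ((if b then hd (A d) ℕ.+ 64 else hd (A d)) ∷ tl) ∈ ((hd (A d) ∷ tl) ∷ (if seeing (A d) then ((hd (A d) ℕ.+ 64) ∷ tl) ∷ [] else []))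
      options false _ = here refl
      options true  h = subst (λ b → ((hd (A d) ℕ.+ 64) ∷ tl) ∈ ((hd (A d) ∷ tl) ∷ (if b then ((hd (A d) ℕ.+ 64) ∷ tl) ∷ [] else []))) (sym (h refl)) (there (here refl))
      choose : (el d ∷ tl) ∈ ((hd (A d) ∷ tl) ∷ (if seeing (A d) then ((hd (A d) ℕ.+ 64) ∷ tl) ∷ [] else []))
      choose = subst (λ c → ((if sees (A d) (A (φ d)) then c ℕ.+ 64 else c) ∷ tl) ∈ ((hd (A d) ∷ tl) ∷ (if seeing (A d) then ((hd (A d) ℕ.+ 64) ∷ tl) ∷ [] else [])))
        (around-hd (cap ∘ sz) d) (options (sees (A d) (A (φ d))) (sees⇒seeing (A d) (A (φ d))))
      lose′ : applyUpTo (λ i → el (iter σf i (σf d))) n ∈ marked n (A (σf d)) →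
              Any (λ X → (el d ∷ tl) ∈ ((hd (A d) ∷ X) ∷ (if seeing (A d) then ((hd (A d) ℕ.+ 64) ∷ X) ∷ [] else []))) (marked n (rot (A d)))
      lose′ m = Any-lose (subst₂ (λ a b → a ∈ marked n b) tail≡ (around-σ (cap ∘ sz) d) m) choose
        where open import Data.List.Membership.Propositional using () renaming (lose to Any-lose)

    X∈states : ∀ d → X d ∈ states
    X∈states d = ∈-concatMap⁺ statesOf (lose (complete d) (subst (λ B → X d ∈ marked (length B) B) (A≡ d)
        (subst (λ n → X d ∈ marked n (A d)) (sym (Listₚ.length-applyUpTo (λ i → cap (sz (iter σf i d))) (dg d))) (X∈marked (dg d) d))))
      where open import Data.List.Membership.Propositional using (lose)

    vertexOK-sound : ∀ {E} → VertexOK E → ∀ d → orbit-sum (share ∘ X) d ℤ.≤ E (A d)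
    vertexOK-sound {E} ok d = subst₂ ℤ._≤_ sum≡ (cong E (lab-X d))
      (ℤₚ.≤ᵇ⇒≤ (Equivalence.from T-≡ (all-∈ (λ X → ∑ₗ share (rotations (length X) X) ℤ.≤ᵇ E (lab X)) (VertexOK.check ok) (X∈states d))))
      where
      open ℤ∑
      rotations≡ : ∀ n d → rotations n (X d) ≡ applyUpTo (λ i → X (iter σf i d)) n
      rotations≡ zero    d = refl
      rotations≡ (suc n) d = cong (X d ∷_) (trans (cong (rotations n) (sym (X-σ d))) (trans (rotations≡ n (σf d))
        (go n (λ i → cong X (iter-comm σf i d)))))
        where
        go : ∀ {f f′ : ℕ → State} n → (∀ i → f i ≡ f′ i) → applyUpTo f n ≡ applyUpTo f′ n
        go zero    e = refl
        go (suc n) e = cong₂ _∷_ (e 0) (go n (e ∘ suc))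
      sum≡ : ∑ₗ share (rotations (length (X d)) (X d)) ≡ orbit-sum (share ∘ X) d
      sum≡ = trans (cong (λ n → ∑ₗ share (rotations n (X d))) (Listₚ.length-applyUpTo (λ i → el (iter σf i d)) (dg d)))
        (trans (cong (∑ₗ share) (rotations≡ (dg d) d)) (∑ₗ-applyUpTo share (λ i → X (iter σf i d)) (dg d)))

    module Face (ok : ∀ d → allowed (X d) (X (φ d)) ≡ true) (k : ℕ) (G : List (Node × ℤ))
      (covered : ∀ e → cap (sz e) ≡ k → Covered G (node (X e)) (share (X e))) where

      position : ∀ {e} → Covered G (node (X e)) (share (X e)) → ℕ
      position (_ , m , _) = index m

      idx : ∀ e → cap (sz e) ≡ k → ℕ
      idx e p = position (covered e p)

      -- Positions depend on proofs of `cap (sz e) ≡ k`. When the walk returns to its start the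
      -- proof has changed, but equalities of naturals are irrelevant.
      idx-cong : ∀ {e e′} → e ≡ e′ → ∀ p p′ → idx e p ≡ idx e′ p′
      idx-cong {e} refl p p′ = cong (idx e) (ℕₚ.≡-irrelevant p p′)

      on : ∀ d → cap (sz d) ≡ k → ∀ i → cap (sz (iter φ i d)) ≡ k
      on d p i = trans (cong (cap ∘ size) (FO.lab-iter i d)) p

      edge : ∀ e (x : Covered G (node (X e)) (share (X e))) (y : Covered G (node (X (φ e))) (share (X (φ e)))) →
             ∃ λ c → (position y , c) ∈ row (rows G) (position x) × c ℤ.≤ net e
      edge e (c , m , q) (_ , m′ , _) = c ℤ.+ transfer (node (X e)) (node (X (φ e))) ,
        subst (λ r → (index m′ , c ℤ.+ transfer (node (X e)) (node (X (φ e)))) ∈ r) (sym (row-rows (targets G) m))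
          (rowOf-∈ (node (X e)) c 0 m′ (compatible-X ok e)) ,
        subst (λ t → c ℤ.+ t ℤ.≤ net e) (sym (transfer-X e)) (ℤₚ.+-monoˡ-≤ (give″ e ℤ.- give″ (αf e)) q)

      walkOf : ∀ d (p : cap (sz d) ≡ k) → Walk (rows G) (λ i → idx (iter φ i d) (on d p i)) (λ i → net (iter φ i d))
      walkOf d p = record { step = λ i → edge (iter φ i d) (covered (iter φ i d) (on d p i)) (covered (iter φ (suc i) d) (on d p (suc i))) }

      position∈ : ∀ {e} (x : Covered G (node (X e)) (share (X e))) → position x ∈ upTo (length G)
      position∈ (_ , m , _) = index< m

      idx∈ : ∀ d p → idx d p ∈ upTo (length G)
      idx∈ d p = position∈ (covered d p)

      not-true : ∀ {b} → not b ≡ true → b ≡ false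
      not-true {false} _ = refl

      graph-sound : ∀ ns → faceOK-graph ns G ≡ true → ∀ d → cap (sz d) ≡ k → sz d ∈ ns →
                    ¬ (∀ j → 0 ℕ.< j → j ℕ.≤ sz d → walk net d j ℤ.< 0ℤ)
      graph-sound ns e d p n∈ = closes-sound (walkOf d p) (sz d) (idx-cong (FO.fibre-period d) (on d p (sz d)) (on d p 0))
        (not-true (all-∈ (λ s → not (closes (rows G) (sz d) s)) (all-∈ (λ n → all (λ s → not (closes (rows G) n s)) (upTo (length G))) e n∈) (idx∈ d (on d p 0))))

      null-sound : ∀ {F} → null F ≡ true → F ≡ []
      null-sound {[]} _ = refl

      idle-sound : idleOK-graph G ≡ true → ∀ d → cap (sz d) ≡ k → ¬ (∀ j → 0 ℕ.< j → j ℕ.≤ sz d → walk net d j ℤ.< 0ℤ)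
      idle-sound e d p neg = dies-sound (walkOf d p) (null-sound (all-∈ (λ s → null (expand (rows G) ((s , 0ℤ) ∷ []))) e (idx∈ d (on d p 0))))
        (neg 1 (s≤s z≤n) (FO.fibre-nonempty d))

    module _ (ok : ∀ d → allowed (X d) (X (φ d)) ≡ true) (k : ℕ) where

      covered : ∀ e → cap (sz e) ≡ k → Covered (collect (statesAt states k)) (node (X e)) (share (X e))
      covered e p = collect-covers (statesAt states k)
        (filterᵇ-∈ (λ X → hd (lab X) ≡ᵇ k) (X∈states e) (subst (λ c → (c ≡ᵇ k) ≡ true) (sym (trans (hd-lab-X e) p)) (≡ᵇ-refl k)))

      faceOK-sound : ∀ ns → faceOK states (k , ns) ≡ true → ∀ d → cap (sz d) ≡ k → sz d ∈ ns →
                     ¬ (∀ j → 0 ℕ.< j → j ℕ.≤ sz d → walk net d j ℤ.< 0ℤ)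
      faceOK-sound = Face.graph-sound ok k (collect (statesAt states k)) covered

      idleOK-sound : idleOK states k ≡ true → ∀ d → cap (sz d) ≡ k → ¬ (∀ j → 0 ℕ.< j → j ℕ.≤ sz d → walk net d j ℤ.< 0ℤ)
      idleOK-sound = Face.idle-sound ok k (collect (statesAt states k)) covered

      facesOK-sound : ∀ {ps} → FacesOK ps → ∀ {ns} d → (k , ns) ∈ ps → cap (sz d) ≡ k → sz d ∈ ns →
                      ¬ (∀ j → 0 ℕ.< j → j ℕ.≤ sz d → walk net d j ℤ.< 0ℤ)
      facesOK-sound ok′ {ns} d m = faceOK-sound ns (all-∈ (faceOK states) (FacesOK.check ok′) m) d

-- Rounded face sizes and the finite list of vertex types.

-- Half of 720720 = lcm(1,…,16).
half : ℕ
half = 360360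

-- Sizes are rounded up to the next label; 42 stands for every size above 41.
labels : List ℕ
labels = 3 ∷ 4 ∷ 5 ∷ 6 ∷ 7 ∷ 8 ∷ 9 ∷ 10 ∷ 11 ∷ 12 ∷ 13 ∷ 14 ∷ 16 ∷ 17 ∷ 18 ∷ 19 ∷ 23 ∷ 39 ∷ 40 ∷ 41 ∷ 42 ∷ []

firstAbove : List ℕ → ℕ → ℕ
firstAbove []       s = 42
firstAbove (c ∷ cs) s = if s ≤ᵇ c then c else firstAbove cs s

cap : ℕ → ℕ
cap = firstAbove labels

assoc : List (ℕ × ℕ) → ℕ → ℕ
assoc []             c = 0
assoc ((k , v) ∷ kv) c = if k ≡ᵇ c then v else assoc kv c

-- 720720 / s, rounded up, for the smallest size s with the given label.
upper : ℕ → ℕ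
upper = assoc ((3 , 240240) ∷ (4 , 180180) ∷ (5 , 144144) ∷ (6 , 120120) ∷ (7 , 102960) ∷ (8 , 90090) ∷ (9 , 80080) ∷ (10 , 72072) ∷ (11 , 65520) ∷ (12 , 60060) ∷ (13 , 55440) ∷ (14 , 51480) ∷ (16 , 48048) ∷ (17 , 42396) ∷ (18 , 40040) ∷ (19 , 37933) ∷ (23 , 36036) ∷ (39 , 30030) ∷ (40 , 18018) ∷ (41 , 17579) ∷ (42 , 17160) ∷ [])

≤ᵇ-sound : ∀ m n → (m ≤ᵇ n) ≡ true → m ℕ.≤ n
≤ᵇ-sound m n e = ℕₚ.≤ᵇ⇒≤ m n (Equivalence.from T-≡ e)

∈-upTo : ∀ {n i} → i ℕ.< n → i ∈ upTo n
∈-upTo = Anyₚ.applyUpTo⁺ (λ i → i) refl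

cap-42 : ∀ m → cap (42 ℕ.+ m) ≡ 42
cap-42 zero    = refl
cap-42 (suc m) = refl

large : ∀ {s} → 42 ℕ.≤ s → cap s ≡ 42
large {s} 42≤s = subst (λ t → cap t ≡ 42) (ℕₚ.m+[n∸m]≡n 42≤s) (cap-42 (s ℕ.∸ 42))

-- A property of labels and sizes that is checked up to 42 and holds for larger sizes by monotonicity.
small-or-large : ∀ s → s ℕ.< 42 ⊎ 42 ℕ.≤ s
small-or-large s with s ℕₚ.<? 42
... | yes p = inj₁ p
... | no p  = inj₂ (ℕₚ.≮⇒≥ p)

inRange : ℕ → Bool
inRange s = (720720 ≤ᵇ upper (cap s) ℕ.* s) ∧ any (λ c → c ≡ᵇ cap s) labels

smallOK : ℕ → Bool
smallOK s = if 3 ≤ᵇ s then inRange s else true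

smallOK-sound : ∀ s → 3 ℕ.≤ s → s ℕ.< 42 → inRange s ≡ true
smallOK-sound s 3≤s s<42 = if-true (Equivalence.to T-≡ (ℕₚ.≤⇒≤ᵇ 3≤s)) (all-∈ smallOK {upTo 42} refl (∈-upTo s<42))
  where
  if-true : ∀ {b x} → b ≡ true → (if b then x else true) ≡ true → x ≡ true
  if-true refl e = e

any-≡ : ∀ c cs → any (λ x → x ≡ᵇ c) cs ≡ true → c ∈ cs
any-≡ c (x ∷ cs) e with x ≡ᵇ c in eq
... | true  = here (sym (≡ᵇ-sound x c eq))
... | false = there (any-≡ c cs e)

scale : ∀ {m n s} u → m ℕ.≤ u ℕ.* n → n ℕ.≤ s → m ℕ.≤ u ℕ.* s
scale u q n≤s = ℕₚ.≤-trans q (ℕₚ.*-monoʳ-≤ u n≤s)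

upper-cap : ∀ s → 3 ℕ.≤ s → 720720 ℕ.≤ upper (cap s) ℕ.* s
upper-cap s 3≤s with small-or-large s
... | inj₁ s<42 = ≤ᵇ-sound 720720 (upper (cap s) ℕ.* s) (proj₁ (∧-true (smallOK-sound s 3≤s s<42)))
... | inj₂ 42≤s = subst (λ c → 720720 ℕ.≤ upper c ℕ.* s) (sym (large 42≤s)) (scale (upper 42) (≤ᵇ-sound 720720 (upper 42 ℕ.* 42) refl) 42≤s)

cap∈labels : ∀ s → 3 ℕ.≤ s → cap s ∈ labels
cap∈labels s 3≤s with small-or-large s
... | inj₁ s<42 = any-≡ (cap s) labels (proj₂ (∧-true {720720 ≤ᵇ upper (cap s) ℕ.* s} (smallOK-sound s 3≤s s<42)))
... | inj₂ 42≤s = subst (_∈ labels) (sym (large 42≤s)) (any-≡ 42 labels refl)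

cap<64 : ∀ s → cap s ℕ.< 64
cap<64 s = go labels refl s
  where
  go : ∀ cs → all (_<ᵇ 64) cs ≡ true → ∀ s → firstAbove cs s ℕ.< 64
  go []       _ s = ℕₚ.≤ᵇ⇒≤ 43 64 _
  go (c ∷ cs) e s with s ≤ᵇ c
  ... | true  = ℕₚ.<ᵇ⇒< c 64 (Equivalence.from T-≡ (proj₁ (∧-true e)))
  ... | false = go cs (proj₂ (∧-true {c <ᵇ 64} e)) s

cap≡42 : ∀ s → cap s ≡ 42 → 42 ℕ.≤ s
cap≡42 s e with small-or-large s
... | inj₂ 42≤s = 42≤s
... | inj₁ s<42 = ⊥-elim (true≢false (all-∈ (λ t → not (cap t ≡ᵇ 42)) {upTo 42} refl (∈-upTo s<42)) (cong (λ c → not (c ≡ᵇ 42)) e))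

-- What a corner takes from the initial 720720. Positive curvature forces a total cost below 720720,
-- even with the rounding in `upper`.
cost : ℕ → ℕ
cost c = half ℕ.∸ upper c

generate : ℕ → ℕ → List (List ℕ)
generate zero    B = [] ∷ []
generate (suc n) B = [] ∷ concatMap (λ c → if cost c <ᵇ B then map (c ∷_) (generate n (B ℕ.∸ cost c)) else []) labels

-- The possible capped face sizes around a vertex of positive curvature and degree at least 3.
corners : ℕ → List (List ℕ)
corners B = filterᵇ (λ A → 3 ≤ᵇ length A) (generate 5 B)

total : List ℕ → ℕ
total []      = 0
total (c ∷ A) = cost c ℕ.+ total A

generate-complete : ∀ n B A → All (_∈ labels) A → length A ℕ.≤ n → total A ℕ.< B → A ∈ generate n B
generate-complete zero    B []      _        _         _ = here refl
generate-complete (suc n) B []      _        _         _ = here refl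
generate-complete (suc n) B (c ∷ A) (p ∷ ps) (s≤s l≤n) t<B = there (∈-concatMap⁺ (λ c → if cost c <ᵇ B then map (c ∷_) (generate n (B ℕ.∸ cost c)) else []) (lose p step))
  where
  c<B : cost c ℕ.< B
  c<B = ℕₚ.≤-<-trans (ℕₚ.m≤m+n (cost c) (total A)) t<B
  step : (c ∷ A) ∈ (if cost c <ᵇ B then map (c ∷_) (generate n (B ℕ.∸ cost c)) else [])
  step = subst (λ b → (c ∷ A) ∈ (if b then map (c ∷_) (generate n (B ℕ.∸ cost c)) else [])) (sym (Equivalence.to T-≡ (ℕₚ.<⇒<ᵇ c<B)))
    (∈-map⁺ (c ∷_) (generate-complete n (B ℕ.∸ cost c) A ps l≤n
      (ℕₚ.+-cancelˡ-< (cost c) (total A) (B ℕ.∸ cost c) (subst (cost c ℕ.+ total A ℕ.<_) (sym (ℕₚ.m+[n∸m]≡n (ℕₚ.<⇒≤ c<B))) t<B))))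

length-bound : ∀ k A → All (λ c → k ℕ.≤ cost c) A → length A ℕ.* k ℕ.≤ total A
length-bound k []      []       = z≤n
length-bound k (c ∷ A) (p ∷ ps) = ℕₚ.+-mono-≤ p (length-bound k A ps)

charge-total : ∀ A → All (_∈ labels) A → ∑ₗ (λ c → + upper c ℤ.- + half) A ≡ ℤ.- + total A
charge-total []      []       = refl
charge-total (c ∷ A) (p ∷ ps) = trans (cong₂ ℤ._+_ one (charge-total A ps))
    (trans (sym (ℤₚ.neg-distrib-+ (+ cost c) (+ total A))) (cong ℤ.-_ (sym (ℤₚ.pos-+ (cost c) (total A)))))
  where
  u≤h : upper c ℕ.≤ half
  u≤h = ≤ᵇ-sound (upper c) half (all-∈ (λ c → upper c ≤ᵇ half) {labels} refl p)
  one : + upper c ℤ.- + half ≡ ℤ.- + cost c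
  one = trans (ℤₚ.m-n≡m⊖n (upper c) half) (ℤₚ.⊖-≤ u≤h)

-- With at least `k` per corner, a total below `6 k` allows at most five corners, hence the depth 5
-- in `corners`.
corners-complete′ : ∀ B k A → .{{_ : ℕ.NonZero k}} → All (_∈ labels) A → All (λ c → k ℕ.≤ cost c) A → 3 ℕ.≤ length A →
                    total A ℕ.< B → B ℕ.≤ 6 ℕ.* k → A ∈ corners B
corners-complete′ B k A ps qs 3≤ t< B≤ = filterᵇ-∈ (λ A → 3 ≤ᵇ length A)
    (generate-complete 5 B A ps (ℕₚ.≤-pred (ℕₚ.*-cancelʳ-< k (length A) 6 (ℕₚ.≤-<-trans (length-bound k A qs) (ℕₚ.<-≤-trans t< B≤)))) t<)
    (Equivalence.to T-≡ (ℕₚ.≤⇒≤ᵇ 3≤))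

total-bound : ∀ B A → 0ℤ ℤ.< + B ℤ.+ ∑ₗ (λ c → + upper c ℤ.- + half) A → All (_∈ labels) A → total A ℕ.< B
total-bound B A pos ps = ℤₚ.drop‿+<+ (subst₂ ℤ._<_ (ℤₚ.+-identityˡ (+ total A)) cancel
         (ℤₚ.+-monoˡ-< (+ total A) (subst (0ℤ ℤ.<_) (cong (ℤ._+_ (+ B)) (charge-total A ps)) pos)))
  where
  cancel : + B ℤ.+ (ℤ.- + total A) ℤ.+ + total A ≡ + B
  cancel = trans (ℤₚ.+-assoc (+ B) (ℤ.- + total A) (+ total A)) (trans (cong (ℤ._+_ (+ B)) (ℤₚ.+-inverseˡ (+ total A))) (ℤₚ.+-identityʳ (+ B)))

corners-complete : ∀ A → All (_∈ labels) A → 3 ℕ.≤ length A → 0ℤ ℤ.< charge half (λ c → + upper c) A → A ∈ corners 720720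
corners-complete A ps 3≤ pos = corners-complete′ 720720 120120 A ps
  (All.map (λ {c} p → ≤ᵇ-sound 120120 (cost c) (all-∈ (λ c → 120120 ≤ᵇ cost c) {labels} refl p)) ps)
  3≤ (total-bound 720720 A pos ps) ℕₚ.≤-refl

-- Positively curved maps: types of corners, and Gauss-Bonnet with face deficits.

∑ₗ-map′ : ∀ {B C : Set} (g : C → ℤ) (f : B → C) xs → ∑ₗ g (map f xs) ≡ ∑ₗ (g ∘ f) xs
∑ₗ-map′ g f []       = refl
∑ₗ-map′ g f (x ∷ xs) = cong (ℤ._+_ (g (f x))) (∑ₗ-map′ g f xs)

+-cancelʳ-≤ : ∀ k {a b} → a ℤ.+ k ℤ.≤ b ℤ.+ k → a ℤ.≤ b
+-cancelʳ-≤ k {a} {b} q = subst₂ ℤ._≤_ (undo a) (undo b) (ℤₚ.+-monoˡ-≤ (ℤ.- k) q)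
  where
  undo : ∀ x → x ℤ.+ k ℤ.+ ℤ.- k ≡ x
  undo x = trans (ℤₚ.+-assoc x k (ℤ.- k)) (trans (cong (ℤ._+_ x) (ℤₚ.+-inverseʳ k)) (ℤₚ.+-identityʳ x))

-- A record, so that the type is not unfolded into rational arithmetic.
record PositivelyCurved (M : Map) : Set where
  field curved : ∀ v → 0ℚ <ℚ curvature M v

module Positive (M : Map) (simple : Simple M) (spherical : Spherical M)
  (positive : PositivelyCurved M) (deg≥3 : ∀ v → 3 ℕ.≤ Maps.deg′ M v) where

  open Maps M public
  open Discharging M public

  -- A face of size one is a loop. In a face of size two both edges have the same ends, so
  -- simplicity gives `φ d ≡ αf d`; then `σf` fixes `αf d`, whose vertex has degree one.
  sz≥3 : ∀ d → 3 ℕ.≤ sz d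
  sz≥3 d = go (sz d) refl
    where
    closed : ∀ n → sz d ≡ n → iter φ n d ≡ d
    closed n e = subst (λ k → iter φ k d ≡ d) e (FO.fibre-period d)
    go : ∀ n → sz d ≡ n → 3 ℕ.≤ sz d
    go 0 e = ⊥-elim (ℕₚ.<-irrefl (sym e) (FO.fibre-nonempty d))
    go 1 e = ⊥-elim (proj₁ simple d (trans (sym (vert-φ d)) (cong vert (closed 1 e))))
    go 2 e = ⊥-elim (VO.fibre-distinct (αf d) 1 (s≤s z≤n) (ℕₚ.≤-trans (s≤s (s≤s z≤n)) (deg≥3 (vert (αf d))))
      (proj₂ simple (φ d) (αf d) (vert-φ d) (trans (trans (sym (vert-φ (φ d))) (cong vert (closed 2 e))) (cong vert (sym (α-invol d))))))
    go (suc (suc (suc n))) e = subst (3 ℕ.≤_) (sym e) (s≤s (s≤s (s≤s z≤n)))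

  all-faceVec : ∀ {P : ℕ → Set} → (∀ d → P (sz d)) → ∀ v → All P (faceVec v)
  all-faceVec h v = Allₚ.map⁺ (All.universal (λ d → h d) (dartsAt v))

  complete : ∀ d → map cap (corner d) ∈ corners 720720
  complete d = corners-complete (map cap (corner d))
    (Allₚ.map⁺ (All-resp-↭ (↭-sym (corner↭ d)) (all-faceVec {λ s → cap s ∈ labels} (λ e → cap∈labels (sz e) (sz≥3 e)) (vert d))))
    (subst (3 ℕ.≤_) (sym (trans (Listₚ.length-map cap (corner d)) (Listₚ.length-applyUpTo (λ i → sz (iter σf i d)) (dg d)))) (deg≥3 (vert d)))
    (subst (0ℤ ℤ.<_) (trans (vcharge-corner half (λ s → + upper (cap s)) d) (sym (cong (ℤ._+_ (+ 720720)) (∑ₗ-map′ (λ c → + upper c ℤ.- + half) cap (corner d)))))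
      (charge-pos 360359 (λ s → upper (cap s)) (vert d) (PositivelyCurved.curved positive (vert d)) (all-faceVec {λ s → 720720 ℕ.≤ upper (cap s) ℕ.* s} (λ e → upper-cap (sz e) (sz≥3 e)) (vert d))))

  charge-cap : ∀ (u : ℕ → ℤ) d → vcharge half (u ∘ cap) (vert d) ≡ charge half u (map cap (corner d))
  charge-cap u d = trans (vcharge-corner half (u ∘ cap) d) (sym (cong (ℤ._+_ (+ 720720)) (∑ₗ-map′ (λ c → u c ℤ.- + half) cap (corner d))))

  -- Gauss–Bonnet as an inequality: the deficits w of the faces are lost from the total 2 · 720720.
  total-≤ : ∀ (u : ℕ → ℤ) (w : Fin F → ℤ) → (∀ f → + size′ f ℤ.* u (size′ f) ℤ.≤ + 720720 ℤ.- w f) →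
            sum (vcharge half u) ℤ.≤ + 1441440 ℤ.- sum w
  total-≤ u w = total-≤′ (+ 720720) (+ 1441440) u w (∑-vcharge half u spherical)
    where
    ∑-split : ∀ {n} (N : ℤ) (w : Fin n → ℤ) → sum (λ f → N ℤ.- w f) ≡ + n ℤ.* N ℤ.- sum w
    ∑-split {zero}  N w = cong (ℤ._- 0ℤ) (sym (ℤₚ.*-zeroˡ N))
    ∑-split {suc n} N w = trans (cong (ℤ._+_ (N ℤ.- w zero)) (∑-split N (w ∘ suc)))
      (trans (solve 4 (λ N a k s → (N :- a) :+ (k :- s) := (N :+ k) :- (a :+ s)) refl N (w zero) (+ n ℤ.* N) (sum (w ∘ suc)))
             (cong (ℤ._- (w zero ℤ.+ sum (w ∘ suc))) (sym (ℤₚ.suc-* (+ n) N))))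
      where open import Data.Integer.Solver using (module +-*-Solver)
            open +-*-Solver
    total-≤′ : ∀ (N T : ℤ) (u : ℕ → ℤ) (w : Fin F → ℤ) →
      sum (vcharge half u) ℤ.+ (+ F ℤ.* N) ≡ T ℤ.+ sum (λ f → + size′ f ℤ.* u (size′ f)) →
      (∀ f → + size′ f ℤ.* u (size′ f) ℤ.≤ N ℤ.- w f) → sum (vcharge half u) ℤ.≤ T ℤ.- sum w
    total-≤′ N T u w eq h = +-cancelʳ-≤ (+ F ℤ.* N) (subst₂ ℤ._≤_ (sym eq) rearr
        (ℤₚ.+-monoʳ-≤ T (subst (sum (λ f → + size′ f ℤ.* u (size′ f)) ℤ.≤_) (∑-split N w) (sum-mono h))))
      where
      rearr : T ℤ.+ (+ F ℤ.* N ℤ.- sum w) ≡ (T ℤ.- sum w) ℤ.+ + F ℤ.* N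
      rearr = solve 3 (λ a b s → a :+ (b :- s) := (a :- s) :+ b) refl T (+ F ℤ.* N) (sum w)
        where open import Data.Integer.Solver using (module +-*-Solver)
              open +-*-Solver

  total-≡ : ∀ (u : ℕ → ℤ) (w : Fin F → ℤ) → (∀ f → + size′ f ℤ.* u (size′ f) ≡ + 720720 ℤ.- w f) →
            sum (vcharge half u) ≡ + 1441440 ℤ.- sum w
  total-≡ u w h = ℤₚ.≤-antisym (total-≤ u w (λ f → ℤₚ.≤-reflexive (h f)))
    (go (+ 720720) (+ 1441440) (∑-vcharge half u spherical) h)
    where
    open import Data.Integer.Solver using (module +-*-Solver)
    open +-*-Solver
    ∑-const-sum : ∀ {n} (N : ℤ) (w g : Fin n → ℤ) → (∀ f → g f ≡ N ℤ.- w f) → sum g ≡ + n ℤ.* N ℤ.- sum w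
    ∑-const-sum {zero}  N w g e = cong (ℤ._- 0ℤ) (sym (ℤₚ.*-zeroˡ N))
    ∑-const-sum {suc n} N w g e = trans (cong₂ ℤ._+_ (e zero) (∑-const-sum N (w ∘ suc) (g ∘ suc) (e ∘ suc)))
      (trans (solve 4 (λ N a k s → (N :- a) :+ (k :- s) := (N :+ k) :- (a :+ s)) refl N (w zero) (+ n ℤ.* N) (sum (w ∘ suc)))
             (cong (ℤ._- (w zero ℤ.+ sum (w ∘ suc))) (sym (ℤₚ.suc-* (+ n) N))))
    go : ∀ N T → sum (vcharge half u) ℤ.+ (+ F ℤ.* N) ≡ T ℤ.+ sum (λ f → + size′ f ℤ.* u (size′ f)) →
         (∀ f → + size′ f ℤ.* u (size′ f) ≡ N ℤ.- w f) → T ℤ.- sum w ℤ.≤ sum (vcharge half u)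
    go N T eq h = +-cancelʳ-≤ (+ F ℤ.* N) (ℤₚ.≤-reflexive (trans
      (solve 3 (λ a b s → (a :- s) :+ b := a :+ (b :- s)) refl T (+ F ℤ.* N) (sum w))
      (trans (cong (ℤ._+_ T) (sym (∑-const-sum N w _ h))) (sym eq))))

-- The discharging scheme for a single face of size at least 86.

second last : List ℕ → ℕ
second A = hd (rot A)
last A = hd (rotʳ A)

eqList-sound : ∀ xs ys → eqList xs ys ≡ true → xs ≡ ys
eqList-sound []       []       _ = refl
eqList-sound (x ∷ xs) (y ∷ ys) e = cong₂ _∷_ (≡ᵇ-sound x y (proj₁ (∧-true e))) (eqList-sound xs ys (proj₂ (∧-true {x ≡ᵇ y} e)))

-- 720720 / s, rounded down, for the largest size s with the given label.
lower : ℕ → ℕ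
lower = assoc ((3 , 240240) ∷ (4 , 180180) ∷ (5 , 144144) ∷ (6 , 120120) ∷ (7 , 102960) ∷ (8 , 90090) ∷ (9 , 80080) ∷ (10 , 72072) ∷ (11 , 65520) ∷ (12 , 60060) ∷ (13 , 55440) ∷ (14 , 51480) ∷ (16 , 45045) ∷ (17 , 42395) ∷ (18 , 40040) ∷ (19 , 37932) ∷ (23 , 31335) ∷ (39 , 18480) ∷ (40 , 18018) ∷ (41 , 17578) ∷ [])

lower-cap : ∀ s → s ℕ.< 42 → s ℕ.* lower (cap s) ℕ.≤ 720720
lower-cap s s<42 = ≤ᵇ-sound (s ℕ.* lower (cap s)) 720720 (all-∈ (λ s → s ℕ.* lower (cap s) ≤ᵇ 720720) {upTo 42} refl (∈-upTo s<42))

withLarge : ℤ → ℕ → ℤ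
withLarge z c = if c ≡ᵇ 42 then z else + lower c

known′ : List ℕ → Bool
known′ = any (_≡ᵇ 42)

isSmall : ℕ → Bool
isSmall c = (c ≡ᵇ 3) ∨ (c ≡ᵇ 4)

count : List ℕ → ℕ
count []      = 0
count (c ∷ A) = if isSmall c then suc (count A) else count A

-- A vertex on a large face owes it 8400 and divides the rest evenly among its triangles and squares.
surplus : List ℕ → ℤ
surplus = charge half (withLarge -[1+ 8399 ])

-- The table is `60 / count`; 60 is divisible by every count from 1 to 5, so the shares are
-- integers.
share′ : State → ℤ
share′ X = if isSmall (hd X) then + assoc ((1 , 60) ∷ (2 , 30) ∷ (3 , 20) ∷ (4 , 15) ∷ (5 , 12) ∷ []) (count X) ℤ.* surplus X else 0ℤ

-- The configurations that an even division cannot pay for: a square with opposite sides on large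
-- faces; the middle triangle at a (3,3,3,42) vertex with its opposite side on a large face; and
-- such a triangle that is the middle one for two adjacent vertices.
noLadder : State → State → Bool
noLadder A B = not (eqList A (4 ∷ 4 ∷ 42 ∷ []) ∧ eqList B (4 ∷ 42 ∷ 4 ∷ []))
             ∧ not (eqList A (3 ∷ 3 ∷ 42 ∷ 3 ∷ []) ∧ ((second B ≡ᵇ 42) ∨ eqList B (3 ∷ 3 ∷ 42 ∷ 3 ∷ [])))

module Ladder = Scheme labels (corners 720720) known′ [] share′ (λ _ _ → 0ℤ) (λ X Y → noLadder (lab X) (lab Y))

ladder-vertexOK : Ladder.VertexOK (λ A → + 60 ℤ.* surplus A)
ladder-vertexOK = record { check = refl }

ladder-faceOK₃ : Ladder.faceOK Ladder.states (3 , 3 ∷ []) ≡ true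
ladder-faceOK₃ = refl

ladder-faceOK₄ : Ladder.faceOK Ladder.states (4 , 4 ∷ []) ≡ true
ladder-faceOK₄ = refl

idleLabels : List ℕ
idleLabels = 5 ∷ 6 ∷ 7 ∷ 8 ∷ 9 ∷ 10 ∷ 11 ∷ 12 ∷ 13 ∷ 14 ∷ 16 ∷ 17 ∷ 18 ∷ 19 ∷ 23 ∷ 39 ∷ 40 ∷ 41 ∷ 42 ∷ []

-- Only triangles and squares receive shares, so along every other face all steps weigh zero and
-- none is negative.
ladder-idleOK : all (Ladder.idleOK Ladder.states) idleLabels ≡ true
ladder-idleOK = refl

any-snoc : ∀ (p : ℕ → Bool) x xs → any p (xs ∷ʳ x) ≡ any p (x ∷ xs)
any-snoc p x []       = refl
any-snoc p x (y ∷ ys) rewrite any-snoc p x ys with p x | p y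
... | true  | true  = refl
... | true  | false = refl
... | false | true  = refl
... | false | false = refl

known′-rot : ∀ A → known′ (rot A) ≡ known′ A
known′-rot []      = refl
known′-rot (x ∷ A) = any-snoc (_≡ᵇ 42) x A

implies-list : (List ℕ → Bool) → List (List ℕ) → List ℕ → Bool
implies-list q R A = not (q A) ∨ any (eqList A) R

eqList-∈ : ∀ B R → any (eqList B) R ≡ true → B ∈ R
eqList-∈ B (C ∷ R) r with eqList B C in eq
... | true  = here (eqList-sound B C eq)
... | false = there (eqList-∈ B R r)

implies-sound : ∀ q R B → implies-list q R B ≡ true → q B ≡ true → B ∈ R
implies-sound q R B r e = eqList-∈ B R (subst (λ b → not b ∨ any (eqList B) R ≡ true) e r)

only : ∀ {B C : List ℕ} → B ∈ (C ∷ []) → B ≡ C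
only (here e) = e

either : ∀ {B C D : List ℕ} → B ∈ (C ∷ D ∷ []) → ¬ (B ≡ D) → B ≡ C
either (here e)         _ = e
either (there (here e)) n = ⊥-elim (n e)

is : ℕ → ℕ → ℕ → List ℕ → Bool
is h s l A = (hd A ≡ᵇ h) ∧ ((second A ≡ᵇ s) ∧ (last A ≡ᵇ l))

exactly : ∀ c → c ∈ (3 ∷ 4 ∷ []) → ∀ s → 3 ℕ.≤ s → cap s ≡ c → s ≡ c
exactly c c∈ s 3≤s e with small-or-large s
... | inj₂ 42≤s = ⊥-elim (absurd c c∈ (trans (sym (large 42≤s)) e))
  where
  absurd : ∀ c → c ∈ (3 ∷ 4 ∷ []) → ¬ (42 ≡ c)
  absurd .3 (here refl) ()
  absurd .4 (there (here refl)) ()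
... | inj₁ s<42 = ℕₚ.≤-antisym (subst (s ℕ.≤_) e (below s s<42)) (bound c c∈ e)
  where
  below : ∀ s → s ℕ.< 42 → s ℕ.≤ cap s
  below s s<42 = ≤ᵇ-sound s (cap s) (all-∈ (λ s → s ≤ᵇ cap s) {upTo 42} refl (∈-upTo s<42))
  bound : ∀ c → c ∈ (3 ∷ 4 ∷ []) → cap s ≡ c → c ℕ.≤ s
  bound .3 (here refl) e = 3≤s
  bound .4 (there (here refl)) e with s ℕₚ.≟ 3
  ... | yes refl with () ← e
  ... | no s≢3 = ℕₚ.≤∧≢⇒< 3≤s (s≢3 ∘ sym)

-- Local geometry at a large face: ladders of squares and of triangles.

module Large (M : Map) (simple : Simple M) (spherical : Spherical M)
  (positive : PositivelyCurved M) (deg≥3 : ∀ v → 3 ℕ.≤ Maps.deg′ M v) where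

  open Positive M simple spherical positive deg≥3 public
  open Ladder.Apply M cap cap<64 known′-rot complete public using (A; A≡; around-σ; around-hd; X; lab-X; give″; net; discharge-net; vertexOK-sound; faceOK-sound; idleOK-sound)

  A-∈ : ∀ d → A d ∈ corners 720720
  A-∈ d = subst (_∈ corners 720720) (sym (A≡ d)) (complete d)

  A-σ : ∀ d → A (σf d) ≡ rot (A d)
  A-σ = around-σ (cap ∘ sz)

  A-hd : ∀ d → hd (A d) ≡ cap (sz d)
  A-hd = around-hd (cap ∘ sz)

  A-next : ∀ {d e R} → σf d ≡ e → A d ≡ R → A e ≡ rot R
  A-next {d} refl refl = A-σ d

  A-prev : ∀ {d e R} → σf d ≡ e → A e ≡ R → A d ≡ rotʳ R
  A-prev {d} refl q = trans (sym (rotʳ-rot (A d))) (cong rotʳ (trans (sym (A-σ d)) q))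

  A-second : ∀ d → second (A d) ≡ cap (sz (αf d))
  A-second d = trans (cong hd (sym (A-σ d))) (trans (A-hd (σf d)) (cong (cap ∘ size) (sym (face-α d))))

  A-last : ∀ d → last (A (φ d)) ≡ cap (sz (αf d))
  A-last d = trans (cong hd (sym (A-prev refl refl))) (A-hd (αf d))

  link : ∀ d → last (A (φ d)) ≡ second (A d)
  link d = trans (A-last d) (sym (A-second d))

  same : ∀ d → hd (A (φ d)) ≡ hd (A d)
  same d = trans (A-hd (φ d)) (trans (cong (cap ∘ size) (face-φ d)) (sym (A-hd d)))

  period : ∀ d → iter σf (length (A d)) d ≡ d
  period d = trans (cong (λ n → iter σf n d) (Listₚ.length-applyUpTo (λ i → cap (sz (iter σf i d))) (dg d))) (VO.fibre-period d)

  σ³ : ∀ {d a b c} → A d ≡ a ∷ b ∷ c ∷ [] → σf (σf (σf d)) ≡ d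
  σ³ {d} e = subst (λ R → iter σf (length R) d ≡ d) e (period d)

  σ⁴ : ∀ {d a b c k} → A d ≡ a ∷ b ∷ c ∷ k ∷ [] → σf (σf (σf (σf d))) ≡ d
  σ⁴ {d} e = subst (λ R → iter σf (length R) d ≡ d) e (period d)

  triangle : ∀ {d} → hd (A d) ≡ 3 → φ (φ (φ d)) ≡ d
  triangle {d} e = subst (λ n → iter φ n d ≡ d) (exactly 3 (here refl) (sz d) (sz≥3 d) (trans (sym (A-hd d)) e)) (FO.fibre-period d)

  square : ∀ {d} → hd (A d) ≡ 4 → φ (φ (φ (φ d))) ≡ d
  square {d} e = subst (λ n → iter φ n d ≡ d) (exactly 4 (there (here refl)) (sz d) (sz≥3 d) (trans (sym (A-hd d)) e)) (FO.fibre-period d)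

  classify : ∀ q R → all (implies-list q R) (corners 720720) ≡ true → ∀ d → q (A d) ≡ true → A d ∈ R
  classify q R ok d = implies-sound q R (A d) (all-∈ (implies-list q R) {corners 720720} ok (A-∈ d))

  is-true : ∀ {d a b c} → hd (A d) ≡ a → second (A d) ≡ b → last (A d) ≡ c → is a b c (A d) ≡ true
  is-true {d} refl refl refl rewrite ≡ᵇ-refl (hd (A d)) | ≡ᵇ-refl (second (A d)) | ≡ᵇ-refl (last (A d)) = refl

  -- `second` and `last` are two different corners of one vertex, and positive curvature leaves room
  -- for only one large face.
  no-double : ∀ d → second (A d) ≡ 42 → last (A d) ≡ 42 → ⊥
  no-double d s l = empty (classify (λ A → (second A ≡ᵇ 42) ∧ (last A ≡ᵇ 42)) [] refl d (subst₂ (λ a b → ((a ≡ᵇ 42) ∧ (b ≡ᵇ 42)) ≡ true) (sym s) (sym l) refl))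
    where
    empty : ∀ {B : List ℕ} → ¬ (B ∈ [])
    empty ()

  -- Two sides of a triangle lie on large faces, so the vertex where they meet would lie on two of
  -- them.
  bad-triangle : ∀ e → hd (A e) ≡ 3 → last (A e) ≡ 42 → second (A (φ e)) ≡ 42 → ⊥
  bad-triangle e h l s = no-double (φ (φ e))
    (trans (sym (link (φ (φ e)))) (trans (cong (last ∘ A) (triangle h)) l))
    (trans (link (φ e)) s)

  -- x lies on a large face and the square across it leads to another vertex on a large face.
  Ladder₄ : Fin darts → Set
  Ladder₄ x = A x ≡ 42 ∷ 4 ∷ 4 ∷ [] × A (φ (σf x)) ≡ 4 ∷ 42 ∷ 4 ∷ []

  -- The triangular analogue: the side opposite to the vertex of `x` in its middle triangle lies on
  -- a large face.
  Ladder₃ : Fin darts → Set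
  Ladder₃ x = A x ≡ 42 ∷ 3 ∷ 3 ∷ 3 ∷ [] × second (A (φ (σf (σf x)))) ≡ 42

  from-φ : ∀ {x m} → φ m ≡ σf x → m ≡ αf x
  from-φ {x} e = φ-injective (trans e (sym (φα x)))

  -- Large faces along two opposite sides determine the types at all four corners of the square, and
  -- then the square that follows along the large face of `x` has the same form.
  module Square {x} (Ax : A x ≡ 42 ∷ 4 ∷ 4 ∷ []) (Aq₁ : A (φ (σf x)) ≡ 4 ∷ 42 ∷ 4 ∷ []) where
    m q₁ q₂ q₃ : Fin darts
    m = σf x
    q₁ = φ m
    q₂ = φ q₁
    q₃ = φ q₂
    Am : A m ≡ 4 ∷ 4 ∷ 42 ∷ []
    Am = A-next refl Ax
    closed : φ q₃ ≡ m
    closed = square (cong hd Am)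
    q₃≡ : q₃ ≡ αf x
    q₃≡ = from-φ closed
    hq₂ : hd (A q₂) ≡ 4
    hq₂ = trans (same q₁) (cong hd Aq₁)
    hq₃ : hd (A q₃) ≡ 4
    hq₃ = trans (same q₂) hq₂
    lq₂ : last (A q₂) ≡ 42
    lq₂ = trans (link q₁) (cong second Aq₁)
    sq₃ : second (A q₃) ≡ 42
    sq₃ = trans (sym (link q₃)) (trans (cong (last ∘ A) closed) (cong last Am))
    Aq₂∈ : A q₂ ∈ ((4 ∷ 4 ∷ 42 ∷ []) ∷ (4 ∷ 3 ∷ 42 ∷ []) ∷ [])
    Aq₂∈ = classify (λ A → (hd A ≡ᵇ 4) ∧ (last A ≡ᵇ 42)) _ refl q₂ (subst₂ (λ a b → ((a ≡ᵇ 4) ∧ (b ≡ᵇ 42)) ≡ true) (sym hq₂) (sym lq₂) refl)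
    Aq₃∈ : ∀ p → second (A q₂) ≡ p → is 4 42 p (A q₃) ≡ true
    Aq₃∈ p e = is-true {q₃} hq₃ sq₃ (trans (link q₂) e)
    φx≡ : φ x ≡ σf q₃
    φx≡ = cong σf (sym q₃≡)

    Aq₂ : A q₂ ≡ 4 ∷ 4 ∷ 42 ∷ []
    -- A 3 in place of the second 4 makes `q₃` of type (4,42,3); the triangle across the edge `q₂`
    -- then has two sides on large faces.
    Aq₂ = either Aq₂∈ λ e → let Ay = A-prev {αf q₂} refl (only (classify (is 4 42 3) ((4 ∷ 42 ∷ 3 ∷ []) ∷ []) refl q₃ (Aq₃∈ 3 (cong second e)))) in
      bad-triangle (αf q₂) (cong hd Ay) (cong last Ay) (cong second (A-next (sym (φα q₂)) e))

    Aq₃ : A q₃ ≡ 4 ∷ 42 ∷ 4 ∷ []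
    Aq₃ = only (classify (is 4 42 4) ((4 ∷ 42 ∷ 4 ∷ []) ∷ []) refl q₃ (Aq₃∈ 4 (cong second Aq₂)))

    Aφx : A (φ x) ≡ 42 ∷ 4 ∷ 4 ∷ []
    Aφx = A-next (sym φx≡) Aq₃

    σφx≡ : σf (φ x) ≡ αf q₂
    σφx≡ = σf-injective (trans (trans (cong (σf ∘ σf) φx≡) (σ³ Aq₃)) refl)

    φσφx≡ : φ (σf (φ x)) ≡ σf q₂
    φσφx≡ = trans (cong φ σφx≡) (φα q₂)

    next : Ladder₄ (φ x)
    next = Aφx , trans (cong A φσφx≡) (A-next refl Aq₂)

    -- The large faces across the square at x and at φ x agree.
    opposite : φ (σf (φ (σf (φ x)))) ≡ σf (φ (σf x))
    opposite = trans (cong (φ ∘ σf) φσφx≡) (trans (cong φ (σf-injective (σ³ Aq₂))) (φα q₁))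

  -- The triangles `d`, `d₁`, `d₂` and `σf x`, `e₁`, `e₂` are consecutive in the strip and share the
  -- edge of `σf x`. The only competing types have degree three, and each of them creates a triangle
  -- excluded by `bad-triangle`.
  module Strip {x} (Ax : A x ≡ 42 ∷ 3 ∷ 3 ∷ 3 ∷ []) (s₁ : second (A (φ (σf (σf x)))) ≡ 42) where
    d d₁ d₂ e₁ e₂ z : Fin darts
    d = σf (σf x)
    d₁ = φ d
    d₂ = φ d₁
    e₁ = φ (σf x)
    e₂ = φ e₁
    z = αf e₁
    Aσx : A (σf x) ≡ 3 ∷ 3 ∷ 3 ∷ 42 ∷ []
    Aσx = A-next refl Ax
    Ad : A d ≡ 3 ∷ 3 ∷ 42 ∷ 3 ∷ []
    Ad = A-next refl Aσx
    closed : φ d₂ ≡ d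
    closed = triangle (cong hd Ad)
    d₂≡ : d₂ ≡ αf (σf x)
    d₂≡ = from-φ closed
    e₁≡ : e₁ ≡ σf d₂
    e₁≡ = cong σf (sym d₂≡)
    closed′ : φ e₂ ≡ σf x
    closed′ = triangle (cong hd Aσx)
    e₂≡ : e₂ ≡ αf x
    e₂≡ = from-φ closed′
    φx≡ : φ x ≡ σf e₂
    φx≡ = cong σf (sym e₂≡)
    σz : σf z ≡ e₂
    σz = refl
    φz : φ z ≡ σf e₁
    φz = φα e₁

    Ad₁ : A d₁ ≡ 3 ∷ 42 ∷ 3 ∷ 3 ∷ []
    Ad₁ = either (classify (is 3 42 3) ((3 ∷ 42 ∷ 3 ∷ 3 ∷ []) ∷ (3 ∷ 42 ∷ 3 ∷ []) ∷ []) refl d₁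
               (is-true {d₁} (trans (same d) (cong hd Ad)) s₁ (trans (link d) (cong second Ad))))
      λ e → let At = A-prev {αf d} refl e in
        bad-triangle (αf d) (cong hd At) (cong last At) (trans (cong (second ∘ A) (φα d)) (cong second (A-next refl Ad)))

    Ad₂ : A d₂ ≡ 3 ∷ 3 ∷ 3 ∷ 42 ∷ []
    Ad₂ = either (classify (is 3 3 42) ((3 ∷ 3 ∷ 3 ∷ 42 ∷ []) ∷ (3 ∷ 3 ∷ 42 ∷ []) ∷ []) refl d₂
               (is-true {d₂} (trans (same d₁) (trans (same d) (cong hd Ad))) (trans (sym (link d₂)) (trans (cong (last ∘ A) closed) (cong last Ad))) (trans (link d₁) s₁)))
      λ e → bad-triangle (σf x) (cong hd Aσx) (cong last Aσx) (cong second (A-next (sym e₁≡) e))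

    Ae₁ : A e₁ ≡ 3 ∷ 3 ∷ 42 ∷ 3 ∷ []
    Ae₁ = A-next (sym e₁≡) Ad₂

    Aσe₁ : A (σf e₁) ≡ 3 ∷ 42 ∷ 3 ∷ 3 ∷ []
    Aσe₁ = A-next refl Ae₁

    Ae₂ : A e₂ ≡ 3 ∷ 42 ∷ 3 ∷ 3 ∷ []
    Ae₂ = either (classify (is 3 42 3) ((3 ∷ 42 ∷ 3 ∷ 3 ∷ []) ∷ (3 ∷ 42 ∷ 3 ∷ []) ∷ []) refl e₂
               (is-true {e₂} (trans (same e₁) (cong hd Ae₁)) (trans (sym (link e₂)) (trans (cong (last ∘ A) closed′) (cong last Aσx))) (trans (link e₁) (cong second Ae₁))))
      λ e → let Az = A-prev {z} refl e in bad-triangle z (cong hd Az) (cong last Az) (trans (cong (second ∘ A) φz) (cong second Aσe₁))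

    Aφx : A (φ x) ≡ 42 ∷ 3 ∷ 3 ∷ 3 ∷ []
    Aφx = A-next (sym φx≡) Ae₂

    σσφx≡ : σf (σf (φ x)) ≡ z
    σσφx≡ = σf-injective (trans (cong (σf ∘ σf ∘ σf) φx≡) (σ⁴ Ae₂))

    φσσφx≡ : φ (σf (σf (φ x))) ≡ σf e₁
    φσσφx≡ = trans (cong φ σσφx≡) φz

    next : Ladder₃ (φ x)
    next = Aφx , trans (cong (second ∘ A) φσσφx≡) (cong second Aσe₁)

    opposite : φ (σf (φ (σf (σf (φ x))))) ≡ σf (φ (σf (σf x)))
    opposite = trans (cong (φ ∘ σf) (trans φσσφx≡ (cong σf e₁≡))) (trans (cong φ (σf-injective (σ⁴ Ad₂))) (φα d₁))

  -- The triangle across the common edge `d` would have two sides on large faces.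
  no-twin : ∀ d → A d ≡ 3 ∷ 3 ∷ 42 ∷ 3 ∷ [] → A (φ d) ≡ 3 ∷ 3 ∷ 42 ∷ 3 ∷ [] → ⊥
  no-twin d p q = bad-triangle (αf d) (cong hd Aα) (cong last Aα) (trans (cong (second ∘ A) (φα d)) (cong second (A-next refl p)))
    where
    Aα : A (αf d) ≡ 3 ∷ 3 ∷ 3 ∷ 42 ∷ []
    Aα = A-prev refl q

  everywhere : ∀ {P : Fin darts → Set} → (∀ e → P e → P (σf e)) → (∀ e → P e → P (αf e)) → ∀ {d} → P d → ∀ e → P e
  everywhere {P} s a {d} p e = go (connected d e)
    where
    go : ∀ {e} → Reach σf αf d e → P e
    go here      = p
    go (stepσ r) = s _ (go r)
    go (stepα r) = a _ (go r)

  along-face : ∀ {P : Fin darts → Set} → (∀ x → P x → P (φ x)) → ∀ {x} → P x → ∀ y → face x ≡ face y → P y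
  along-face {P} step {x} p y e with proj₁ (face-orbit x y) e
  ... | k , refl = go k
    where
    go : ∀ k → P (iter φ k x)
    go zero    = p
    go (suc k) = step _ (go k)

-- A ladder fills the graph, and a single large face is impossible.

sum-zero : ∀ {n} {g : Fin n → ℤ} → (∀ v → g v ≡ 0ℤ) → sum g ≡ 0ℤ
sum-zero {n} h = trans (sum-cong-≗ h) (sum-replicate-zero n)

not-intro : ∀ {b} → (b ≡ true → ⊥) → not b ≡ true
not-intro {true}  f = ⊥-elim (f refl)
not-intro {false} f = refl

∧-intro : ∀ {a b} → a ≡ true → b ≡ true → (a ∧ b) ≡ true
∧-intro refl refl = refl

∨-true : ∀ {a b} → (a ∨ b) ≡ true → a ≡ true ⊎ b ≡ true
∨-true {true}  e = inj₁ refl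
∨-true {false} e = inj₂ e

module Closure (M : Map) (simple : Simple M) (spherical : Spherical M)
  (positive : PositivelyCurved M) (deg≥3 : ∀ v → 3 ℕ.≤ Maps.deg′ M v) where

  open Large M simple spherical positive deg≥3 public

  -- These cross the strip, from a corner of a large face to the corner of a large face on the far
  -- side.
  ψ₄ ψ₃ : Fin darts → Fin darts
  ψ₄ x = σf (φ (σf x))
  ψ₃ x = σf (φ (σf (σf x)))

  On₄ On₃ : Fin F → Fin darts → Set
  On₄ f e = ∃ λ x → face x ≡ f × (e ≡ x ⊎ e ≡ σf x ⊎ e ≡ σf (σf x))
  On₃ f e = ∃ λ x → face x ≡ f × (e ≡ x ⊎ e ≡ σf x ⊎ e ≡ σf (σf x) ⊎ e ≡ σf (σf (σf x)))

  -- The three darts at a vertex of `f` lead backwards or forwards along `f`, or over a rung to a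
  -- corner that is again on `f`. The darts at `f` are thus closed under `σf` and `αf`, and
  -- connectedness makes them all darts.
  closure₄ : ∀ f → (∀ x → face x ≡ f → A x ≡ 42 ∷ 4 ∷ 4 ∷ [] × A (φ (σf x)) ≡ 4 ∷ 42 ∷ 4 ∷ [] × face (ψ₄ x) ≡ f) →
             ∀ {x} → face x ≡ f → ∀ e → On₄ f e
  closure₄ f H {x} p = everywhere rotate cross (x , p , inj₁ refl)
    where
    rotate : ∀ e → On₄ f e → On₄ f (σf e)
    rotate e (x , p , inj₁ refl)        = x , p , inj₂ (inj₁ refl)
    rotate e (x , p , inj₂ (inj₁ refl)) = x , p , inj₂ (inj₂ refl)
    rotate e (x , p , inj₂ (inj₂ refl)) = x , p , inj₁ (σ³ (proj₁ (H x p)))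
    cross : ∀ e → On₄ f e → On₄ f (αf e)
    cross e (x , p , inj₁ refl) = φ x , q , inj₂ (inj₂ (σf-injective (sym (σ³ (proj₁ (H (φ x) q))))))
      where q = trans (face-φ x) p
    cross e (x , p , inj₂ (inj₁ refl)) = ψ₄ x , proj₂ (proj₂ (H x p)) , inj₂ (inj₁ (σf-injective (sym (σ³ (proj₁ (proj₂ (H x p)))))))
    cross e (x , p , inj₂ (inj₂ refl)) = αf (σf (σf x)) , trans (face-α (σf (σf x))) (trans (cong face (σ³ (proj₁ (H x p)))) p) , inj₁ refl

  closure₃ : ∀ f → (∀ x → face x ≡ f → A x ≡ 42 ∷ 3 ∷ 3 ∷ 3 ∷ [] × A (φ (σf (σf x))) ≡ 3 ∷ 42 ∷ 3 ∷ 3 ∷ [] × face (ψ₃ x) ≡ f) →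
             ∀ {x} → face x ≡ f → ∀ e → On₃ f e
  closure₃ f H {x} p = everywhere rotate cross (x , p , inj₁ refl)
    where
    rotate : ∀ e → On₃ f e → On₃ f (σf e)
    rotate e (x , p , inj₁ refl)               = x , p , inj₂ (inj₁ refl)
    rotate e (x , p , inj₂ (inj₁ refl))        = x , p , inj₂ (inj₂ (inj₁ refl))
    rotate e (x , p , inj₂ (inj₂ (inj₁ refl))) = x , p , inj₂ (inj₂ (inj₂ refl))
    rotate e (x , p , inj₂ (inj₂ (inj₂ refl))) = x , p , inj₁ (σ⁴ (proj₁ (H x p)))
    cross : ∀ e → On₃ f e → On₃ f (αf e)
    cross e (x , p , inj₁ refl) = φ x , q , inj₂ (inj₂ (inj₂ (σf-injective (sym (σ⁴ (proj₁ (H (φ x) q)))))))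
      where q = trans (face-φ x) p
    -- This is the slanted rung of the next triangle: the large corner at its far end is `ψ₃ (φ x)`.
    cross e (x , p , inj₂ (inj₁ refl)) = σf (σf (σf d₂)) ,
        trans (cong face (sym (trans (cong σf φσσφx≡) (cong (σf ∘ σf) e₁≡)))) (proj₂ (proj₂ (H (φ x) (trans (face-φ x) p)))) ,
        inj₂ (inj₁ (trans (sym d₂≡) (sym (σ⁴ Ad₂))))
      where open Strip {x} (proj₁ (H x p)) (cong second (proj₁ (proj₂ (H x p))))
    cross e (x , p , inj₂ (inj₂ (inj₁ refl))) = ψ₃ x , proj₂ (proj₂ (H x p)) , inj₂ (inj₂ (inj₁ (σf-injective (sym (σ⁴ (proj₁ (proj₂ (H x p))))))))
    cross e (x , p , inj₂ (inj₂ (inj₂ refl))) = αf (σf (σf (σf x))) , trans (face-α (σf (σf (σf x)))) (trans (cong face (σ⁴ (proj₁ (H x p)))) p) , inj₁ refl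

  rotations₄ rotations₃ : List (List ℕ)
  rotations₄ = (42 ∷ 4 ∷ 4 ∷ []) ∷ (4 ∷ 4 ∷ 42 ∷ []) ∷ (4 ∷ 42 ∷ 4 ∷ []) ∷ []
  rotations₃ = (42 ∷ 3 ∷ 3 ∷ 3 ∷ []) ∷ (3 ∷ 3 ∷ 3 ∷ 42 ∷ []) ∷ (3 ∷ 3 ∷ 42 ∷ 3 ∷ []) ∷ (3 ∷ 42 ∷ 3 ∷ 3 ∷ []) ∷ []

  on₄-A : ∀ f → (∀ x → face x ≡ f → A x ≡ 42 ∷ 4 ∷ 4 ∷ []) → ∀ e → On₄ f e → A e ∈ rotations₄
  on₄-A f H e (x , p , inj₁ refl)        = here (H x p)
  on₄-A f H e (x , p , inj₂ (inj₁ refl)) = there (here (A-next refl (H x p)))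
  on₄-A f H e (x , p , inj₂ (inj₂ refl)) = there (there (here (A-next refl (A-next refl (H x p)))))

  on₃-A : ∀ f → (∀ x → face x ≡ f → A x ≡ 42 ∷ 3 ∷ 3 ∷ 3 ∷ []) → ∀ e → On₃ f e → A e ∈ rotations₃
  on₃-A f H e (x , p , inj₁ refl)               = here (H x p)
  on₃-A f H e (x , p , inj₂ (inj₁ refl))        = there (here (A-next refl (H x p)))
  on₃-A f H e (x , p , inj₂ (inj₂ (inj₁ refl))) = there (there (here (A-next refl (A-next refl (H x p)))))
  on₃-A f H e (x , p , inj₂ (inj₂ (inj₂ refl))) = there (there (there (here (A-next refl (A-next refl (A-next refl (H x p)))))))

  large-face : ∀ {d f} → 42 ℕ.≤ size′ f → face d ≡ f → cap (sz d) ≡ 42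
  large-face b refl = large b

  -- A single large face whose vertices are all the vertices violates Gauss–Bonnet.
  lonely : ∀ f₀ c → c ∈ (3 ∷ 4 ∷ []) → 42 ℕ.≤ size′ f₀ → (∀ d → cap (sz d) ≡ 42 → face d ≡ f₀) →
           + c ℤ.* + lower c ≡ + 720720 →
           (∀ d → cap (sz d) ≡ 42 ⊎ cap (sz d) ≡ c) → (∀ d → charge half (withLarge 0ℤ) (A d) ≡ 0ℤ) → ⊥
  lonely f₀ c c∈ big only₀ cN sizes zero-charge = absurd (trans (sym vertices) (trans (total-≡ (withLarge 0ℤ ∘ cap) w faces) (cong (λ t → + 1441440 ℤ.- t) (∑-delta f₀ (+ 720720)))))
    where
    absurd : ¬ (0ℤ ≡ + 720720)
    absurd ()
    w : Fin F → ℤ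
    w f = if does (f₀ Finₚ.≟ f) then + 720720 else 0ℤ
    vertices : sum (vcharge half (withLarge 0ℤ ∘ cap)) ≡ 0ℤ
    vertices = sum-zero λ v → at v (vert-surj v)
      where
      at : ∀ v → (∃ λ d → vert d ≡ v) → vcharge half (withLarge 0ℤ ∘ cap) v ≡ 0ℤ
      at .(vert d) (d , refl) = trans (charge-cap (withLarge 0ℤ) d) (trans (cong (charge half (withLarge 0ℤ)) (sym (A≡ d))) (zero-charge d))
    c≢42 : ∀ c → c ∈ (3 ∷ 4 ∷ []) → ¬ (42 ≡ c)
    c≢42 .3 (here refl) ()
    c≢42 .4 (there (here refl)) ()
    withLarge-c : ∀ c → c ∈ (3 ∷ 4 ∷ []) → withLarge 0ℤ c ≡ + lower c
    withLarge-c .3 (here refl) = refl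
    withLarge-c .4 (there (here refl)) = refl
    value : ∀ s c → c ∈ (3 ∷ 4 ∷ []) → s ≡ c → cap s ≡ c → + c ℤ.* + lower c ≡ + 720720 → + s ℤ.* withLarge 0ℤ (cap s) ≡ + 720720
    value s c c∈ refl e cN = trans (cong (+ s ℤ.*_) (trans (cong (withLarge 0ℤ) e) (withLarge-c s c∈))) cN
    faces : ∀ f → + size′ f ℤ.* (withLarge 0ℤ ∘ cap) (size′ f) ≡ + 720720 ℤ.- w f
    faces f = at f (face-surj f)
      where
      at : ∀ f → (∃ λ d → face d ≡ f) → + size′ f ℤ.* (withLarge 0ℤ ∘ cap) (size′ f) ≡ + 720720 ℤ.- w f
      at .(face d) (d , refl) with sizes d
      ... | inj₁ e = trans (cong (λ t → + sz d ℤ.* withLarge 0ℤ t) e) (trans (ℤₚ.*-zeroʳ (+ sz d))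
            (cong (λ b → + 720720 ℤ.- (if b then + 720720 else 0ℤ)) (sym (dec-true (f₀ Finₚ.≟ face d) (sym (only₀ d e))))))
      ... | inj₂ e = trans (value (sz d) c c∈ (exactly c c∈ (sz d) (sz≥3 d) e) e cN)
            (cong (λ b → + 720720 ℤ.- (if b then + 720720 else 0ℤ)) (sym (dec-false (f₀ Finₚ.≟ face d) λ q → c≢42 c c∈ (trans (sym (large-face {d} big (sym q))) e))))

  zero₄ : ∀ {B} → B ∈ rotations₄ → charge half (withLarge 0ℤ) B ≡ 0ℤ × (hd B ≡ 42 ⊎ hd B ≡ 4)
  zero₄ (here refl)                 = refl , inj₁ refl
  zero₄ (there (here refl))         = refl , inj₂ refl
  zero₄ (there (there (here refl))) = refl , inj₂ refl

  zero₃ : ∀ {B} → B ∈ rotations₃ → charge half (withLarge 0ℤ) B ≡ 0ℤ × (hd B ≡ 42 ⊎ hd B ≡ 3)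
  zero₃ (here refl)                         = refl , inj₁ refl
  zero₃ (there (here refl))                 = refl , inj₂ refl
  zero₃ (there (there (here refl)))         = refl , inj₂ refl
  zero₃ (there (there (there (here refl)))) = refl , inj₂ refl

  sizes-of : ∀ {d c} → hd (A d) ≡ 42 ⊎ hd (A d) ≡ c → cap (sz d) ≡ 42 ⊎ cap (sz d) ≡ c
  sizes-of {d} (inj₁ e) = inj₁ (trans (sym (A-hd d)) e)
  sizes-of {d} (inj₂ e) = inj₂ (trans (sym (A-hd d)) e)

  module One (f₀ : Fin F) (big : 86 ℕ.≤ size′ f₀) (only₀ : ∀ f → f ≢ f₀ → size′ f ℕ.< 42) where

    big₄₂ : 42 ℕ.≤ size′ f₀
    big₄₂ = ℕₚ.≤-trans (ℕₚ.≤ᵇ⇒≤ 42 86 _) big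

    onlyLarge : ∀ d → cap (sz d) ≡ 42 → face d ≡ f₀
    onlyLarge d e with face d Finₚ.≟ f₀
    ... | yes p = p
    ... | no p  = ⊥-elim (ℕₚ.<⇒≱ (only₀ (face d) p) (cap≡42 (sz d) e))

    on-f₀ : ∀ {d} → hd (A d) ≡ 42 → face d ≡ f₀
    on-f₀ {d} e = onlyLarge d (trans (sym (A-hd d)) e)

    -- A ladder propagates along all of `f₀`, and its far side is `f₀` too, no other face being
    -- large. It contains every vertex, so all vertices are flat, contrary to `lonely`.
    no-ladder₄ : ∀ x → ¬ Ladder₄ x
    no-ladder₄ x L = lonely f₀ 4 (there (here refl)) big₄₂ onlyLarge refl (λ d → sizes-of {d} (proj₂ (zero₄ (all-A d)))) (λ d → proj₁ (zero₄ (all-A d)))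
      where
      x∈ : face x ≡ f₀
      x∈ = on-f₀ {x} (cong hd (proj₁ L))
      L′ : ∀ y → face y ≡ f₀ → Ladder₄ y
      L′ y p = along-face {Ladder₄} (λ x L → Square.next (proj₁ L) (proj₂ L)) L y (trans x∈ (sym p))
      all-A : ∀ d → A d ∈ rotations₄
      all-A d = on₄-A f₀ (λ y p → proj₁ (L′ y p)) d (closure₄ f₀ (λ y p → proj₁ (L′ y p) , proj₂ (L′ y p) , on-f₀ {ψ₄ y} (cong hd (A-next refl (proj₂ (L′ y p))))) x∈ d)

    no-ladder₃ : ∀ x → ¬ Ladder₃ x
    no-ladder₃ x L = lonely f₀ 3 (here refl) big₄₂ onlyLarge refl (λ d → sizes-of {d} (proj₂ (zero₃ (all-A d)))) (λ d → proj₁ (zero₃ (all-A d)))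
      where
      x∈ : face x ≡ f₀
      x∈ = on-f₀ {x} (cong hd (proj₁ L))
      L′ : ∀ y → face y ≡ f₀ → Ladder₃ y
      L′ y p = along-face {Ladder₃} (λ x L → Strip.next (proj₁ L) (proj₂ L)) L y (trans x∈ (sym p))
      all-A : ∀ d → A d ∈ rotations₃
      all-A d = on₃-A f₀ (λ y p → proj₁ (L′ y p)) d (closure₃ f₀ (λ y p → let (a , b) = L′ y p in
        a , Strip.Ad₁ a b , on-f₀ {ψ₃ y} (cong hd (A-next refl (Strip.Ad₁ a b)))) x∈ d)

    noLadder-A : ∀ d → noLadder (A d) (A (φ d)) ≡ true
    noLadder-A d = ∧-intro
      (not-intro λ e → let p = eqList-sound (A d) _ (proj₁ (∧-true e)) ; q = eqList-sound (A (φ d)) _ (proj₂ (∧-true {eqList (A d) (4 ∷ 4 ∷ 42 ∷ [])} e)) in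
        no-ladder₄ (σf (σf d)) (A-next refl (A-next refl p) , trans (cong (A ∘ φ) (σ³ p)) q))
      (not-intro λ e → let p = eqList-sound (A d) _ (proj₁ (∧-true e)) in
        either-way p (∨-true (proj₂ (∧-true {eqList (A d) (3 ∷ 3 ∷ 42 ∷ 3 ∷ [])} e))))
      where
      either-way : A d ≡ 3 ∷ 3 ∷ 42 ∷ 3 ∷ [] → (second (A (φ d)) ≡ᵇ 42) ≡ true ⊎ eqList (A (φ d)) (3 ∷ 3 ∷ 42 ∷ 3 ∷ []) ≡ true → ⊥
      either-way p (inj₁ s) = no-ladder₃ (σf (σf d)) (A-next refl (A-next refl p) , trans (cong (second ∘ A ∘ φ) (σ⁴ p)) (≡ᵇ-sound _ 42 s))
      either-way p (inj₂ q) = no-twin d p (eqList-sound (A (φ d)) _ q)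

    faces-OK : ∀ d → ¬ (∀ j → 0 ℕ.< j → j ℕ.≤ sz d → walk net d j ℤ.< 0ℤ)
    faces-OK d = go (cap∈labels (sz d) (sz≥3 d))
      where
      ok : ∀ d → noLadder (lab (X d)) (lab (X (φ d))) ≡ true
      ok d = subst₂ (λ a b → noLadder a b ≡ true) (sym (lab-X d)) (sym (lab-X (φ d))) (noLadder-A d)
      go : cap (sz d) ∈ labels → ¬ (∀ j → 0 ℕ.< j → j ℕ.≤ sz d → walk net d j ℤ.< 0ℤ)
      go (here e)            = faceOK-sound ok 3 (3 ∷ []) ladder-faceOK₃ d e (here (exactly 3 (here refl) (sz d) (sz≥3 d) e))
      go (there (here e))    = faceOK-sound ok 4 (4 ∷ []) ladder-faceOK₄ d e (here (exactly 4 (there (here refl)) (sz d) (sz≥3 d) e))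
      go (there (there m))   = idleOK-sound ok (cap (sz d)) (all-∈ (Ladder.idleOK Ladder.states) {idleLabels} ladder-idleOK m) d refl

    contradiction : ⊥
    contradiction = ℤₚ.<⇒≱ bound (ℤₚ.*-cancelˡ-≤-pos 0ℤ S (+ 60) (subst (+ 60 ℤ.* 0ℤ ℤ.≤_) (∑-* (+ 60) (vcharge half u)) (discharge-net (λ v → + 60 ℤ.* vcharge half u v) vertices faces-OK)))
      where
      u : ℕ → ℤ
      u = withLarge -[1+ 8399 ] ∘ cap
      S : ℤ
      S = sum (vcharge half u)
      vertices : ∀ d → orbit-sum (share′ ∘ X) d ℤ.≤ + 60 ℤ.* vcharge half u (vert d)
      vertices d = subst (λ t → orbit-sum (share′ ∘ X) d ℤ.≤ + 60 ℤ.* t)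
        (trans (cong surplus (A≡ d)) (sym (charge-cap (withLarge -[1+ 8399 ]) d)))
        (vertexOK-sound ladder-vertexOK d)
      -- 1443120 = 720720 + 86 · 8400: the large face contributes at most -86 · 8400 where
      -- Gauss-Bonnet expects 720720. The total 1441440 - 1443120 is negative.
      w : Fin F → ℤ
      w f = if does (f₀ Finₚ.≟ f) then + 1443120 else 0ℤ
      mono : ∀ z s → ℤ.NonPositive z → 86 ℕ.≤ s → + s ℤ.* z ℤ.≤ + 86 ℤ.* z
      mono z s np q = ℤₚ.*-monoʳ-≤-nonPos z {{np}} (ℤ.+≤+ q)
      faces : ∀ f → + size′ f ℤ.* u (size′ f) ℤ.≤ + 720720 ℤ.- w f
      faces f with f₀ Finₚ.≟ f
      ... | yes refl = subst (λ c → + size′ f₀ ℤ.* withLarge -[1+ 8399 ] c ℤ.≤ + 720720 ℤ.- + 1443120) (sym (large big₄₂)) (mono -[1+ 8399 ] (size′ f₀) _ big)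
      ... | no p     = small (size′ f) (only₀ f (p ∘ sym))
        where
        small : ∀ s → s ℕ.< 42 → + s ℤ.* withLarge -[1+ 8399 ] (cap s) ℤ.≤ + 720720
        small s q = subst (λ t → + s ℤ.* t ℤ.≤ + 720720) (sym (isLower (cap s ℕₚ.≟ 42)))
          (subst (ℤ._≤ + 720720) (ℤₚ.pos-* s (lower (cap s))) (ℤ.+≤+ (lower-cap s q)))
          where
          isLower : Relation.Nullary.Dec (cap s ≡ 42) → withLarge -[1+ 8399 ] (cap s) ≡ + lower (cap s)
          isLower (yes e) = ⊥-elim (ℕₚ.<⇒≱ q (cap≡42 s e))
          isLower (no n)  = cong (λ b → if b then -[1+ 8399 ] else + lower (cap s)) (≢ᵇ (cap s) 42 n)
            where
            ≢ᵇ : ∀ a b → a ≢ b → (a ≡ᵇ b) ≡ false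
            ≢ᵇ a b n with a ≡ᵇ b in e
            ... | true  = ⊥-elim (n (≡ᵇ-sound a b e))
            ... | false = refl
      bound : S ℤ.< 0ℤ
      bound = ℤₚ.≤-<-trans (subst (λ t → S ℤ.≤ + 1441440 ℤ.- t) (∑-delta f₀ (+ 1443120)) (total-≤ u w faces)) ℤ.-<+

-- Two large faces force a prism or an antiprism.

delta : ∀ {n} → Fin n → ℤ → Fin n → ℤ
delta a z f = if does (a Finₚ.≟ f) then z else 0ℤ

flat : List ℕ → Bool
flat B = charge half (withLarge 0ℤ) B ℤ.≤ᵇ 0ℤ

-- The rotations of (4,4,42), (3,3,3,42) and, in both orientations, (3,6,42).
flatTypes : List (List ℕ)
flatTypes = (42 ∷ 4 ∷ 4 ∷ []) ∷ (4 ∷ 4 ∷ 42 ∷ []) ∷ (4 ∷ 42 ∷ 4 ∷ [])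
  ∷ (42 ∷ 3 ∷ 3 ∷ 3 ∷ []) ∷ (3 ∷ 3 ∷ 3 ∷ 42 ∷ []) ∷ (3 ∷ 3 ∷ 42 ∷ 3 ∷ []) ∷ (3 ∷ 42 ∷ 3 ∷ 3 ∷ [])
  ∷ (3 ∷ 6 ∷ 42 ∷ []) ∷ (6 ∷ 42 ∷ 3 ∷ []) ∷ (42 ∷ 3 ∷ 6 ∷ []) ∷ (3 ∷ 42 ∷ 6 ∷ []) ∷ (42 ∷ 6 ∷ 3 ∷ []) ∷ (6 ∷ 3 ∷ 42 ∷ []) ∷ []

one-if-large : ℕ → ℤ
one-if-large c = if c ≡ᵇ 42 then + 1 else 0ℤ

sum-nonneg-zero : ∀ {n} (g : Fin n → ℤ) → (∀ v → 0ℤ ℤ.≤ g v) → sum g ℤ.≤ 0ℤ → ∀ v → g v ℤ.≤ 0ℤ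
sum-nonneg-zero {suc n} g pos le zero =
  ℤₚ.≤-trans (subst (ℤ._≤ g zero ℤ.+ sum (g ∘ suc)) (ℤₚ.+-identityʳ (g zero)) (ℤₚ.+-monoʳ-≤ (g zero) (nonneg (g ∘ suc) (pos ∘ suc)))) le
  where
  nonneg : ∀ {n} (g : Fin n → ℤ) → (∀ v → 0ℤ ℤ.≤ g v) → 0ℤ ℤ.≤ sum g
  nonneg {zero}  g p = ℤₚ.≤-refl
  nonneg {suc n} g p = ℤₚ.+-mono-≤ (p zero) (nonneg (g ∘ suc) (p ∘ suc))
sum-nonneg-zero {suc n} g pos le (suc v) = sum-nonneg-zero (g ∘ suc) (pos ∘ suc)
  (ℤₚ.≤-trans (subst (ℤ._≤ g zero ℤ.+ sum (g ∘ suc)) (ℤₚ.+-identityˡ (sum (g ∘ suc))) (ℤₚ.+-monoˡ-≤ (sum (g ∘ suc)) (pos zero))) le) v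

module Two (M : Map) (simple : Simple M) (spherical : Spherical M)
  (positive : PositivelyCurved M) (deg≥3 : ∀ v → 3 ℕ.≤ Maps.deg′ M v)
  (f₀ g₀ : Fin (Map.F M)) (distinct : f₀ ≢ g₀) (big-f : 42 ℕ.≤ Maps.size′ M f₀) (big-g : 42 ℕ.≤ Maps.size′ M g₀) where

  open Closure M simple spherical positive deg≥3

  u : ℕ → ℤ
  u = withLarge 0ℤ ∘ cap

  w : Fin F → ℤ
  w f = if 42 ≤ᵇ size′ f then + 720720 else 0ℤ

  w-big : ∀ {f} → 42 ℕ.≤ size′ f → w f ≡ + 720720
  w-big {f} q = cong (λ b → if b then + 720720 else 0ℤ) (≤ᵇ-true q)
    where
    open import Data.Bool.Properties using (T-≡)
    open import Function.Bundles using (Equivalence)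
    ≤ᵇ-true : 42 ℕ.≤ size′ f → (42 ≤ᵇ size′ f) ≡ true
    ≤ᵇ-true q = Equivalence.to T-≡ (ℕₚ.≤⇒≤ᵇ q)

  w-nonneg : ∀ f → 0ℤ ℤ.≤ w f
  w-nonneg f with 42 ≤ᵇ size′ f
  ... | true  = ℤ.+≤+ z≤n
  ... | false = ℤₚ.≤-refl

  faces : ∀ f → + size′ f ℤ.* u (size′ f) ℤ.≤ + 720720 ℤ.- w f
  faces f with small-or-large (size′ f)
  ... | inj₂ q = subst₂ (λ a b → + size′ f ℤ.* withLarge 0ℤ a ℤ.≤ + 720720 ℤ.- b) (sym (large q)) (sym (w-big {f} q)) (ℤₚ.≤-reflexive (ℤₚ.*-zeroʳ (+ size′ f)))
  ... | inj₁ q = subst (λ b → + size′ f ℤ.* u (size′ f) ℤ.≤ + 720720 ℤ.- b) (sym w≡0)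
        (subst (λ t → + size′ f ℤ.* t ℤ.≤ + 720720) (sym u≡) (subst (ℤ._≤ + 720720) (ℤₚ.pos-* (size′ f) (lower (cap (size′ f)))) (ℤ.+≤+ (lower-cap (size′ f) q))))
    where
    ≢ᵇ : ∀ a b → a ≢ b → (a ≡ᵇ b) ≡ false
    ≢ᵇ a b n with a ≡ᵇ b in e
    ... | true  = ⊥-elim (n (≡ᵇ-sound a b e))
    ... | false = refl
    u≡ : u (size′ f) ≡ + lower (cap (size′ f))
    u≡ = cong (λ b → if b then 0ℤ else + lower (cap (size′ f))) (≢ᵇ (cap (size′ f)) 42 (λ e → ℕₚ.<⇒≱ q (cap≡42 (size′ f) e)))
    w≡0 : w f ≡ 0ℤ
    w≡0 with 42 ≤ᵇ size′ f in e
    ... | true  = ⊥-elim (ℕₚ.<⇒≱ q (≤ᵇ-sound 42 (size′ f) e))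
    ... | false = refl

  S : ℤ
  S = sum (vcharge half u)

  S≤ : S ℤ.≤ + 1441440 ℤ.- sum w
  S≤ = total-≤ u w faces

  vcharge≡ : ∀ d → vcharge half u (vert d) ≡ charge half (withLarge 0ℤ) (A d)
  vcharge≡ d = trans (charge-cap (withLarge 0ℤ) d) (cong (charge half (withLarge 0ℤ)) (sym (A≡ d)))

  -- This is where the threshold 42 matters: 1/3 + 1/7 - 1/2 = -1/42, so (3,7,s) is positively
  -- curved just for s < 42. The remaining types are checked one by one.
  nonneg : ∀ v → 0ℤ ℤ.≤ vcharge half u v
  nonneg v = at v (vert-surj v)
    where
    open import Data.Bool.Properties using (T-≡)
    open import Function.Bundles using (Equivalence)
    at : ∀ v → (∃ λ d → vert d ≡ v) → 0ℤ ℤ.≤ vcharge half u v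
    at .(vert d) (d , refl) = subst (0ℤ ℤ.≤_) (sym (vcharge≡ d))
      (ℤₚ.≤ᵇ⇒≤ (Equivalence.from T-≡ (all-∈ (λ B → 0ℤ ℤ.≤ᵇ charge half (withLarge 0ℤ) B) {corners 720720} refl (A-∈ d))))

  deltas≤ : (ds : List (Fin F)) → All (λ a → 42 ℕ.≤ size′ a) ds → Data.List.Relation.Unary.AllPairs.AllPairs _≢_ ds →
            ∀ f → ∑ₗ (λ a → delta a (+ 720720) f) ds ℤ.≤ w f
  deltas≤ []       _        _        f = w-nonneg f
  deltas≤ (a ∷ ds) (p ∷ ps) (n ∷ ns) f with a Finₚ.≟ f
  ... | no _     = subst (ℤ._≤ w f) (sym (ℤₚ.+-identityˡ _)) (deltas≤ ds ps ns f)
  ... | yes refl = ℤₚ.≤-reflexive (trans (cong (ℤ._+_ (+ 720720)) (others ds n)) (trans (ℤₚ.+-identityʳ _) (sym (w-big p))))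
    where
    others : ∀ ds → All (a ≢_) ds → ∑ₗ (λ b → delta b (+ 720720) a) ds ≡ 0ℤ
    others []       _        = refl
    others (b ∷ ds) (q ∷ qs) = cong₂ ℤ._+_ (cong (λ t → if t then + 720720 else 0ℤ) (dec-false (b Finₚ.≟ a) (q ∘ sym))) (others ds qs)

  -- Every large face takes 720720 from the total 1441440, so three of them would make a sum of
  -- nonnegative charges negative.
  third : ∀ h → 42 ℕ.≤ size′ h → h ≡ f₀ ⊎ h ≡ g₀
  third h big-h with h Finₚ.≟ f₀ | h Finₚ.≟ g₀
  ... | yes p | _     = inj₁ p
  ... | no _  | yes p = inj₂ p
  ... | no p  | no q  = ⊥-elim (ℤₚ.<⇒≱ neg (sum-nonneg nonneg))
    where
    three : + 2162160 ℤ.≤ sum w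
    three = subst (ℤ._≤ sum w) (trans (∑-distrib-+ (delta f₀ (+ 720720)) _) (cong₂ ℤ._+_ (∑-delta f₀ (+ 720720))
        (trans (∑-distrib-+ (delta g₀ (+ 720720)) _) (cong₂ ℤ._+_ (∑-delta g₀ (+ 720720))
        (trans (∑-distrib-+ (delta h (+ 720720)) _) (cong₂ ℤ._+_ (∑-delta h (+ 720720)) (sum-replicate-zero F)))))))
      (sum-mono (deltas≤ (f₀ ∷ g₀ ∷ h ∷ []) (big-f ∷ big-g ∷ big-h ∷ []) ((distinct ∷ (p ∘ sym) ∷ []) ∷ ((q ∘ sym) ∷ []) ∷ [] ∷ Data.List.Relation.Unary.AllPairs.[])))
    neg : S ℤ.< 0ℤ
    neg = ℤₚ.≤-<-trans (ℤₚ.≤-trans S≤ (ℤₚ.+-monoʳ-≤ (+ 1441440) (ℤₚ.neg-mono-≤ three))) ℤ.-<+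

  S≤0 : S ℤ.≤ 0ℤ
  S≤0 = ℤₚ.≤-trans S≤ (ℤₚ.+-monoʳ-≤ (+ 1441440) (ℤₚ.neg-mono-≤ two))
    where
    two : + 1441440 ℤ.≤ sum w
    two = subst (ℤ._≤ sum w) (trans (∑-distrib-+ (delta f₀ (+ 720720)) _) (cong₂ ℤ._+_ (∑-delta f₀ (+ 720720))
        (trans (∑-distrib-+ (delta g₀ (+ 720720)) _) (cong₂ ℤ._+_ (∑-delta g₀ (+ 720720)) (sum-replicate-zero F)))))
      (sum-mono (deltas≤ (f₀ ∷ g₀ ∷ []) (big-f ∷ big-g ∷ []) ((distinct ∷ []) ∷ [] ∷ Data.List.Relation.Unary.AllPairs.[])))

  -- Two large faces use up the whole total, so the nonnegative charges all vanish.
  flat-A : ∀ d → flat (A d) ≡ true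
  flat-A d = Equivalence.to T-≡ (ℤₚ.≤⇒≤ᵇ (subst (ℤ._≤ 0ℤ) (vcharge≡ d) (sum-nonneg-zero (vcharge half u) nonneg S≤0 (vert d))))
    where
    open import Data.Bool.Properties using (T-≡)
    open import Function.Bundles using (Equivalence)

  flat-is : ∀ {d} (q : List ℕ → Bool) → q (A d) ≡ true → (flat (A d) ∧ q (A d)) ≡ true
  flat-is {d} q e = ∧-intro (flat-A d) e

  -- A parity obstruction: the sides of the triangle would have to alternate between 6 and 42. Here
  -- it appears as a corner `φ t` between two large faces.
  no-3-42-6 : ∀ t → A t ≡ 3 ∷ 42 ∷ 6 ∷ [] → ⊥
  no-3-42-6 t e = no-double (φ t) (trans (sym (link (φ t))) (cong last A₂)) (trans (link t) (cong second e))
    where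
    A₂ : A (φ (φ t)) ≡ 3 ∷ 6 ∷ 42 ∷ []
    A₂ = only (classify (λ B → flat B ∧ ((hd B ≡ᵇ 3) ∧ (second B ≡ᵇ 6))) ((3 ∷ 6 ∷ 42 ∷ []) ∷ []) refl (φ (φ t))
      (flat-is {φ (φ t)} (λ B → (hd B ≡ᵇ 3) ∧ (second B ≡ᵇ 6)) (subst₂ (λ a b → ((a ≡ᵇ 3) ∧ (b ≡ᵇ 6)) ≡ true)
        (sym (trans (same (φ t)) (trans (same t) (cong hd e)))) (sym (trans (sym (link (φ (φ t)))) (trans (cong (last ∘ A) (triangle (cong hd e))) (cong last e)))) refl)))

  no-3-6-42 : ∀ t → A t ≡ 3 ∷ 6 ∷ 42 ∷ [] → ⊥
  no-3-6-42 t e = no-3-42-6 (φ t) (only (classify (λ B → flat B ∧ ((hd B ≡ᵇ 3) ∧ (last B ≡ᵇ 6))) ((3 ∷ 42 ∷ 6 ∷ []) ∷ []) refl (φ t)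
      (flat-is {φ t} (λ B → (hd B ≡ᵇ 3) ∧ (last B ≡ᵇ 6)) (subst₂ (λ a b → ((a ≡ᵇ 3) ∧ (b ≡ᵇ 6)) ≡ true)
        (sym (trans (same t) (cong hd e))) (sym (trans (link t) (cong second e))) refl))))

  type : ∀ d → A d ∈ rotations₄ ⊎ A d ∈ rotations₃
  type d = split (classify flat flatTypes refl d (flat-A d))
    where
    split : A d ∈ flatTypes → A d ∈ rotations₄ ⊎ A d ∈ rotations₃
    split (here e)                                         = inj₁ (here e)
    split (there (here e))                                 = inj₁ (there (here e))
    split (there (there (here e)))                         = inj₁ (there (there (here e)))
    split (there (there (there (here e))))                 = inj₂ (here e)
    split (there (there (there (there (here e)))))         = inj₂ (there (here e))
    split (there (there (there (there (there (here e)))))) = inj₂ (there (there (here e)))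
    split (there (there (there (there (there (there (here e))))))) = inj₂ (there (there (there (here e))))
    split (there (there (there (there (there (there (there (here e)))))))) = ⊥-elim (no-3-6-42 d e)
    split (there (there (there (there (there (there (there (there (here e))))))))) = ⊥-elim (no-3-6-42 (σf (σf d)) (A-next refl (A-next refl e)))
    split (there (there (there (there (there (there (there (there (there (here e)))))))))) = ⊥-elim (no-3-6-42 (σf d) (A-next refl e))
    split (there (there (there (there (there (there (there (there (there (there (here e))))))))))) = ⊥-elim (no-3-42-6 d e)
    split (there (there (there (there (there (there (there (there (there (there (there (here e)))))))))))) = ⊥-elim (no-3-42-6 (σf (σf d)) (A-next refl (A-next refl e)))
    split (there (there (there (there (there (there (there (there (there (there (there (there (here e))))))))))))) = ⊥-elim (no-3-42-6 (σf d) (A-next refl e))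

  rot₄ : ∀ {B} → B ∈ rotations₄ → rot B ∈ rotations₄
  rot₄ (here refl)                 = there (here refl)
  rot₄ (there (here refl))         = there (there (here refl))
  rot₄ (there (there (here refl))) = here refl

  rotʳ₄ : ∀ {B} → B ∈ rotations₄ → rotʳ B ∈ rotations₄
  rotʳ₄ (here refl)                 = there (there (here refl))
  rotʳ₄ (there (here refl))         = here refl
  rotʳ₄ (there (there (here refl))) = there (here refl)

  -- Adjacent vertices have the two faces along their edge in common, and no such pair of labels
  -- occurs in both families.
  all₄ : ∀ {d} → A d ∈ rotations₄ → ∀ e → A e ∈ rotations₄
  all₄ = everywhere {λ e → A e ∈ rotations₄} (λ e m → subst (_∈ rotations₄) (sym (A-σ e)) (rot₄ m))
    (λ e m → subst (_∈ rotations₄) (sym (A-prev {αf e} refl refl)) (rotʳ₄ (across e m (type (φ e)))))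
    where
    clash : ∀ {B C} → B ∈ rotations₄ → C ∈ rotations₃ → hd C ≡ hd B → last C ≡ second B → ⊥
    clash (here refl) (here refl) _ ()
    clash (here refl) (there (here refl)) () _
    clash (here refl) (there (there (here refl))) () _
    clash (here refl) (there (there (there (here refl)))) () _
    clash (there (here refl)) (here refl) () _
    clash (there (here refl)) (there (here refl)) () _
    clash (there (here refl)) (there (there (here refl))) () _
    clash (there (here refl)) (there (there (there (here refl)))) () _
    clash (there (there (here refl))) (here refl) () _
    clash (there (there (here refl))) (there (here refl)) () _
    clash (there (there (here refl))) (there (there (here refl))) () _
    clash (there (there (here refl))) (there (there (there (here refl)))) () _
    across : ∀ e → A e ∈ rotations₄ → A (φ e) ∈ rotations₄ ⊎ A (φ e) ∈ rotations₃ → A (φ e) ∈ rotations₄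
    across e m (inj₁ q) = q
    across e m (inj₂ q) = ⊥-elim (clash m q (same e) (link e))

  -- Two large faces joined by a strip: ψ leads from a corner of one to a corner of the other.
  module Pair (c n : ℕ) (c∈ : c ∈ (3 ∷ 4 ∷ [])) (ψ : Permutation′ darts)
    (sizes : ∀ e → cap (sz e) ≡ 42 ⊎ cap (sz e) ≡ c)
    (degree : ∀ d → length (A d) ≡ n)
    (one-large : ∀ d → ∑ₗ one-if-large (A d) ≡ + 1)
    (ψ-large : ∀ x → cap (sz x) ≡ 42 → cap (sz (ψ ⟨$⟩ʳ x)) ≡ 42)
    (ψ-φ : ∀ x → cap (sz x) ≡ 42 → face (ψ ⟨$⟩ʳ (φ x)) ≡ face (ψ ⟨$⟩ʳ x))
    (separated : ∀ f → (∀ x → face x ≡ f → face (ψ ⟨$⟩ʳ x) ≡ f) → 42 ℕ.≤ size′ f → ∀ y → cap (sz y) ≡ 42 → face y ≡ f)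
    where

    -- If one corner of `f` were led back to `f`, then by `ψ-φ` all of them would be, and
    -- `separated` would place every large corner on `f`, including those of `h`.
    crosses : ∀ f h → f ≢ h → 42 ℕ.≤ size′ f → 42 ℕ.≤ size′ h → (∀ k → 42 ℕ.≤ size′ k → k ≡ f ⊎ k ≡ h) →
              ∀ x → face x ≡ f → face (ψ ⟨$⟩ʳ x) ≡ h
    crosses f h f≢h bf bh among x p = resolve (among (face (ψ ⟨$⟩ʳ x)) (cap≡42 (sz (ψ ⟨$⟩ʳ x)) (ψ-large x (large-face {x} bf p))))
      where
      y : Fin darts
      y = proj₁ (face-surj h)
      y∈ : face y ≡ h
      y∈ = proj₂ (face-surj h)
      Stays : Fin darts → Set
      Stays z = face z ≡ f × face (ψ ⟨$⟩ʳ z) ≡ f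
      step : ∀ z → Stays z → Stays (φ z)
      step z (p , q) = trans (face-φ z) p , trans (ψ-φ z (large-face {z} bf p)) q
      stay : face (ψ ⟨$⟩ʳ x) ≡ f → ∀ z → face z ≡ f → face (ψ ⟨$⟩ʳ z) ≡ f
      stay q z r = proj₂ (along-face {Stays} step {x} (p , q) z (trans p (sym r)))
      resolve : face (ψ ⟨$⟩ʳ x) ≡ f ⊎ face (ψ ⟨$⟩ʳ x) ≡ h → face (ψ ⟨$⟩ʳ x) ≡ h
      resolve (inj₂ q) = q
      resolve (inj₁ q) = ⊥-elim (f≢h (trans (sym (separated f (stay q) bf y (large-face {y} bh y∈))) y∈))

    size-sum : ∀ f → + size′ f ≡ sum (λ d → if does (face d Finₚ.≟ f) then + 1 else 0ℤ)
    size-sum f = trans (sym (trans (∑ₗ-const half (+ 1) (FO.fibre f)) (ℤₚ.*-identityʳ (+ size′ f))))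
      (trans (∑ₗ-filter (λ d → face d Finₚ.≟ f) (λ _ → + 1) (allFin darts)) (∑-allFin (λ d → if does (face d Finₚ.≟ f) then + 1 else 0ℤ)))

    -- `ψ` permutes the darts and carries those of `f` into those of `h`; compare the sums of the
    -- two indicators.
    size-≤ : ∀ f h → (∀ x → face x ≡ f → face (ψ ⟨$⟩ʳ x) ≡ h) → size′ f ℕ.≤ size′ h
    size-≤ f h cross = ℤₚ.drop‿+≤+ (subst₂ ℤ._≤_ (sym (size-sum f))
        (trans (sym (sum-permute (λ d → if does (face d Finₚ.≟ h) then + 1 else 0ℤ) ψ)) (sym (size-sum h))) (sum-mono pointwise))
      where
      pointwise : ∀ d → (if does (face d Finₚ.≟ f) then + 1 else 0ℤ) ℤ.≤ (if does (face (ψ ⟨$⟩ʳ d) Finₚ.≟ h) then + 1 else 0ℤ)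
      pointwise d with face d Finₚ.≟ f
      ... | yes p = ℤₚ.≤-reflexive (cong (λ b → if b then + 1 else 0ℤ) (sym (dec-true (face (ψ ⟨$⟩ʳ d) Finₚ.≟ h) (cross d p))))
      ... | no _ with does (face (ψ ⟨$⟩ʳ d) Finₚ.≟ h)
      ...   | true  = ℤ.+≤+ z≤n
      ...   | false = ℤₚ.≤-refl

    N : ℕ
    N = size′ f₀

    N≡ : size′ g₀ ≡ N
    N≡ = ℕₚ.≤-antisym (size-≤ g₀ f₀ (crosses g₀ f₀ (distinct ∘ sym) big-g big-f (λ k b → Data.Sum.swap (third k b))))
                       (size-≤ f₀ g₀ (crosses f₀ g₀ distinct big-f big-g third))

    size-large : ∀ f → 42 ℕ.≤ size′ f → size′ f ≡ N
    size-large f b with third f b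
    ... | inj₁ refl = refl
    ... | inj₂ refl = N≡

    value : ℕ → ℕ
    value k = if k ≡ᵇ 42 then N else k

    value-sz : ∀ e → sz e ≡ value (cap (sz e))
    value-sz e = by (sizes e)
      where
      small : ∀ c → c ∈ (3 ∷ 4 ∷ []) → c ≡ value c
      small .3 (here refl)         = refl
      small .4 (there (here refl)) = refl
      by : cap (sz e) ≡ 42 ⊎ cap (sz e) ≡ c → sz e ≡ value (cap (sz e))
      by (inj₁ p) = trans (size-large (face e) (cap≡42 (sz e) p)) (cong value (sym p))
      by (inj₂ p) = trans (exactly c c∈ (sz e) (sz≥3 e) p) (trans (small c c∈) (cong value (sym p)))

    faceVec↭ : ∀ d → faceVec (vert d) ↭ map value (A d)
    faceVec↭ d = subst (faceVec (vert d) ↭_) corner≡ (↭-sym (corner↭ d))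
      where
      corner≡ : corner d ≡ map value (A d)
      corner≡ = trans (go (λ i → iter σf i d) (dg d)) (sym (Listₚ.map-applyUpTo (λ i → cap (sz (iter σf i d))) value (dg d)))
        where
        go : ∀ (h : ℕ → Fin darts) k → applyUpTo (λ i → sz (h i)) k ≡ applyUpTo (λ i → value (cap (sz (h i)))) k
        go h zero    = refl
        go h (suc k) = cong₂ _∷_ (value-sz (h 0)) (go (h ∘ suc) k)

    darts≡ : darts ≡ V ℕ.* n
    darts≡ = ℤₚ.+-injective (trans (sym (trans (∑-const darts (+ 1)) (ℤₚ.*-identityʳ (+ darts))))
      (trans (sym (∑-fibres vert (λ _ → + 1))) (trans (sum-cong-≗ {V} λ v → at v (vert-surj v)) (trans (∑-const V (+ n)) (sym (ℤₚ.pos-* V n))))))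
      where
      at : ∀ v → (∃ λ d → vert d ≡ v) → ∑ₗ (λ _ → + 1) (dartsAt v) ≡ + n
      at .(vert d) (d , refl) = trans (∑ₗ-const half (+ 1) (dartsAt (vert d))) (trans (ℤₚ.*-identityʳ (+ dg d))
        (cong +_ (trans (sym (Listₚ.length-applyUpTo (λ i → cap (sz (iter σf i d))) (dg d))) (degree d))))

    -- Each vertex has exactly one large corner, so the vertices are counted by the corners of `f₀`
    -- and `g₀`.
    V≡ : V ≡ 2 ℕ.* N
    V≡ = ℤₚ.+-injective (begin
      + V                                       ≡⟨ sym (trans (∑-const V (+ 1)) (ℤₚ.*-identityʳ (+ V))) ⟩
      sum {V} (λ _ → + 1)                       ≡⟨ sum-cong-≗ {V} (λ v → at v (vert-surj v)) ⟩
      sum (λ v → ∑ₗ L (dartsAt v))              ≡⟨ ∑-fibres vert L ⟩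
      sum L                                     ≡⟨ sum-cong-≗ {darts} split ⟩
      sum (λ d → I f₀ d ℤ.+ I g₀ d)             ≡⟨ ∑-distrib-+ (I f₀) (I g₀) ⟩
      sum (I f₀) ℤ.+ sum (I g₀)                 ≡⟨ cong₂ ℤ._+_ (sym (size-sum f₀)) (trans (sym (size-sum g₀)) (cong +_ N≡)) ⟩
      + N ℤ.+ + N                               ≡⟨ sym (ℤₚ.pos-+ N N) ⟩
      + (N ℕ.+ N)                               ≡⟨ cong (λ t → + (N ℕ.+ t)) (sym (ℕₚ.+-identityʳ N)) ⟩
      + (2 ℕ.* N)                               ∎)
      where
      open ≡-Reasoning
      L : Fin darts → ℤ
      L d = one-if-large (cap (sz d))
      I : Fin F → Fin darts → ℤ
      I f d = if does (face d Finₚ.≟ f) then + 1 else 0ℤ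
      ∑ₗ-map″ : ∀ ds → ∑ₗ (one-if-large ∘ cap) (map sz ds) ≡ ∑ₗ L ds
      ∑ₗ-map″ []       = refl
      ∑ₗ-map″ (d ∷ ds) = cong (ℤ._+_ (L d)) (∑ₗ-map″ ds)
      at : ∀ v → (∃ λ d → vert d ≡ v) → + 1 ≡ ∑ₗ L (dartsAt v)
      at .(vert d) (d , refl) = trans (sym (one-large d)) (trans (cong (∑ₗ one-if-large) (A≡ d)) (trans (∑ₗ-map′ one-if-large cap (corner d))
        (trans (∑ₗ-↭ (one-if-large ∘ cap) (corner↭ d)) (∑ₗ-map″ (dartsAt (vert d))))))
      c≢42 : ∀ c → c ∈ (3 ∷ 4 ∷ []) → ¬ (42 ≡ c)
      c≢42 .3 (here refl) ()
      c≢42 .4 (there (here refl)) ()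
      one-c : ∀ c → c ∈ (3 ∷ 4 ∷ []) → one-if-large c ≡ 0ℤ
      one-c .3 (here refl)         = refl
      one-c .4 (there (here refl)) = refl
      I-yes : ∀ {f d} → face d ≡ f → I f d ≡ + 1
      I-yes {f} {d} p = cong (λ b → if b then + 1 else 0ℤ) (dec-true (face d Finₚ.≟ f) p)
      I-no : ∀ {f d} → face d ≢ f → I f d ≡ 0ℤ
      I-no {f} {d} p = cong (λ b → if b then + 1 else 0ℤ) (dec-false (face d Finₚ.≟ f) p)
      split : ∀ d → L d ≡ I f₀ d ℤ.+ I g₀ d
      split d = by (sizes d)
        where
        by : cap (sz d) ≡ 42 ⊎ cap (sz d) ≡ c → L d ≡ I f₀ d ℤ.+ I g₀ d
        by (inj₂ p) = trans (trans (cong one-if-large p) (one-c c c∈)) (sym (cong₂ ℤ._+_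
              (I-no {f₀} {d} λ q → c≢42 c c∈ (trans (sym (large-face {d} big-f q)) p)) (I-no {g₀} {d} λ q → c≢42 c c∈ (trans (sym (large-face {d} big-g q)) p))))
        by (inj₁ p) = trans (cong one-if-large p) (sym (which (third (face d) (cap≡42 (sz d) p))))
          where
          which : face d ≡ f₀ ⊎ face d ≡ g₀ → I f₀ d ℤ.+ I g₀ d ≡ + 1
          which (inj₁ q) = cong₂ ℤ._+_ (I-yes {f₀} {d} q) (I-no {g₀} {d} (λ r → distinct (trans (sym q) r)))
          which (inj₂ q) = cong₂ ℤ._+_ (I-no {f₀} {d} (λ r → distinct (trans (sym r) q))) (I-yes {g₀} {d} q)

    rest : List (Fin F)
    rest = filter (λ f → ¬? (f Finₚ.≟ f₀) ×-dec ¬? (f Finₚ.≟ g₀)) (allFin F)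

    rest-∈ : ∀ {f} → f ∈ rest → f ≢ f₀ × f ≢ g₀
    rest-∈ m = proj₂ (∈-filter⁻ (λ f → ¬? (f Finₚ.≟ f₀) ×-dec ¬? (f Finₚ.≟ g₀)) {xs = allFin F} m)

    faces↭ : allFin F ↭ f₀ ∷ g₀ ∷ rest
    faces↭ = unique⇒↭ (Uniqueₚ.allFin⁺ F)
      ((distinct ∷ All.tabulate (λ m e → proj₁ (rest-∈ m) (sym e))) ∷ (All.tabulate (λ m e → proj₂ (rest-∈ m) (sym e)) ∷ Uniqueₚ.filter⁺ (λ f → ¬? (f Finₚ.≟ f₀) ×-dec ¬? (f Finₚ.≟ g₀)) (Uniqueₚ.allFin⁺ F)))
      (λ {f} _ → place f) (λ {f} _ → ∈-allFin f)
      where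
      place : ∀ f → f ∈ (f₀ ∷ g₀ ∷ rest)
      place f = by (f Finₚ.≟ f₀) (f Finₚ.≟ g₀)
        where
        by : Dec (f ≡ f₀) → Dec (f ≡ g₀) → f ∈ (f₀ ∷ g₀ ∷ rest)
        by (yes p) _       = here p
        by (no _)  (yes q) = there (here q)
        by (no p)  (no q)  = there (there (∈-filter⁺ (λ f → ¬? (f Finₚ.≟ f₀) ×-dec ¬? (f Finₚ.≟ g₀)) (∈-allFin f) (p , q)))

    size-rest : ∀ {f} → f ∈ rest → size′ f ≡ c
    size-rest {f} m = at f (face-surj f) (rest-∈ m)
      where
      at : ∀ f → (∃ λ d → face d ≡ f) → f ≢ f₀ × f ≢ g₀ → size′ f ≡ c
      at .(face d) (d , refl) (p , q) = by (sizes d)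
        where
        by : cap (sz d) ≡ 42 ⊎ cap (sz d) ≡ c → sz d ≡ c
        by (inj₂ e) = exactly c c∈ (sz d) (sz≥3 d) e
        by (inj₁ e) = ⊥-elim (Data.Sum.[ p , q ] (third (face d) (cap≡42 (sz d) e)))

    faceSizes↭ : ∀ k → F ≡ suc (suc k) → faceSizes ↭ N ∷ N ∷ replicate k c
    faceSizes↭ k e = subst (faceSizes ↭_) (cong₂ (λ a b → N ∷ a ∷ b) N≡ (trans (go rest size-rest) (cong (λ l → replicate l c) length≡))) (map⁺ size′ faces↭)
      where
      go : ∀ fs → (∀ {f} → f ∈ fs → size′ f ≡ c) → map size′ fs ≡ replicate (length fs) c
      go []       h = refl
      go (f ∷ fs) h = cong₂ _∷_ (h (here refl)) (go fs (h ∘ there))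
      length≡ : length rest ≡ k
      length≡ = ℕₚ.suc-injective (ℕₚ.suc-injective (trans (sym (↭-length faces↭)) (trans (Listₚ.length-tabulate (λ i → i)) e)))

  prism : (∀ d → A d ∈ rotations₄) → IsPrism M
  prism all-A = N , V≡ , faceSizes↭ N F≡ , λ v → vec v (vert-surj v)
    where
    Ax : ∀ x → cap (sz x) ≡ 42 → A x ≡ 42 ∷ 4 ∷ 4 ∷ []
    Ax x p = pick (all-A x) (trans (A-hd x) p)
      where
      pick : ∀ {B} → B ∈ rotations₄ → hd B ≡ 42 → B ≡ 42 ∷ 4 ∷ 4 ∷ []
      pick (here e) _ = e
      pick (there (here refl)) ()
      pick (there (there (here refl))) ()
    Aq : ∀ x → cap (sz x) ≡ 42 → A (φ (σf x)) ≡ 4 ∷ 42 ∷ 4 ∷ []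
    Aq x p = pick (all-A (φ (σf x))) (trans (same (σf x)) (cong hd Am)) (trans (link (σf x)) (cong second Am))
      where
      Am : A (σf x) ≡ 4 ∷ 4 ∷ 42 ∷ []
      Am = A-next refl (Ax x p)
      pick : ∀ {B} → B ∈ rotations₄ → hd B ≡ 4 → last B ≡ 4 → B ≡ 4 ∷ 42 ∷ 4 ∷ []
      pick (here refl) () _
      pick (there (here refl)) _ ()
      pick (there (there (here e))) _ _ = e
    ψ-large : ∀ x → cap (sz x) ≡ 42 → cap (sz (ψ₄ x)) ≡ 42
    ψ-large x p = trans (sym (A-hd (ψ₄ x))) (cong hd (A-next refl (Aq x p)))
    separated : ∀ f → (∀ x → face x ≡ f → face (ψ₄ x) ≡ f) → 42 ℕ.≤ size′ f → ∀ y → cap (sz y) ≡ 42 → face y ≡ f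
    separated f stay b y p = locate (closure₄ f (λ x q → Ax x (large-face {x} b q) , Aq x (large-face {x} b q) , stay x q) (proj₂ (face-surj f)) y)
      where
      small≢42 : ¬ (4 ≡ 42)
      small≢42 ()
      locate : On₄ f y → face y ≡ f
      locate (x , q , inj₁ refl)        = q
      locate (x , q , inj₂ (inj₁ refl)) = ⊥-elim (small≢42 (trans (sym (cong hd (A-next refl (Ax x (large-face {x} b q))))) (trans (A-hd y) p)))
      locate (x , q , inj₂ (inj₂ refl)) = ⊥-elim (small≢42 (trans (sym (cong hd (A-next refl (A-next refl (Ax x (large-face {x} b q)))))) (trans (A-hd y) p)))
    one-large : ∀ {B} → B ∈ rotations₄ → ∑ₗ one-if-large B ≡ + 1
    one-large (here refl)                 = refl
    one-large (there (here refl))         = refl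
    one-large (there (there (here refl))) = refl
    degree : ∀ {B} → B ∈ rotations₄ → length B ≡ 3
    degree (here refl)                 = refl
    degree (there (here refl))         = refl
    degree (there (there (here refl))) = refl
    -- `∘ₚ` applies its left factor first, so this permutation is `ψ₄`.
    open Pair 4 3 (there (here refl)) (σ ∘ₚ α ∘ₚ σ ∘ₚ σ) (λ e → sizes-of {e} (proj₂ (zero₄ (all-A e)))) (degree ∘ all-A) (one-large ∘ all-A)
      ψ-large (λ x p → trans (sym (face-φ (ψ₄ (φ x)))) (cong face (Square.opposite (Ax x p) (Aq x p)))) separated
    -- Euler's formula with `2 * N` vertices of degree three.
    F≡ : F ≡ suc (suc N)
    F≡ = ℕₚ.*-cancelˡ-≡ F (2 ℕ.+ N) 2 (ℕₚ.+-cancelˡ-≡ (2 ℕ.* V) (2 ℕ.* F) (2 ℕ.* (2 ℕ.+ N)) (trans spherical (trans (cong (ℕ._+ 4) (trans darts≡ (cong (ℕ._* 3) V≡)))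
      (trans (arith N) (cong (λ t → 2 ℕ.* t ℕ.+ 2 ℕ.* (2 ℕ.+ N)) (sym V≡))))))
      where
      arith : ∀ N → 2 ℕ.* N ℕ.* 3 ℕ.+ 4 ≡ 2 ℕ.* (2 ℕ.* N) ℕ.+ 2 ℕ.* (2 ℕ.+ N)
      arith = solve 1 (λ n → con 2 :* n :* con 3 :+ con 4 := con 2 :* (con 2 :* n) :+ con 2 :* (con 2 :+ n)) refl
        where open import Data.Nat.Solver using (module +-*-Solver)
              open +-*-Solver
    vec : ∀ v → (∃ λ d → vert d ≡ v) → faceVec v ↭ 4 ∷ 4 ∷ N ∷ []
    vec .(vert d) (d , refl) = ↭-trans (faceVec↭ d) (arrange (all-A d))
      where
      arrange : ∀ {B} → B ∈ rotations₄ → map value B ↭ 4 ∷ 4 ∷ N ∷ []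
      arrange (here refl)                 = ∷↭∷ʳ N (4 ∷ 4 ∷ [])
      arrange (there (here refl))         = ↭-refl
      arrange (there (there (here refl))) = prep 4 (swap N 4 ↭-refl)

  antiprism : (∀ d → A d ∈ rotations₃) → IsAntiprism M
  antiprism all-A = N , V≡ , faceSizes↭ (2 ℕ.* N) F≡ , λ v → vec v (vert-surj v)
    where
    Ax : ∀ x → cap (sz x) ≡ 42 → A x ≡ 42 ∷ 3 ∷ 3 ∷ 3 ∷ []
    Ax x p = pick (all-A x) (trans (A-hd x) p)
      where
      pick : ∀ {B} → B ∈ rotations₃ → hd B ≡ 42 → B ≡ 42 ∷ 3 ∷ 3 ∷ 3 ∷ []
      pick (here e) _ = e
      pick (there (here refl)) ()
      pick (there (there (here refl))) ()
      pick (there (there (there (here refl)))) ()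
    Ad : ∀ x → cap (sz x) ≡ 42 → A (σf (σf x)) ≡ 3 ∷ 3 ∷ 42 ∷ 3 ∷ []
    Ad x p = A-next refl (A-next refl (Ax x p))
    Aq : ∀ x → cap (sz x) ≡ 42 → A (φ (σf (σf x))) ≡ 3 ∷ 42 ∷ 3 ∷ 3 ∷ []
    Aq x p = pick (all-A (φ d)) (λ e → no-twin d (Ad x p) e) (trans (same d) (cong hd (Ad x p))) (trans (link d) (cong second (Ad x p)))
      where
      d : Fin darts
      d = σf (σf x)
      pick : ∀ {B} → B ∈ rotations₃ → ¬ (B ≡ 3 ∷ 3 ∷ 42 ∷ 3 ∷ []) → hd B ≡ 3 → last B ≡ 3 → B ≡ 3 ∷ 42 ∷ 3 ∷ 3 ∷ []
      pick (here refl) _ () _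
      pick (there (here refl)) _ _ ()
      pick (there (there (here e))) n _ _ = ⊥-elim (n e)
      pick (there (there (there (here e)))) _ _ _ = e
    ψ-large : ∀ x → cap (sz x) ≡ 42 → cap (sz (ψ₃ x)) ≡ 42
    ψ-large x p = trans (sym (A-hd (ψ₃ x))) (cong hd (A-next refl (Aq x p)))
    separated : ∀ f → (∀ x → face x ≡ f → face (ψ₃ x) ≡ f) → 42 ℕ.≤ size′ f → ∀ y → cap (sz y) ≡ 42 → face y ≡ f
    separated f stay b y p = locate (closure₃ f (λ x q → Ax x (large-face {x} b q) , Aq x (large-face {x} b q) , stay x q) (proj₂ (face-surj f)) y)
      where
      small≢42 : ¬ (3 ≡ 42)
      small≢42 ()
      locate : On₃ f y → face y ≡ f
      locate (x , q , inj₁ refl) = q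
      locate (x , q , inj₂ (inj₁ refl)) = ⊥-elim (small≢42 (trans (sym (cong hd (A-next refl (Ax x (large-face {x} b q))))) (trans (A-hd y) p)))
      locate (x , q , inj₂ (inj₂ (inj₁ refl))) = ⊥-elim (small≢42 (trans (sym (cong hd (Ad x (large-face {x} b q)))) (trans (A-hd y) p)))
      locate (x , q , inj₂ (inj₂ (inj₂ refl))) = ⊥-elim (small≢42 (trans (sym (cong hd (A-next refl (Ad x (large-face {x} b q))))) (trans (A-hd y) p)))
    one-large : ∀ {B} → B ∈ rotations₃ → ∑ₗ one-if-large B ≡ + 1
    one-large (here refl)                         = refl
    one-large (there (here refl))                 = refl
    one-large (there (there (here refl)))         = refl
    one-large (there (there (there (here refl)))) = refl
    degree : ∀ {B} → B ∈ rotations₃ → length B ≡ 4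
    degree (here refl)                         = refl
    degree (there (here refl))                 = refl
    degree (there (there (here refl)))         = refl
    degree (there (there (there (here refl)))) = refl
    open Pair 3 4 (here refl) (σ ∘ₚ σ ∘ₚ α ∘ₚ σ ∘ₚ σ) (λ e → sizes-of {e} (proj₂ (zero₃ (all-A e)))) (degree ∘ all-A) (one-large ∘ all-A)
      ψ-large (λ x p → trans (sym (face-φ (ψ₃ (φ x)))) (cong face (Strip.opposite (Ax x p) (cong second (Aq x p))))) separated
    F≡ : F ≡ suc (suc (2 ℕ.* N))
    F≡ = ℕₚ.*-cancelˡ-≡ F (2 ℕ.+ 2 ℕ.* N) 2 (ℕₚ.+-cancelˡ-≡ (2 ℕ.* V) (2 ℕ.* F) (2 ℕ.* (2 ℕ.+ 2 ℕ.* N)) (trans spherical (trans (cong (ℕ._+ 4) (trans darts≡ (cong (ℕ._* 4) V≡)))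
      (trans (arith N) (cong (λ t → 2 ℕ.* t ℕ.+ 2 ℕ.* (2 ℕ.+ 2 ℕ.* N)) (sym V≡))))))
      where
      arith : ∀ N → 2 ℕ.* N ℕ.* 4 ℕ.+ 4 ≡ 2 ℕ.* (2 ℕ.* N) ℕ.+ 2 ℕ.* (2 ℕ.+ 2 ℕ.* N)
      arith = solve 1 (λ n → con 2 :* n :* con 4 :+ con 4 := con 2 :* (con 2 :* n) :+ con 2 :* (con 2 :+ con 2 :* n)) refl
        where open import Data.Nat.Solver using (module +-*-Solver)
              open +-*-Solver
    vec : ∀ v → (∃ λ d → vert d ≡ v) → faceVec v ↭ 3 ∷ 3 ∷ 3 ∷ N ∷ []
    vec .(vert d) (d , refl) = ↭-trans (faceVec↭ d) (arrange (all-A d))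
      where
      arrange : ∀ {B} → B ∈ rotations₃ → map value B ↭ 3 ∷ 3 ∷ 3 ∷ N ∷ []
      arrange (here refl)                         = ∷↭∷ʳ N (3 ∷ 3 ∷ 3 ∷ [])
      arrange (there (here refl))                 = ↭-refl
      arrange (there (there (here refl)))         = prep 3 (prep 3 (swap N 3 ↭-refl))
      arrange (there (there (there (here refl)))) = prep 3 (∷↭∷ʳ N (3 ∷ 3 ∷ []))

  prism-or-antiprism : IsPrism M ⊎ IsAntiprism M
  prism-or-antiprism = decide (type x₀)
    where
    x₀ : Fin darts
    x₀ = proj₁ (face-surj f₀)
    clash : ∀ {B} → B ∈ rotations₄ → B ∈ rotations₃ → ⊥
    clash (here refl) (there (there (there (there ()))))
    clash (there (here refl)) (there (there (there (there ()))))
    clash (there (there (here refl))) (there (there (there (there ()))))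
    three : A x₀ ∈ rotations₃ → ∀ e → A e ∈ rotations₄ ⊎ A e ∈ rotations₃ → A e ∈ rotations₃
    three m e (inj₂ q) = q
    three m e (inj₁ q) = ⊥-elim (clash (all₄ q x₀) m)
    decide : A x₀ ∈ rotations₄ ⊎ A x₀ ∈ rotations₃ → IsPrism M ⊎ IsAntiprism M
    decide (inj₁ m) = inj₁ (prism (all₄ m))
    decide (inj₂ m) = inj₂ (antiprism λ e → three m e (type e))

-- All faces of size at most 85: the tables and the bound on the average.

data Table : Set where
  leaf : Table
  node : ℕ → ℤ → Table → Table → Table

find : Table → ℕ → ℤ
find leaf           k = 0ℤ
find (node j v l r) k = if k ≡ᵇ j then v else if k <ᵇ j then find l k else find r k

-- Base 128 suffices, as entries are at most 42 + 64.
code : State → ℕ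
code = foldr (λ e r → e ℕ.+ 128 ℕ.* r) 0

mirrored : List ℕ → List ℕ
mirrored []      = []
mirrored (c ∷ A) = c ∷ reverse A

-- Reversing the orientation moves the mark of a dart to the corner on its other side.
mirror : State → State
mirror X = zipWith ℕ._+_ (mirrored (lab X)) (reverse (map (λ e → e ℕ.∸ e % 64) X))

cubes : List ℕ → ℕ
cubes = foldr (λ c s → c ℕ.* c ℕ.* c ℕ.+ s) 0

-- The vertex types that occur in transfers, recognised by the sum of the cubes of their labels.
known : List ℕ → Bool
known A = any (_≡ᵇ cubes A) (280 ∷ 522 ∷ 1118 ∷ 1449 ∷ 1611 ∷ 2278 ∷ 2689 ∷ 3555 ∷ 7048 ∷ 64081 ∷ 64370 ∷ 69002 ∷ 69291 ∷ 74169 ∷ [])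

-- A vertex of the first type recognises a neighbour of the second type along its first dart.
seen : List (List ℕ × List ℕ)
seen = (3 ∷ 4 ∷ 3 ∷ 11 ∷ [] , 3 ∷ 11 ∷ 3 ∷ 4 ∷ []) ∷
  (3 ∷ 4 ∷ 11 ∷ 3 ∷ [] , 3 ∷ 3 ∷ 11 ∷ 4 ∷ []) ∷
  (3 ∷ 40 ∷ 3 ∷ 3 ∷ [] , 3 ∷ 3 ∷ 3 ∷ 40 ∷ []) ∷
  (3 ∷ 41 ∷ 3 ∷ 3 ∷ [] , 3 ∷ 3 ∷ 3 ∷ 41 ∷ []) ∷
  (3 ∷ 42 ∷ 3 ∷ 3 ∷ [] , 3 ∷ 3 ∷ 3 ∷ 42 ∷ []) ∷
  (4 ∷ 3 ∷ 3 ∷ 11 ∷ [] , 4 ∷ 11 ∷ 3 ∷ 3 ∷ []) ∷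
  (4 ∷ 3 ∷ 11 ∷ 3 ∷ [] , 4 ∷ 3 ∷ 11 ∷ 3 ∷ []) ∷
  (4 ∷ 11 ∷ 3 ∷ 3 ∷ [] , 4 ∷ 6 ∷ 11 ∷ []) ∷
  (11 ∷ 4 ∷ 3 ∷ 3 ∷ [] , 11 ∷ 6 ∷ 4 ∷ []) ∷
  (40 ∷ 3 ∷ 3 ∷ 3 ∷ [] , 40 ∷ 3 ∷ 3 ∷ 3 ∷ []) ∷
  (41 ∷ 3 ∷ 3 ∷ 3 ∷ [] , 41 ∷ 3 ∷ 3 ∷ 3 ∷ []) ∷
  (42 ∷ 3 ∷ 3 ∷ 3 ∷ [] , 42 ∷ 3 ∷ 3 ∷ 3 ∷ []) ∷ []

-- The solution of a linear program, in units of 1 / (17280 · 720720).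
shares : Table
shares =
  (node 82563 (+ 171737280) (node 50563 (+ 135799200) (node 49929 (+ 994800564) (node 49681 (+ 1553018328) (node 49575 (+ 2247410880) (node 49547 (+
  2816510400) (node 49543 (+ 3547938240) (node 49541 (+ 4498528320) (node 49540 (+ 4875382080) (node 49539 (+ 2035756800) leaf leaf) leaf) (node 49542 (+
  3434650560) leaf leaf)) (node 49545 (+ 3220060248) (node 49544 (+ 3304259280) leaf leaf) (node 49546 (+ 3253124160) leaf leaf))) (node 49553 (+
  2702527920) (node 49550 (+ 2672809920) (node 49549 (+ 2845972800) (node 49548 (+ 2912736960) leaf leaf) leaf) (node 49552 (+ 2748319920) leaf leaf))
  (node 49555 (+ 2614476960) (node 49554 (+ 2661833520) leaf leaf) (node 49559 (+ 2511411120) leaf leaf)))) (node 49672 (+ 2382109992) (node 49668 (+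
  1982557440) (node 49578 (+ 2154237120) (node 49577 (+ 1711765440) (node 49576 (+ 2199225600) leaf leaf) leaf) (node 49667 (+ 97025760) leaf leaf))
  (node 49670 (+ 2606473872) (node 49669 (+ 3203893440) leaf leaf) (node 49671 (+ 2616523632) leaf leaf))) (node 49676 (+ 1852816320) (node 49674 (+
  2051723520) (node 49673 (+ 2275822836) leaf leaf) (node 49675 (+ 1744220160) leaf leaf)) (node 49678 (+ 1676672640) (node 49677 (+ 1726341120) leaf
  leaf) (node 49680 (+ 1598810328) leaf leaf))))) (node 49805 (+ 1142547120) (node 49796 (+ 79856640) (node 49704 (+ 1101680208) (node 49687 (+
  1361901528) (node 49683 (+ 1481362848) (node 49682 (+ 1512323928) leaf leaf) leaf) (node 49703 (+ 1129764528) leaf leaf)) (node 49706 (+ 933282288)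
  (node 49705 (+ 1037860848) leaf leaf) (node 49795 (-[1+ 25898399 ]) leaf leaf))) (node 49801 (+ 1643284116) (node 49799 (+ 2067785280) (node 49798 (+
  2215382400) (node 49797 (+ 1307227680) leaf leaf) leaf) (node 49800 (+ 1799109720) leaf leaf)) (node 49803 (+ 1325389680) (node 49802 (+ 1380313440)
  leaf leaf) (node 49804 (+ 1241269560) leaf leaf)))) (node 49833 (+ 420860880) (node 49811 (+ 808063920) (node 49809 (+ 886383720) (node 49808 (+
  932175720) (node 49806 (+ 1048837680) leaf leaf) leaf) (node 49810 (+ 845689320) leaf leaf)) (node 49831 (+ 512764560) (node 49815 (+ 744901560) leaf
  leaf) (node 49832 (+ 484680240) leaf leaf))) (node 49925 (+ 9836640) (node 49923 (+ 298473120) (node 49834 (+ 316282320) leaf leaf) (node 49924 (+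
  199630080) leaf leaf)) (node 49927 (+ 1275294240) (node 49926 (+ 705576960) leaf leaf) (node 49928 (+ 1101087720) leaf leaf)))))) (node 50181 (+
  48708000) (node 50055 (+ 266729760) (node 49939 (+ 768966480) (node 49934 (+ 1003075920) (node 49932 (+ 1156803480) (node 49931 (+ 750444840) (node
  49930 (+ 831956400) leaf leaf) leaf) (node 49933 (+ 1063546200) leaf leaf)) (node 49937 (+ 851552280) (node 49936 (+ 897344280) leaf leaf) (node 49938
  (+ 810857880) leaf leaf))) (node 49962 (+ 299151360) (node 49960 (+ 460421280) (node 49959 (+ 448303680) (node 49943 (+ 660435480) leaf leaf) leaf)
  (node 49961 (+ 396601920) leaf leaf)) (node 50052 (+ 46592640) (node 50051 (+ 93566880) leaf leaf) (node 50053 (+ 2138400) leaf leaf)))) (node 50065 (+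
  392318280) (node 50060 (+ 703034640) (node 50058 (+ 690726960) (node 50057 (+ 790654524) (node 50056 (+ 970788600) leaf leaf) leaf) (node 50059 (+
  614680560) leaf leaf)) (node 50062 (+ 554772240) (node 50061 (+ 598847040) leaf leaf) (node 50064 (+ 438110280) leaf leaf))) (node 50088 (+ 12117600)
  (node 50067 (+ 320662800) (node 50066 (+ 351623880) leaf leaf) (node 50071 (+ 201201480) leaf leaf)) (node 50179 (+ 104209560) (node 50089 (+ 60730560)
  leaf leaf) (node 50180 (+ 46592640) leaf leaf))))) (node 50313 (+ 255556044) (node 50192 (+ 236908800) (node 50187 (+ 378508680) (node 50185 (+
  617399244) (node 50184 (+ 361843200) (node 50183 (-[1+ 1758239 ]) leaf leaf) leaf) (node 50186 (+ 454555080) leaf leaf)) (node 50189 (+ 397645560)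
  (node 50188 (+ 490902840) leaf leaf) (node 50190 (+ 342640440) leaf leaf))) (node 50307 (+ 59822676) (node 50194 (+ 150422400) (node 50193 (+
  191116800) leaf leaf) (node 50195 (+ 108531000) leaf leaf)) (node 50309 (+ 9836640) (node 50308 (+ 46592640) leaf leaf) (node 50311 (+ 66623520) leaf
  leaf)))) (node 50436 (+ 46592640) (node 50318 (+ 128543985) (node 50316 (+ 276806385) (node 50315 (+ 286853193) (node 50314 (+ 362899593) leaf leaf)
  leaf) (node 50317 (+ 183549105) leaf leaf)) (node 50321 (-[1+ 28444814 ]) (node 50320 (+ 17347185) leaf leaf) (node 50435 (-[1+ 25898399 ]) leaf
  leaf))) (node 50442 (+ 87246720) (node 50439 (-[1+ 1758239 ]) (node 50437 (+ 48708000) leaf leaf) (node 50441 (-[1+ 20096828 ]) leaf leaf)) (node 50444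
  (+ 102430080) (node 50443 (+ 65053440) leaf leaf) (node 50445 (-[1+ 43813439 ]) leaf leaf))))))) (node 66059 (+ 1012435200) (node 51460 (+ 46592640)
  (node 50827 (-[1+ 8758079 ]) (node 50693 (-[1+ 926639 ]) (node 50571 (+ 11200320) (node 50567 (-[1+ 1758239 ]) (node 50565 (-[1+ 926639 ]) (node 50564
  (+ 106467840) leaf leaf) leaf) (node 50569 (-[1+ 20096828 ]) leaf leaf)) (node 50691 (+ 40511520) (node 50573 (-[1+ 59780159 ]) leaf leaf) (node 50692
  (+ 46592640) leaf leaf))) (node 50820 (+ 46592640) (node 50699 (-[1+ 2128319 ]) (node 50697 (-[1+ 20096828 ]) (node 50695 (-[1+ 1758239 ]) leaf leaf)
  leaf) (node 50819 (+ 33976800) leaf leaf)) (node 50823 (-[1+ 1758239 ]) (node 50821 (-[1+ 926639 ]) leaf leaf) (node 50825 (-[1+ 20096828 ]) leaf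
  leaf)))) (node 51207 (-[1+ 1758239 ]) (node 50953 (-[1+ 20096828 ]) (node 50949 (+ 48708000) (node 50948 (+ 46592640) (node 50947 (+ 86343840) leaf
  leaf) leaf) (node 50951 (-[1+ 1758239 ]) leaf leaf)) (node 51204 (+ 46592640) (node 51203 (-[1+ 7009559 ]) leaf leaf) (node 51205 (+ 48708000) leaf
  leaf))) (node 51333 (+ 48708000) (node 51331 (-[1+ 7009559 ]) (node 51209 (-[1+ 20096828 ]) leaf leaf) (node 51332 (+ 46592640) leaf leaf)) (node 51337
  (-[1+ 20096828 ]) (node 51335 (-[1+ 1758239 ]) leaf leaf) (node 51459 (-[1+ 7009559 ]) leaf leaf))))) (node 54277 (-[1+ 926639 ]) (node 52101 (-[1+
  926639 ]) (node 51589 (+ 55372320) (node 51587 (-[1+ 1544399 ]) (node 51463 (-[1+ 1758239 ]) (node 51461 (+ 48708000) leaf leaf) leaf) (node 51588 (+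
  46592640) leaf leaf)) (node 52099 (-[1+ 7009559 ]) (node 51591 (-[1+ 1758239 ]) leaf leaf) (node 52100 (+ 46592640) leaf leaf))) (node 54149 (-[1+
  926639 ]) (node 54147 (+ 13923360) (node 52103 (-[1+ 1758239 ]) leaf leaf) (node 54148 (+ 46592640) leaf leaf)) (node 54275 (+ 34024320) (node 54151
  (-[1+ 1758239 ]) leaf leaf) (node 54276 (+ 46592640) leaf leaf)))) (node 66051 (+ 66481920) (node 54407 (-[1+ 1758239 ]) (node 54404 (+ 46592640) (node
  54403 (+ 273952800) (node 54279 (-[1+ 1758239 ]) leaf leaf) leaf) (node 54405 (-[1+ 926639 ]) leaf leaf)) (node 54532 (+ 46592640) (node 54531 (-[1+
  25898399 ]) leaf leaf) (node 54533 (-[1+ 926639 ]) leaf leaf))) (node 66055 (+ 1659398400) (node 66053 (+ 2371057920) (node 66052 (+ 997920000) leaf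
  leaf) (node 66054 (+ 1955923200) leaf leaf)) (node 66057 (+ 1264032000) (node 66056 (+ 1437004800) leaf leaf) (node 66058 (+ 1125653760) leaf
  leaf)))))) (node 66435 (+ 34118928) (node 66185 (+ 653019840) (node 66087 (+ 199584000) (node 66065 (+ 612835200) (node 66062 (+ 769824000) (node 66061
  (+ 838252800) (node 66060 (+ 918086400) leaf leaf) leaf) (node 66064 (+ 658627200) leaf leaf)) (node 66067 (+ 535714560) (node 66066 (+ 572140800) leaf
  leaf) (node 66071 (+ 421718400) leaf leaf))) (node 66181 (+ 870816960) (node 66090 (+ 26766720) (node 66089 (+ 183997440) (node 66088 (+ 191600640)
  leaf leaf) leaf) (node 66179 (+ 125144640) leaf leaf)) (node 66183 (+ 974160000) (node 66182 (+ 1247411520) leaf leaf) (node 66184 (+ 864864000) leaf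
  leaf)))) (node 66307 (+ 187656048) (node 66190 (+ 197683200) (node 66188 (+ 296310960) (node 66187 (+ 390659760) (node 66186 (+ 550152000) leaf leaf)
  leaf) (node 66189 (+ 216477360) leaf leaf)) (node 66193 (+ 40694400) (node 66192 (+ 86486400) leaf leaf) (node 66195 (-[1+ 29761919 ]) leaf leaf)))
  (node 66312 (+ 399168000) (node 66310 (+ 459043200) (node 66309 (+ 55906560) leaf leaf) (node 66311 (+ 621561600) leaf leaf)) (node 66314 (+ 87816960)
  (node 66313 (+ 226195200) leaf leaf) (node 66315 (-[1+ 25401599 ]) leaf leaf))))) (node 67203 (+ 103155840) (node 66693 (-[1+ 11689919 ]) (node 66563
  (+ 46138968) (node 66440 (+ 70210560) (node 66439 (+ 162518400) (node 66437 (+ 62536320) leaf leaf) leaf) (node 66441 (-[1+ 34380479 ]) leaf leaf))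
  (node 66567 (+ 32432640) (node 66565 (-[1+ 50561279 ]) leaf leaf) (node 66691 (-[1+ 20546675 ]) leaf leaf))) (node 66947 (+ 199584000) (node 66819 (+
  65174400) (node 66695 (-[1+ 35949119 ]) leaf leaf) (node 66821 (-[1+ 50561279 ]) leaf leaf)) (node 67075 (+ 56514240) (node 66949 (-[1+ 926639 ]) leaf
  leaf) (node 67077 (-[1+ 926639 ]) leaf leaf)))) (node 67845 (-[1+ 50561279 ]) (node 67589 (-[1+ 50561279 ]) (node 67333 (-[1+ 50561279 ]) (node 67331
  (+ 84395520) (node 67205 (-[1+ 926639 ]) leaf leaf) leaf) (node 67587 (+ 51061032) leaf leaf)) (node 67717 (-[1+ 50561279 ]) (node 67715 (+ 51061032)
  leaf leaf) (node 67843 (+ 51061032) leaf leaf))) (node 70531 (+ 61063632) (node 67973 (-[1+ 57225599 ]) (node 67971 (+ 45595872) leaf leaf) (node 68483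
  (+ 51061032) leaf leaf)) (node 70787 (+ 137380752) (node 70659 (+ 81164592) leaf leaf) (node 70915 (+ 84728592) leaf leaf)))))))) (node 6341509 (+
  2138400) (node 132227 (+ 127714356) (node 99203 (+ 384104160) (node 83203 (+ 111767040) (node 82693 (-[1+ 3991679 ]) (node 82568 (+ 199584000) (node
  82566 (+ 718502400) (node 82565 (+ 375217920) (node 82564 (+ 6721920) leaf leaf) leaf) (node 82567 (+ 382060800) leaf leaf)) (node 82691 (+ 145838880)
  (node 82569 (+ 26611200) leaf leaf) (node 82692 (+ 29903040) leaf leaf))) (node 82947 (+ 4321800) (node 82819 (+ 4609440) (node 82695 (+ 2851200) (node
  82694 (+ 139708800) leaf leaf) leaf) (node 82821 (+ 15966720) leaf leaf)) (node 83075 (+ 26045964) (node 82949 (-[1+ 3991679 ]) leaf leaf) (node 83077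
  (-[1+ 3991679 ]) leaf leaf)))) (node 84355 (+ 87413040) (node 83715 (+ 87413040) (node 83459 (+ 92878200) (node 83331 (+ 103106880) (node 83204 (+
  3360960) leaf leaf) leaf) (node 83587 (+ 111767040) leaf leaf)) (node 84099 (+ 92878200) (node 83971 (+ 92878200) leaf leaf) (node 84227 (+ 92878200)
  leaf leaf))) (node 87171 (+ 179197920) (node 86915 (+ 102880800) (node 84867 (+ 92878200) leaf leaf) (node 87043 (+ 122981760) leaf leaf)) (node 99075
  (+ 544769280) (node 87299 (+ 126545760) leaf leaf) (node 99077 (+ 15966720) leaf leaf))))) (node 115587 (+ 829414080) (node 100355 (-[1+ 238717079 ])
  (node 99715 (+ 261990360) (node 99459 (+ 269231436) (node 99331 (+ 335917080) (node 99205 (-[1+ 3991679 ]) leaf leaf) leaf) (node 99587 (+ 293697360)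
  leaf leaf)) (node 99971 (-[1+ 225293399 ]) (node 99843 (-[1+ 238717079 ]) leaf leaf) (node 100099 (-[1+ 233251919 ]) leaf leaf))) (node 103299 (-[1+
  248719679 ]) (node 100739 (-[1+ 233251919 ]) (node 100611 (-[1+ 238717079 ]) (node 100483 (-[1+ 238717079 ]) leaf leaf) leaf) (node 101251 (-[1+
  238717079 ]) leaf leaf)) (node 103555 (-[1+ 212604479 ]) (node 103427 (-[1+ 268820639 ]) leaf leaf) (node 103683 (-[1+ 272384639 ]) leaf leaf)))) (node
  116867 (-[1+ 74249639 ]) (node 116227 (-[1+ 79714799 ]) (node 115971 (+ 140160240) (node 115843 (+ 110229156) (node 115715 (+ 171449640) leaf leaf)
  leaf) (node 116099 (+ 102988080) leaf leaf)) (node 116483 (-[1+ 79714799 ]) (node 116355 (-[1+ 55360799 ]) leaf leaf) (node 116739 (-[1+ 74249639 ])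
  leaf leaf))) (node 119683 (-[1+ 95182559 ]) (node 117123 (-[1+ 79714799 ]) (node 116995 (-[1+ 74249639 ]) leaf leaf) (node 117635 (-[1+ 74249639 ])
  leaf leaf)) (node 119939 (-[1+ 171499679 ]) (node 119811 (-[1+ 115283519 ]) leaf leaf) (node 132099 (+ 194400000) leaf leaf)))))) (node 6341003 (+
  569099520) (node 149635 (-[1+ 30514355 ]) (node 133507 (-[1+ 91734839 ]) (node 132867 (-[1+ 91734839 ]) (node 132611 (-[1+ 91734839 ]) (node 132483 (+
  115008120) (node 132355 (+ 152180280) leaf leaf) leaf) (node 132739 (-[1+ 78311159 ]) leaf leaf)) (node 133251 (-[1+ 97199999 ]) (node 133123 (-[1+
  97199999 ]) leaf leaf) (node 133379 (-[1+ 97199999 ]) leaf leaf))) (node 148995 (-[1+ 30514355 ]) (node 148739 (+ 90959796) (node 148611 (+ 61028712)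
  (node 134019 (-[1+ 97199999 ]) leaf leaf) leaf) (node 148867 (+ 53787636) leaf leaf)) (node 149251 (-[1+ 30514355 ]) (node 149123 (-[1+ 17090675 ])
  leaf leaf) (node 149507 (-[1+ 30514355 ]) leaf leaf)))) (node 6340995 (+ 1007899200) (node 165635 (-[1+ 60445439 ]) (node 165379 (-[1+ 14613119 ])
  (node 165251 (+ 117112320) (node 165123 (+ 120890880) leaf leaf) leaf) (node 165507 (+ 51796800) leaf leaf)) (node 181763 (-[1+ 23273279 ]) (node
  181635 (+ 46546560) leaf leaf) (node 181891 (-[1+ 36696959 ]) leaf leaf))) (node 6340999 (+ 1300527360) (node 6340997 (+ 2251117440) (node 6340996 (+
  2627971200) leaf leaf) (node 6340998 (+ 1187239680) leaf leaf)) (node 6341001 (+ 972649368) (node 6341000 (+ 1056848400) leaf leaf) (node 6341002 (+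
  1005713280) leaf leaf))))) (node 6341125 (+ 1182237120) (node 6341032 (-[1+ 48185279 ]) (node 6341009 (+ 455117040) (node 6341006 (+ 425399040) (node
  6341005 (+ 718312320) (node 6341004 (+ 665326080) leaf leaf) leaf) (node 6341008 (+ 500909040) leaf leaf)) (node 6341011 (+ 367066080) (node 6341010 (+
  414422640) leaf leaf) (node 6341015 (+ 264000240) leaf leaf))) (node 6341097 (+ 303937920) (node 6341034 (-[1+ 252564479 ]) (node 6341033 (+ 303937920)
  leaf leaf) (node 6341096 (+ 101360160) leaf leaf)) (node 6341123 (+ 97025760) (node 6341098 (-[1+ 252564479 ]) leaf leaf) (node 6341124 (+ 880935840)
  leaf leaf)))) (node 6341253 (+ 381157920) (node 6341131 (+ 31112640) (node 6341128 (+ 151340040) (node 6341127 (+ 384376320) (node 6341126 (+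
  322957440) leaf leaf) leaf) (node 6341129 (+ 22754124) leaf leaf)) (node 6341251 (-[1+ 25898399 ]) (node 6341195 (+ 61061760) leaf leaf) (node 6341252
  (+ 79856640) leaf leaf))) (node 6341380 (+ 199630080) (node 6341255 (+ 1330560) (node 6341254 (+ 12972960) leaf leaf) (node 6341379 (+ 298473120) leaf
  leaf)) (node 6341507 (+ 93566880) (node 6341381 (+ 9836640) leaf leaf) (node 6341508 (+ 46592640) leaf leaf))))))) (node 6406533 (+ 3706560) (node
  6357382 (+ 436260384) (node 6345731 (+ 93899520) (node 6342147 (+ 40511520) (node 6341891 (-[1+ 25898399 ]) (node 6341763 (+ 59822676) (node 6341636 (+
  46592640) (node 6341635 (+ 104209560) leaf leaf) leaf) (node 6341764 (+ 46592640) leaf leaf)) (node 6342019 (+ 135799200) (node 6341892 (+ 46592640)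
  leaf leaf) (node 6342084 (-[1+ 43231679 ]) leaf leaf))) (node 6342915 (-[1+ 7009559 ]) (node 6342659 (-[1+ 7009559 ]) (node 6342403 (+ 86343840) (node
  6342275 (-[1+ 25898399 ]) leaf leaf) leaf) (node 6342787 (-[1+ 7009559 ]) leaf leaf)) (node 6343555 (-[1+ 7009559 ]) (node 6343043 (-[1+ 1544399 ])
  leaf leaf) (node 6345603 (+ 13923360) leaf leaf)))) (node 6353987 (+ 3849120) (node 6346051 (-[1+ 26088479 ]) (node 6345923 (-[1+ 85868639 ]) (node
  6345859 (-[1+ 85868639 ]) (node 6345795 (-[1+ 55645919 ]) leaf leaf) leaf) (node 6345987 (-[1+ 26088479 ]) leaf leaf)) (node 6349387 (+ 17830080) (node
  6349323 (+ 17830080) leaf leaf) (node 6353923 (+ 93899520) leaf leaf))) (node 6354243 (-[1+ 26088479 ]) (node 6354115 (-[1+ 85868639 ]) (node 6354051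
  (-[1+ 85868639 ]) leaf leaf) (node 6354179 (-[1+ 26088479 ]) leaf leaf)) (node 6357380 (+ 911479680) (node 6357379 (+ 171737280) leaf leaf) (node
  6357381 (+ 976417920) leaf leaf))))) (node 6366595 (-[1+ 17238239 ]) (node 6357636 (+ 13328640) (node 6357507 (+ 97025760) (node 6357385 (+ 160774632)
  (node 6357384 (+ 200376144) (node 6357383 (+ 446809824) leaf leaf) leaf) (node 6357387 (+ 74459520) leaf leaf)) (node 6357509 (+ 123647040) (node
  6357508 (+ 425802240) leaf leaf) (node 6357635 (-[1+ 25898399 ]) leaf leaf))) (node 6358147 (+ 59822676) (node 6357891 (+ 93566880) (node 6357763 (+
  298473120) leaf leaf) (node 6358019 (+ 104209560) leaf leaf)) (node 6358403 (-[1+ 17238239 ]) (node 6358275 (-[1+ 25898399 ]) leaf leaf) (node 6365579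
  (+ 74459520) leaf leaf)))) (node 6374275 (+ 81259200) (node 6373891 (+ 97025760) (node 6373765 (+ 183522240) (node 6373764 (+ 106513920) (node 6373763
  (+ 171737280) leaf leaf) leaf) (node 6373767 (+ 10549440) leaf leaf)) (node 6374019 (-[1+ 25898399 ]) (node 6373892 (+ 46592640) leaf leaf) (node
  6374147 (+ 298473120) leaf leaf))) (node 6390275 (+ 97025760) (node 6390148 (+ 106513920) (node 6390147 (+ 171737280) leaf leaf) (node 6390149 (+
  3706560) leaf leaf)) (node 6406531 (+ 171737280) (node 6390403 (-[1+ 25898399 ]) leaf leaf) (node 6406532 (+ 106513920) leaf leaf)))))) (node 7414155
  (+ 74459520) (node 6480451 (-[1+ 25993439 ]) (node 6455683 (+ 171737280) (node 6423043 (+ 97025760) (node 6422915 (+ 171737280) (node 6406787 (-[1+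
  85868639 ]) (node 6406659 (+ 97025760) leaf leaf) leaf) (node 6422916 (+ 106513920) leaf leaf)) (node 6439300 (+ 106513920) (node 6439299 (+ 171737280)
  leaf leaf) (node 6439427 (+ 97025760) leaf leaf))) (node 6472132 (-[1+ 33379199 ]) (node 6472067 (+ 171737280) (node 6455811 (+ 67122720) (node 6455684
  (+ 135717120) leaf leaf) leaf) (node 6472068 (-[1+ 33379199 ]) leaf leaf)) (node 6472259 (-[1+ 25993439 ]) (node 6472195 (-[1+ 39275999 ]) leaf leaf)
  (node 6480387 (-[1+ 25993439 ]) leaf leaf)))) (node 6930819 (+ 171737280) (node 6570371 (+ 171737280) (node 6521219 (+ 171737280) (node 6504835 (+
  171737280) (node 6488451 (+ 171737280) leaf leaf) leaf) (node 6553987 (+ 171737280) leaf leaf)) (node 6603139 (+ 171737280) (node 6586755 (+ 171737280)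
  leaf leaf) (node 6668675 (+ 171737280) leaf leaf))) (node 6971779 (+ 51796800) (node 6955395 (+ 51986880) (node 6947203 (+ 51986880) leaf leaf) (node
  6963587 (+ 51796800) leaf leaf)) (node 6988163 (+ 331508160) (node 6979971 (+ 331508160) leaf leaf) (node 7406979 (-[1+ 17238239 ]) leaf leaf)))))
  (node 9487747 (-[1+ 33240959 ]) (node 8438659 (+ 34118928) (node 8438275 (+ 66481920) (node 8020355 (+ 51796800) (node 8003971 (+ 171737280) (node
  7415171 (-[1+ 17238239 ]) leaf leaf) leaf) (node 8036739 (+ 51986880) leaf leaf)) (node 8438403 (+ 125144640) (node 8438277 (+ 202245120) leaf leaf)
  (node 8438531 (+ 187656048) leaf leaf))) (node 8439171 (-[1+ 33240959 ]) (node 8438915 (-[1+ 20546675 ]) (node 8438787 (+ 46138968) leaf leaf) (node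
  8439043 (-[1+ 23950079 ]) leaf leaf)) (node 8454787 (+ 125144640) (node 8454659 (+ 66481920) leaf leaf) (node 8471043 (+ 66481920) leaf leaf)))) (node
  140689860 (-[1+ 33379199 ]) (node 23126595 (-[1+ 33240959 ]) (node 10535811 (-[1+ 7698239 ]) (node 10535683 (+ 145838880) (node 10535555 (+ 171737280)
  leaf leaf) leaf) (node 23118403 (-[1+ 33240959 ]) leaf leaf)) (node 140558825 (+ 303937920) (node 140558824 (+ 12165120) leaf leaf) (node 140558826 (+
  26956800) leaf leaf))) (node 811647491 (+ 97025760) (node 811647364 (+ 380560320) (node 811647363 (+ 391184640) leaf leaf) (node 811647365 (+ 3706560)
  leaf leaf)) (node 811663747 (+ 171737280) (node 811647619 (-[1+ 25898399 ]) leaf leaf) (node 811680131 (+ 171737280) leaf leaf)))))))))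

edgeTransfers : Table
edgeTransfers =
  (node 219018421373813123 (-[1+ 59875199 ]) (node 217918909681041795 (+ 59875200) (node 6249727177852291 (+ 19958400) (node 6240931086910851 (+
  26657280) (node 6240931078686083 (+ 13328640) (node 2898450096128644 (-[1+ 13328639 ]) leaf leaf) leaf) (node 6249727171708291 (-[1+ 6629759 ]) (node
  6249727171675523 (+ 13328640) leaf leaf) leaf)) (node 22548887541765123 (-[1+ 119465279 ]) (node 7366830985496195 (+ 190080) (node 6249727179933059
  (-[1+ 33217919 ]) leaf leaf) leaf) (node 23111837501412483 (+ 236079360) (node 23111837495186563 (-[1+ 486414719 ]) leaf leaf) leaf))) (node
  218473063541440899 (-[1+ 12070079 ]) (node 218042054974980483 (-[1+ 59970239 ]) (node 218042054967198083 (-[1+ 79885439 ]) (node 218037656928469379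
  (-[1+ 59875199 ]) leaf leaf) leaf) (node 218046453021491587 (-[1+ 59875199 ]) (node 218042054983352707 (-[1+ 95039 ]) leaf leaf) leaf)) (node
  219018421369618819 (-[1+ 59875199 ]) (node 218473063604339075 (-[1+ 95039 ]) (node 218473063545618819 (+ 59875200) leaf leaf) leaf) (node
  219018421371715971 (-[1+ 59970239 ]) leaf leaf)))) (node 506105374070326149 (-[1+ 6130079 ]) (node 289967707625931267 (-[1+ 33379199 ]) (node
  289963309579420163 (-[1+ 59921279 ]) (node 289963309562774019 (+ 89124480) (node 239829977462260099 (-[1+ 79885439 ]) leaf leaf) leaf) (node
  289967707623834115 (-[1+ 59921279 ]) (node 289967707609268739 (+ 29903040) leaf leaf) leaf)) (node 362553101582123652 (-[1+ 13328639 ]) (node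
  294436122879115779 (+ 89124480) (node 293873172927791619 (+ 29903040) leaf leaf) leaf) (node 362553101588169348 (+ 66528000) leaf leaf))) (node
  794340079549089155 (-[1+ 3314879 ]) (node 794335715862300036 (-[1+ 106467839 ]) (node 507231205261886339 (+ 12307680) (node 506114101443904387 (+
  12307680) leaf leaf) leaf) (node 794340079542945155 (-[1+ 33217919 ]) (node 794340079542912387 (+ 26657280) leaf leaf) leaf)) (node 2956063502634177667
  (+ 236079360) (node 794898631458080131 (-[1+ 3314879 ]) (node 794898631449855363 (+ 19958400) leaf leaf) leaf) (node 3028121096678331651 (+ 60065280)
  leaf leaf)))))

starTransfers : Table
starTransfers =
  (node 275295824663069059 (-[1+ 119940479 ]) (node 218325728968221059 (+ 93173760) (node 218044253991510403 (+ 186347520) (node 218039855944974723 (+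
  119940480) (node 218039855943909763 (+ 59875200) (node 218037656920678787 (-[1+ 119750399 ]) leaf leaf) (node 218039855943926147 (+ 59970240) leaf
  leaf)) (node 218039855944999299 (+ 59875200) (node 218039855944982915 (+ 59970240) leaf leaf) (node 218044253990437251 (+ 119940480) leaf leaf))) (node
  218319131898454403 (-[1+ 33108479 ]) (node 218319131897389443 (-[1+ 179720639 ]) (node 218319131897373059 (-[1+ 119750399 ]) leaf leaf) (node
  218319131898438019 (-[1+ 119750399 ]) leaf leaf)) (node 218325728967156099 (-[1+ 119940479 ]) (node 218323529943900547 (-[1+ 239880959 ]) leaf leaf)
  (node 218325728968196483 (+ 119940480) leaf leaf)))) (node 239548502617670019 (+ 119940480) (node 222382926890869123 (+ 199584000) (node
  222382926889820547 (+ 156352320) (node 218754538503586179 (+ 156352320) leaf leaf) (node 222382926890860931 (+ 156352320) leaf leaf)) (node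
  239267027640959363 (+ 59970240) (node 238704077687538051 (+ 59875200) leaf leaf) (node 239267027643056515 (+ 119940480) leaf leaf))) (node
  274732874573332867 (-[1+ 119750399 ]) (node 254501860545839491 (+ 156352320) (node 239548502620815747 (+ 119940480) leaf leaf) (node 254783335522550147
  (+ 199584000) leaf leaf)) (node 275295824526754179 (-[1+ 179720639 ]) (node 275295824525705603 (-[1+ 119750399 ]) leaf leaf) (node 275295824528851331
  (-[1+ 239880959 ]) leaf leaf))))) (node 794337915019773316 (+ 106467840) (node 289967707609293315 (+ 123019200) (node 276140249590055299 (+ 59875200)
  (node 275577299636633987 (+ 59970240) (node 275577299503464835 (-[1+ 119750399 ]) leaf leaf) (node 276140249456886147 (-[1+ 33108479 ]) leaf leaf))
  (node 276140249593201027 (+ 93173760) (node 276140249592152451 (+ 186347520) leaf leaf) (node 289967707609285123 (-[1+ 20050559 ]) leaf leaf))) (node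
  325996504628257283 (+ 123019200) (node 294436122881221123 (-[1+ 63282239 ]) (node 294436122881212931 (-[1+ 20050559 ]) leaf leaf) (node
  325996504628249091 (-[1+ 63282239 ]) leaf leaf)) (node 330464919900185091 (+ 123019200) (node 330464919900176899 (+ 123019200) leaf leaf) (node
  794335715862300036 (+ 13282560) leaf leaf)))) (node 794898631459128707 (+ 156352320) (node 794621554525799811 (+ 156352320) (node 794340079550145923
  (-[1+ 43231679 ]) (node 794340079549089155 (+ 113120640) leaf leaf) (node 794342278573401475 (-[1+ 43231679 ]) leaf leaf)) (node 794623753550112131
  (-[1+ 43231679 ]) (node 794621554526856579 (-[1+ 43231679 ]) leaf leaf) (node 794898631458080131 (+ 113120640) leaf leaf))) (node 831208903589021059
  (-[1+ 43231679 ]) (node 831208903454803331 (-[1+ 43231679 ]) (node 831208903453754755 (-[1+ 43231679 ]) leaf leaf) (node 831208903587972483 (-[1+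
  43231679 ]) leaf leaf)) (node 7603778318086763715 (+ 119940480) (node 7495691927029863491 (-[1+ 60445439 ]) leaf leaf) (node 7675835912124691779 (-[1+
  33108479 ]) leaf leaf))))))

smaller : ℕ → ℕ → ℕ
smaller a b = if a <ᵇ b then a else b

-- The shares are invariant under reflection, so the table keeps one representative of each mirror
-- pair.
share : State → ℤ
share X = find shares (smaller (code X) (code (mirror X)))

pairCode : State → State → ℕ
pairCode X Y = code X ℕ.+ 34359738368 ℕ.* code Y

-- The first term depends only on the types of the two vertices, the second also on their marks,
-- that is, on which further neighbours they recognise.
give : State → State → ℤ
give X Y = find edgeTransfers (pairCode (lab X) (lab Y)) ℤ.+ find starTransfers (pairCode X Y)

module Small = Scheme labels (corners 720720) known seen share give (λ _ _ → true)

-- By cases on t: for a neutral t the type checker would unfold the product into k summands.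
scaled : ℕ → ℕ → ℤ → ℤ
scaled k m (+ n)    = + k ℤ.* (+ n ℤ.- + m)
scaled k m -[1+ n ] = + k ℤ.* (-[1+ n ] ℤ.- + m)

scaled-≡ : ∀ k m t → scaled k m t ≡ + k ℤ.* (t ℤ.- + m)
scaled-≡ k m (+ n)    = refl
scaled-≡ k m -[1+ n ] = refl

-- The excess of the curvature over 1/104 = 6930/720720; sizes above 41 are at most 85, and 720720/85 > 8479.
small-vertexOK : Small.VertexOK (λ A → scaled 17280 6930 (charge half (withLarge (+ 8479)) A))
small-vertexOK = record { check = refl }

-- All sizes from 3 to 85 under their labels; the 44 sizes from 42 to 85 share the label 42.
lengths : List (ℕ × List ℕ)
lengths = (3 , 3 ∷ []) ∷ (4 , 4 ∷ []) ∷ (5 , 5 ∷ []) ∷ (6 , 6 ∷ []) ∷ (7 , 7 ∷ []) ∷ (8 , 8 ∷ []) ∷ (9 , 9 ∷ []) ∷ (10 , 10 ∷ []) ∷ (11 , 11 ∷ []) ∷ (12 , 12 ∷ []) ∷ (13 , 13 ∷ []) ∷ (14 , 14 ∷ []) ∷ (16 , 15 ∷ 16 ∷ []) ∷ (17 , 17 ∷ []) ∷ (18 , 18 ∷ []) ∷ (19 , 19 ∷ []) ∷ (23 , 20 ∷ 21 ∷ 22 ∷ 23 ∷ []) ∷ (39 , 24 ∷ 25 ∷ 26 ∷ 27 ∷ 28 ∷ 29 ∷ 30 ∷ 31 ∷ 32 ∷ 33 ∷ 34 ∷ 35 ∷ 36 ∷ 37 ∷ 38 ∷ 39 ∷ [])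 ∷ (40 , 40 ∷ []) ∷ (41 , 41 ∷ []) ∷ (42 , applyUpTo (42 ℕ.+_) 44) ∷ []

small-facesOK : Small.FacesOK lengths
small-facesOK = record { check = refl }

cubes-snoc : ∀ x xs → cubes (xs ∷ʳ x) ≡ cubes (x ∷ xs)
cubes-snoc x []       = refl
cubes-snoc x (y ∷ ys) = trans (cong (y ℕ.* y ℕ.* y ℕ.+_) (cubes-snoc x ys)) (exchange (y ℕ.* y ℕ.* y) (x ℕ.* x ℕ.* x) (cubes ys))
  where
  exchange : ∀ a b c → a ℕ.+ (b ℕ.+ c) ≡ b ℕ.+ (a ℕ.+ c)
  exchange a b c = trans (sym (ℕₚ.+-assoc a b c)) (trans (cong (ℕ._+ c) (ℕₚ.+-comm a b)) (ℕₚ.+-assoc b a c))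

-- A sum of cubes does not change under rotation. Should two types have the same sum, more vertices
-- are merely kept unmerged, which is harmless.
known-rot : ∀ A → known (rot A) ≡ known A
known-rot []      = refl
known-rot (x ∷ A) rewrite cubes-snoc x A = refl

covered : ℕ → Bool
covered n = if 3 ≤ᵇ n then any (λ p → (proj₁ p ≡ᵇ cap n) ∧ any (_≡ᵇ n) (proj₂ p)) lengths else true

find-∈ : ∀ (q : ℕ × List ℕ → Bool) ps → any q ps ≡ true → ∃ λ p → p ∈ ps × q p ≡ true
find-∈ q (p ∷ ps) e with q p in eq
... | true  = p , here refl , eq
... | false with find-∈ q ps e
...   | p′ , m , e′ = p′ , there m , e′

covered-sound : ∀ n → 3 ℕ.≤ n → n ℕ.≤ 85 → ∃ λ ns → (cap n , ns) ∈ lengths × n ∈ ns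
covered-sound n 3≤n n≤85 = unpack (find-∈ q lengths (strip (all-∈ covered {upTo 86} refl (∈-upTo (s≤s n≤85)))))
  where
  q : ℕ × List ℕ → Bool
  q p = (proj₁ p ≡ᵇ cap n) ∧ any (_≡ᵇ n) (proj₂ p)
  strip : covered n ≡ true → any q lengths ≡ true
  strip = subst (λ b → (if b then any q lengths else true) ≡ true) (Equivalence.to T-≡ (ℕₚ.≤⇒≤ᵇ 3≤n))
  unpack : (∃ λ p → p ∈ lengths × q p ≡ true) → ∃ λ ns → (cap n , ns) ∈ lengths × n ∈ ns
  unpack ((k , ns) , m , e) = ns , subst (λ k → (k , ns) ∈ lengths) (≡ᵇ-sound k (cap n) (proj₁ (∧-true e))) m , any-≡ n ns (proj₂ (∧-true {k ≡ᵇ cap n} e))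

-- A mean of at least `m` and a total of at most `b * m` allow at most `b` terms. It is applied with
-- 208 · 6930 = 1441440, the whole curvature of the sphere.
average : ∀ k m b {n} (g : Fin n → ℤ) → .{{_ : ℕ.NonZero k}} → .{{_ : ℕ.NonZero m}} →
          0ℤ ℤ.≤ sum (λ v → scaled k m (g v)) → sum g ℤ.≤ + (b ℕ.* m) → n ℕ.≤ b
average (suc k) m b {n} g p q = ℕₚ.*-cancelʳ-≤ n b m (ℤₚ.drop‿+≤+ (ℤₚ.≤-trans lower-bound q))
  where
  N M : ℤ
  N = + n
  M = + m
  nonneg : 0ℤ ℤ.≤ sum g ℤ.+ N ℤ.* (ℤ.- M)
  nonneg = subst (0ℤ ℤ.≤_) (trans (∑-distrib-+ {n} g (λ _ → ℤ.- M)) (cong (ℤ._+_ (sum g)) (∑-const n (ℤ.- M))))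
    (ℤₚ.*-cancelˡ-≤-pos 0ℤ (sum (λ v → g v ℤ.- M)) (+ suc k)
      (subst₂ ℤ._≤_ (sym (ℤₚ.*-zeroʳ (+ suc k))) (trans (sum-cong-≗ {n} (λ v → scaled-≡ (suc k) m (g v))) (∑-* (+ suc k) (λ v → g v ℤ.- M))) p))
  collapse : sum g ℤ.+ N ℤ.* (ℤ.- M) ℤ.+ N ℤ.* M ≡ sum g
  collapse = trans (ℤₚ.+-assoc (sum g) (N ℤ.* (ℤ.- M)) (N ℤ.* M)) (trans (cong (ℤ._+_ (sum g))
    (trans (sym (ℤₚ.*-distribˡ-+ N (ℤ.- M) M)) (trans (cong (N ℤ.*_) (ℤₚ.+-inverseˡ M)) (ℤₚ.*-zeroʳ N)))) (ℤₚ.+-identityʳ (sum g)))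
  lower-bound : + (n ℕ.* m) ℤ.≤ sum g
  lower-bound = subst₂ ℤ._≤_ (trans (ℤₚ.+-identityˡ (N ℤ.* M)) (sym (ℤₚ.pos-* n m))) collapse (ℤₚ.+-monoˡ-≤ (N ℤ.* M) nonneg)

light : ℕ → Bool
light s = (+ s ℤ.* withLarge (+ 8479) (cap s)) ℤ.≤ᵇ + 720720

module SmallFaces (M : Map) (simple : Simple M) (spherical : Spherical M)
  (positive : PositivelyCurved M) (deg≥3 : ∀ v → 3 ℕ.≤ Maps.deg′ M v)
  (small : ∀ f → Maps.size′ M f ℕ.≤ 85) where

  open Positive M simple spherical positive deg≥3
  open Small.Apply M cap cap<64 known-rot complete using (A; A≡; X; net; discharge-net; vertexOK-sound; facesOK-sound)

  u : ℕ → ℤ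
  u = withLarge (+ 8479) ∘ cap

  faces-OK : ∀ d → ¬ (∀ j → 0 ℕ.< j → j ℕ.≤ sz d → walk net d j ℤ.< 0ℤ)
  faces-OK d = go (covered-sound (sz d) (sz≥3 d) (small (face d)))
    where
    go : (∃ λ ns → (cap (sz d) , ns) ∈ lengths × sz d ∈ ns) → ¬ (∀ j → 0 ℕ.< j → j ℕ.≤ sz d → walk net d j ℤ.< 0ℤ)
    go (ns , m , n∈) = facesOK-sound (λ _ → refl) (cap (sz d)) small-facesOK d m refl n∈

  charge≡ : ∀ d → charge half (withLarge (+ 8479)) (A d) ≡ vcharge half u (vert d)
  charge≡ d = trans (cong (charge half (withLarge (+ 8479))) (A≡ d)) (sym (charge-cap (withLarge (+ 8479)) d))

  vertices : ∀ d → orbit-sum (share ∘ X) d ℤ.≤ scaled 17280 6930 (vcharge half u (vert d))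
  vertices d = subst (λ t → orbit-sum (share ∘ X) d ℤ.≤ scaled 17280 6930 t) (charge≡ d) (vertexOK-sound small-vertexOK d)

  bound : V ℕ.≤ 208
  bound = average 17280 6930 208 (vcharge half u)
    (discharge-net (λ v → scaled 17280 6930 (vcharge half u v)) vertices faces-OK)
    (subst (sum (vcharge half u) ℤ.≤_) (cong (λ t → + 1441440 ℤ.- t) (sum-replicate-zero F)) (total-≤ u (λ _ → 0ℤ) light-faces))
    where
    light-faces : ∀ f → + size′ f ℤ.* u (size′ f) ℤ.≤ + 720720 ℤ.- 0ℤ
    light-faces f = ℤₚ.≤ᵇ⇒≤ (Equivalence.from T-≡ (all-∈ light {upTo 86} refl (∈-upTo (s≤s (small f)))))

-- The case distinction by the largest face.

open Map using (V; F; size)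

theorem3p1 : (M : Map) → PCC M → V M ≤ 208
theorem3p1 M ((simple , spherical) , curved , deg≥3 , ¬prism , ¬antiprism) = by-largest (Finₚ.any? (λ f → 86 ℕₚ.≤? size M f))
  where
  positive : PositivelyCurved M
  positive = record { curved = curved }

  -- A second face of size at least 42 would make the map a prism or an antiprism, which a PCC graph
  -- is not.
  no-other : ∀ f → 86 ≤ size M f → ∀ g → g ≢ f → size M g ℕ.< 42
  no-other f big g g≢f = ℕₚ.≰⇒> λ large → [ ¬prism , ¬antiprism ]′
    (Two.prism-or-antiprism M simple spherical positive deg≥3 f g (g≢f ∘ sym) (ℕₚ.≤-trans (ℕₚ.m≤m+n 42 44) big) large)

  by-largest : Dec (∃ λ f → 86 ≤ size M f) → V M ≤ 208
  by-largest (yes (f , big)) = ⊥-elim (Closure.One.contradiction M simple spherical positive deg≥3 f big (no-other f big))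
  by-largest (no  none)      = SmallFaces.bound M simple spherical positive deg≥3 λ f → ℕₚ.≤-pred (ℕₚ.≰⇒> λ big → none (f , big))
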